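{- Let $H$ be a regular graph on $n \geq 3$ vertices which contains a $2$-factor. If $G$ is a $d$-degenerate graph, then (1) $\mathrm{mind}(G\,\Box\,H) \leq nd + \mathrm{mind}(H)$ and (2) $\mathrm{ch}_\Sigma^e(G\,\Box\,H) \leq nd + \mathrm{mind}(H) + 1$.
   Context: All graphs are finite, simple and loopless. A $2$-factor is a spanning $2$-regular subgraph. A graph is $d$-degenerate if every induced subgraph of it has a vertex of degree (in that subgraph) at most $d$. The Cartesian product $G\,\Box\,H$ has vertex set $V(G)\times V(H)$, with $(u,u')$ and $(v,v')$ adjacent if and only if either $u=v$ and $u'v'\in E(H)$, or $u'=v'$ and $uv\in E(G)$. Monomial index. For a polynomial $P \in \mathbb{R}[x_1,\ldots,x_m]$ and a monomial $M$ occurring in $P$ with nonzero coefficient (after full expansion), let $h(M)$ be the largest exponent of any variable in $M$. The monomial index $\mathrm{mind}(P)$ is the minimum of $h(M)$ over all monomials $M$ of $P$ with nonzero coefficient (with $\mathrm{mind}(0)=\infty$). For a graph $G$ with edges $e_1,\ldots,e_m$, associate the variable $x_i$ with $e_i$, and for each vertex $v$ put $X_v = \sum_{e_i \ni v} x_i$. For an orientation $D$ of $G$ let $P_D(x_1,\ldots,x_m) = \prod_{(u,v)\in E(D)} (X_v - X_u)$. Define $\mathrm{mind}(G) = \mathrm{mind}(P_D)$; this does not depend on the orientation $D$, since changing $D$ changes $P_D$ only by a sign. Edge weight choosability number. $\mathrm{ch}_\Sigma^e(G)$ is the smallest positive integer $k$ such that for every assignment of a list $L_e$ of $k$ real numbers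 to each edge $e$ of $G$ there is a choice of weights $w(e)\in L_e$ ($e \in E(G)$) for which $v \mapsto \sum_{e\ni v} w(e)$ is a proper colouring of $V(G)$ (adjacent vertices get different sums). -}

module Defs where

open import Level using (0ℓ)
open import Data.Nat.Base as ℕ using (ℕ)
import Data.Nat.Properties as ℕ
open import Data.Integer.Base as ℤ using (ℤ; 0ℤ; 1ℤ)
import Data.Integer.Properties as ℤ
open import Data.Rational.Base as ℚ using (ℚ; 0ℚ; ½; ∣_∣)
import Data.Rational.Properties as ℚ
open import Data.Bool.Base using (Bool; true; if_then_else_)
open import Data.Fin.Base as Fin using (Fin; remQuot)
import Data.Fin.Properties as Fin
open import Data.Fin.Subset using (Subset; Nonempty; _∈_; _∩_) renaming (∣_∣ to card)
open import Data.List.Base as List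
  using (List; []; _∷_; _++_; map; foldr; filter; allFin; length;
         cartesianProduct; cartesianProductWith)
open import Data.List.Extrema.Nat using (min)
open import Data.Maybe.Base using (zipWith)
open import Data.Product.Base using (Σ-syntax; ∃-syntax; _×_; _,_; proj₁; proj₂; swap)
open import Data.Sum.Base as Sum using (_⊎_; inj₁; inj₂)
open import Data.Vec.Base as Vec using (Vec)
import Data.Vec.Membership.Propositional as Vec
open import Data.Vec.Properties using (≡-dec)
open import Data.Vec.Relation.Unary.AllPairs using (AllPairs)
open import Function.Base using (const)
open import Function.Bundles using (_⇔_; mk⇔)
open import Relation.Binary.Core using (Rel)
open import Relation.Binary.Definitions using (Symmetric; Irreflexive; Decidable)
open import Relation.Binary.PropositionalEquality
open import Relation.Nullary.Decidable using (does; ¬?; _×-dec_; _⊎-dec_)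
open import Relation.Nullary.Construct.Add.Supremum using (_⁺; [_]; ⊤⁺) public
import Relation.Binary.Construct.Add.Supremum.NonStrict ℕ._≤_ as Sup
open Sup using () renaming (_≤⁺_ to _≤∞_) public

ℕ∞ : Set
ℕ∞ = ℕ ⁺

infixl 6 _+∞_

_+∞_ : ℕ∞ → ℕ∞ → ℕ∞
_+∞_ = zipWith ℕ._+_

minimum : List ℕ → ℕ∞
minimum []       = ⊤⁺
minimum (k ∷ ks) = [ min k ks ]

-- Real numbers: Cauchy sequences of rationals.  No quotient is taken;
-- distinctness of reals is the apartness relation _#_, which is
-- classically the negation of equality of limits.

record ℝ : Set where
  constructor mkℝ
  field
    approx : ℕ → ℚ
    cauchy : ∀ ε → 0ℚ ℚ.< ε → ∃[ N ] (∀ i j → N ℕ.≤ i → N ℕ.≤ j →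
             ∣ approx i ℚ.- approx j ∣ ℚ.< ε)

open ℝ public

infix 4 _#_

_#_ : Rel ℝ 0ℓ
x # y = ∃[ ε ] (0ℚ ℚ.< ε × ∃[ N ] (∀ i → N ℕ.≤ i →
        ε ℚ.≤ ∣ approx x i ℚ.- approx y i ∣))

0ℝ : ℝ
0ℝ = mkℝ (const 0ℚ) λ ε 0<ε → 0 , λ _ _ _ _ → 0<ε

private
  half-pos : ∀ {ε} → 0ℚ ℚ.< ε → 0ℚ ℚ.< ½ ℚ.* ε
  half-pos {ε} 0<ε = subst (ℚ._< ½ ℚ.* ε) (ℚ.*-zeroʳ ½) (ℚ.*-monoʳ-<-pos ½ 0<ε)

  halves : ∀ ε → ½ ℚ.* ε ℚ.+ ½ ℚ.* ε ≡ ε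
  halves ε = trans (sym (ℚ.*-distribʳ-+ ε ½ ½)) (ℚ.*-identityˡ ε)

  interchange : ∀ a b c d → (a ℚ.+ b) ℚ.- (c ℚ.+ d) ≡ (a ℚ.- c) ℚ.+ (b ℚ.- d)
  interchange a b c d = begin
    (a ℚ.+ b) ℚ.- (c ℚ.+ d)             ≡⟨ cong (a ℚ.+ b ℚ.+_) (ℚ.neg-distrib-+ c d) ⟩
    (a ℚ.+ b) ℚ.+ (ℚ.- c ℚ.+ ℚ.- d)     ≡⟨ ℚ.+-assoc a b _ ⟩
    a ℚ.+ (b ℚ.+ (ℚ.- c ℚ.+ ℚ.- d))     ≡⟨ cong (a ℚ.+_) (ℚ.+-assoc b (ℚ.- c) (ℚ.- d)) ⟨
    a ℚ.+ ((b ℚ.+ ℚ.- c) ℚ.+ ℚ.- d)     ≡⟨ cong (λ t → a ℚ.+ (t ℚ.+ ℚ.- d)) (ℚ.+-comm b (ℚ.- c)) ⟩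
    a ℚ.+ ((ℚ.- c ℚ.+ b) ℚ.+ ℚ.- d)     ≡⟨ cong (a ℚ.+_) (ℚ.+-assoc (ℚ.- c) b (ℚ.- d)) ⟩
    a ℚ.+ (ℚ.- c ℚ.+ (b ℚ.+ ℚ.- d))     ≡⟨ ℚ.+-assoc a (ℚ.- c) _ ⟨
    (a ℚ.- c) ℚ.+ (b ℚ.- d)             ∎
    where open ≡-Reasoning

infixl 6 _+ℝ_

_+ℝ_ : ℝ → ℝ → ℝ
x +ℝ y = mkℝ (λ i → approx x i ℚ.+ approx y i) λ ε 0<ε →
  let M , p = cauchy x (½ ℚ.* ε) (half-pos 0<ε)
      N , q = cauchy y (½ ℚ.* ε) (half-pos 0<ε)
  in M ℕ.⊔ N , λ i j h k →
    let a = approx x i ; b = approx y i ; c = approx x j ; d = approx y j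
        open ℚ.≤-Reasoning
    in begin-strict
      ∣ (a ℚ.+ b) ℚ.- (c ℚ.+ d) ∣   ≡⟨ cong ∣_∣ (interchange a b c d) ⟩
      ∣ (a ℚ.- c) ℚ.+ (b ℚ.- d) ∣   ≤⟨ ℚ.∣p+q∣≤∣p∣+∣q∣ (a ℚ.- c) (b ℚ.- d) ⟩
      ∣ a ℚ.- c ∣ ℚ.+ ∣ b ℚ.- d ∣   <⟨ ℚ.+-mono-< (p i j (ℕ.m⊔n≤o⇒m≤o M N h) (ℕ.m⊔n≤o⇒m≤o M N k))
                                                  (q i j (ℕ.m⊔n≤o⇒n≤o M N h) (ℕ.m⊔n≤o⇒n≤o M N k)) ⟩
      ½ ℚ.* ε ℚ.+ ½ ℚ.* ε           ≡⟨ halves ε ⟩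
      ε                             ∎

-- Finite simple graphs with vertex set Fin n.
record Graph (n : ℕ) : Set₁ where
  field
    Adj    : Rel (Fin n) 0ℓ
    Adj?   : Decidable Adj
    symm   : Symmetric Adj
    irrefl : Irreflexive _≡_ Adj

open Graph public

neighbours : ∀ {n} → Graph n → Fin n → Subset n
neighbours G v = Vec.tabulate λ u → does (Adj? G v u)

degree : ∀ {n} → Graph n → Fin n → ℕ
degree G v = card (neighbours G v)

IsRegularOf : ℕ → ∀ {n} → Graph n → Set
IsRegularOf r G = ∀ v → degree G v ≡ r

Regular : ∀ {n} → Graph n → Set
Regular G = ∃[ r ] IsRegularOf r G

HasTwoFactor : ∀ {n} → Graph n → Set₁
HasTwoFactor {n} G = Σ[ F ∈ Graph n ] (∀ u v → Adj F u v → Adj G u v) × IsRegularOf 2 F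

-- The induced subgraphs G[S] range over the nonempty vertex sets S, and
-- card (neighbours G v ∩ S) is the degree of v in G[S].
Degenerate : ℕ → ∀ {n} → Graph n → Set
Degenerate d {n} G = ∀ (S : Subset n) → Nonempty S →
  ∃[ v ] v ∈ S × card (neighbours G v ∩ S) ℕ.≤ d

-- Fin (m * n) stands for Fin m × Fin n through the bijection remQuot n.
infixr 7 _□_

_□_ : ∀ {m n} → Graph m → Graph n → Graph (m ℕ.* n)
_□_ {m} {n} G H = record
  { Adj    = λ x y → A (remQuot n x) (remQuot n y)
  ; Adj?   = λ x y → A? (remQuot n x) (remQuot n y)
  ; symm   = Sum.map (λ (e , a) → sym e , symm H a) (λ (e , a) → sym e , symm G a)
  ; irrefl = λ { refl (inj₁ (_ , a)) → irrefl H refl a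
               ; refl (inj₂ (_ , a)) → irrefl G refl a }
  }
  where
  A : Rel (Fin m × Fin n) 0ℓ
  A (u , u′) (v , v′) = (u ≡ v × Adj H u′ v′) ⊎ (u′ ≡ v′ × Adj G u v)

  A? : Decidable A
  A? (u , u′) (v , v′) =
    (u Fin.≟ v ×-dec Adj? H u′ v′) ⊎-dec (u′ Fin.≟ v′ ×-dec Adj? G u v)

-- Each edge is listed once, as the pair (u , v) of its ends with u < v.
edges : ∀ {n} → Graph n → List (Fin n × Fin n)
edges {n} G = filter (λ (u , v) → (u Fin.<? v) ×-dec Adj? G u v)
                     (cartesianProduct (allFin n) (allFin n))

size : ∀ {n} → Graph n → ℕ
size G = length (edges G)

ends : ∀ {n} (G : Graph n) → Fin (size G) → Fin n × Fin n
ends G = List.lookup (edges G)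

incidentEdges : ∀ {n} (G : Graph n) → Fin n → List (Fin (size G))
incidentEdges G v =
  filter (λ e → (v Fin.≟ proj₁ (ends G e)) ⊎-dec (v Fin.≟ proj₂ (ends G e)))
         (allFin (size G))

-- Polynomials in m variables, as unreduced sums of terms
-- (coefficient , exponent vector).  Only the polynomials P G D below are
-- needed; their coefficients are integers, and whether a coefficient
-- vanishes is the same in ℤ as in ℝ.

Monomial : ℕ → Set
Monomial m = Vec ℕ m

Poly : ℕ → Set
Poly m = List (ℤ × Monomial m)

module _ {m : ℕ} where

  var : Fin m → Poly m
  var i = (1ℤ , Vec.replicate m 0 Vec.[ i ]≔ 1) ∷ []

  0ₚ 1ₚ : Poly m
  0ₚ = []
  1ₚ = (1ℤ , Vec.replicate m 0) ∷ []

  infixl 6 _+ₚ_ _-ₚ_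
  infixl 7 _*ₚ_

  _+ₚ_ _-ₚ_ _*ₚ_ : Poly m → Poly m → Poly m
  p +ₚ q = p ++ q
  p -ₚ q = p ++ map (λ (c , M) → ℤ.- c , M) q
  p *ₚ q = cartesianProductWith (λ (c , M) (d , N) → c ℤ.* d , Vec.zipWith ℕ._+_ M N) p q

  -- The coefficient of M after collecting like terms.
  coeff : Poly m → Monomial m → ℤ
  coeff p M = foldr ℤ._+_ 0ℤ (map proj₁ (filter (λ t → ≡-dec ℕ._≟_ (proj₂ t) M) p))

  monomials : Poly m → List (Monomial m)
  monomials p = filter (λ M → ¬? (coeff p M ℤ.≟ 0ℤ)) (map proj₂ p)

  h : Monomial m → ℕ
  h = Vec.foldr′ ℕ._⊔_ 0

  mindₚ : Poly m → ℕ∞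
  mindₚ p = minimum (map h (monomials p))

X : ∀ {n} (G : Graph n) → Fin n → Poly (size G)
X G v = foldr _+ₚ_ 0ₚ (map var (incidentEdges G v))

Orientation : ∀ {n} → Graph n → Set
Orientation G = Fin (size G) → Bool

arc : ∀ {n} (G : Graph n) → Orientation G → Fin (size G) → Fin n × Fin n
arc G D e = if D e then ends G e else swap (ends G e)

P : ∀ {n} (G : Graph n) → Orientation G → Poly (size G)
P G D = foldr _*ₚ_ 1ₚ (map (λ e → let u , v = arc G D e in X G v -ₚ X G u) (allFin (size G)))

-- The choice of orientation only affects the sign of P G D.
mind : ∀ {n} → Graph n → ℕ∞
mind G = mindₚ (P G (const true))

weightSum : ∀ {n} (G : Graph n) → (Fin (size G) → ℝ) → Fin n → ℝ
weightSum G w v = foldr _+ℝ_ 0ℝ (map w (incidentEdges G v))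

-- Every assignment of k distinct reals to each edge admits a proper
-- choice of weights.
EdgeWeightChoosable : ∀ {n} → Graph n → ℕ → Set
EdgeWeightChoosable G k =
  (L : Fin (size G) → Vec ℝ k) → (∀ e → AllPairs _#_ (L e)) →
  ∃[ w ] (∀ e → w e Vec.∈ L e) ×
         (∀ u v → Adj G u v → weightSum G w u # weightSum G w v)

IsChΣᵉ : ∀ {n} → Graph n → ℕ → Set
IsChΣᵉ G c = (1 ℕ.≤ c × EdgeWeightChoosable G c) ×
             (∀ k → 1 ℕ.≤ k → EdgeWeightChoosable G k → c ℕ.≤ k)

-- The inequality ch G ≤ b, unfolded for the minimum of a set of naturals:
-- it holds exactly when the set has an element that is at most b.  In
-- particular it asserts, also for b = ∞, that the set is nonempty.  Computing
-- ch G itself would require deciding EdgeWeightChoosable.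
chΣᵉ[_]≤_ : ∀ {n} → Graph n → ℕ∞ → Set
chΣᵉ[ G ]≤ b = ∃[ k ] (1 ℕ.≤ k × EdgeWeightChoosable G k) × [ k ] ≤∞ b

chΣᵉ≤⇔ : ∀ {n} {G : Graph n} {c b} → IsChΣᵉ G c → (chΣᵉ[ G ]≤ b) ⇔ ([ c ] ≤∞ b)
chΣᵉ≤⇔ {c = c} (isCh , least) = mk⇔
  (λ (k , (1≤k , choosable) , k≤b) → Sup.≤⁺-trans ℕ.≤-trans Sup.[ least k 1≤k choosable ] k≤b)
  (λ c≤b → c , isCh , c≤b)

{-# OPTIONS --safe #-}

-- Remove the vertices v of G one by one, each with at most d neighbours among
-- those that remain.  Let H be r-regular, and let D_v be the sum of ∂/∂x_e over
-- the edges e of the copy of H at v.  D_v annihilates every factor X_y − X_x of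
-- P (G □ H) except those of the c ≤ nd edges joining copy v to the copies that
-- remain, and takes the value ± r on these.  By the Leibniz rule D_v^c sends
-- the product to a nonzero multiple of the product of the factors of the other
-- edges.  At exponents supported on the edges of the copies of H, the
-- coefficient of the latter is the product of a coefficient of P H and of one
-- for the remaining copies.  So a monomial of P H placed on every copy comes
-- from a monomial of P (G □ H) with exponents larger by at most nd.  The same
-- elimination with single variables in place of D_v shows that mind H is
-- finite, all factors of P H being nonzero.
--
-- (2) follows from (1) by the Combinatorial Nullstellensatz.  Michałek's proof,
-- by division by x_e − a, gives over ℚ a lower bound for |P (w)| that depends
-- only on the distances between the listed values; with an upper bound for the
-- factors it keeps each factor away from 0, uniformly along the Cauchy
-- sequences of the given reals.

module Submission where

open import Defs
open import Level using (0ℓ)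
open import Algebra.Core using (Op₂)
open import Algebra.Structures using (IsCommutativeSemiring; IsCommutativeRing)
open import Data.Bool.Base as Bool using (Bool; true; false; if_then_else_)
import Data.Bool.Properties as Bool
open import Data.Fin.Base as Fin using (Fin; remQuot; combine; _↑ˡ_; _↑ʳ_)
import Data.Fin.Properties as Fin
open import Data.Fin.Subset as Subset using (Subset; _∈_; _∉_; _∩_; _⊆_; ⁅_⁆) renaming (∣_∣ to card)
import Data.Fin.Subset.Properties as Subset
open import Data.Integer.Base as ℤ using (ℤ; 0ℤ; 1ℤ; -1ℤ)
import Data.Integer.Properties as ℤ
open import Data.List.Base as List
  using (List; []; _∷_; _++_; map; foldr; filter; length; allFin; cartesianProduct)
open import Data.List.Extrema.Nat using (min; min≤⊤; min≤xs; argmin-sel)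
open import Data.List.Membership.Propositional using () renaming (_∈_ to _∈ₗ_)
open import Data.List.Membership.Propositional.Properties
  using (∈-filter⁺; ∈-filter⁻; ∈-map⁺; ∈-map⁻; ∈-allFin; ∈-cartesianProduct⁺; ∈-lookup)
import Data.List.Properties as List
open import Data.List.Relation.Unary.All as All using (All)
import Data.List.Relation.Unary.AllPairs as AllPairs
open import Data.List.Relation.Unary.Any as Any using (here; there)
import Data.List.Relation.Unary.Any.Properties as Any
open import Data.List.Relation.Unary.Unique.Propositional using (Unique)
import Data.List.Relation.Unary.Unique.Propositional.Properties as Unique
open import Data.Nat.Base as ℕ using (ℕ; zero; suc)
open import Data.Nat.Coprimality as Coprime using (1-coprimeTo)
open import Data.Nat.GeneralisedArithmetic using (fold)
import Data.Nat.Properties as ℕ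
open import Data.Product.Base as Product using (Σ-syntax; ∃-syntax; _×_; _,_; proj₁; proj₂)
import Data.Product.Properties as Product
open import Data.Rational.Base as ℚ using (ℚ; mkℚ; 0ℚ; 1ℚ; ½; ∣_∣)
import Data.Rational.Properties as ℚ
open import Data.Rational.Solver using (module +-*-Solver)
import Data.Rational.Unnormalised.Base as ℚᵘ
import Data.Rational.Unnormalised.Properties as ℚᵘ
open import Data.Sum.Base as Sum using (_⊎_; inj₁; inj₂)
open import Data.Unit.Base using (tt)
open import Data.Vec.Base as Vec using (Vec)
import Data.Vec.Membership.Propositional.Properties as Vec
import Data.Vec.Properties as Vec
import Data.Vec.Relation.Unary.All as VecAll
import Data.Vec.Relation.Unary.AllPairs as VecAllPairs
open import Function.Base using (_∘_; id; case_of_; const)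
open import Function.Bundles using (_⇔_; mk⇔)
open import Relation.Binary.Definitions using (DecidableEquality; Tri; tri<; tri≈; tri>)
open import Relation.Binary.PropositionalEquality
open import Relation.Nullary using (¬_; yes; no; contradiction; Dec)
open import Relation.Nullary.Decidable
  using (does; ¬?; dec-true; dec-false; _⊎-dec_; _×-dec_; does-⇔; decidable-stable)
open import Relation.Unary using (Pred; Decidable)
import Relation.Binary.Construct.Add.Supremum.NonStrict ℕ._≤_ as Sup

open +-*-Solver using (solve; _:+_; _:*_; _:-_; :-_; _:=_)

-- Finite sums

-- The excess over mind H stays at nd for all of G because D_v raises only the variables of copy v,
-- and no other elimination touches these. A derivative in a single variable would also hit factors
-- of edges inside copy v and so spoil the monomial of P H. Regularity is what makes the sum over
-- the whole copy blind to every factor except those of crossing edges.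
--
-- Over the reals it is not enough that P is nonzero at the approximations of some index t. The
-- approximations move afterwards, and how late t must be depends on how far each factor is from 0,
-- so the lower bound has to be known before t is chosen. It is known because the listed values
-- enter Michałek's division only through constant terms. The leading coefficients remain integers,
-- and the nonzero one at the end of the induction has absolute value at least 1. Since a quotient
-- of a product of linear forms by x_e - a is no longer such a product, the division acts on the
-- expressions `Expr`, which are closed under it.

module Summation {C : Set} {_⊕_ _⊗_ : Op₂ C} {𝟘 𝟙 : C}
                 (isSemiring : IsCommutativeSemiring _≡_ _⊕_ _⊗_ 𝟘 𝟙) where

  open IsCommutativeSemiring isSemiring
    using (+-assoc; +-comm; +-identityˡ; +-identityʳ; distribˡ; distribʳ; zeroˡ; zeroʳ)

  private variable
    A B : Set

  ∑ : List A → (A → C) → C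
  ∑ xs f = foldr (λ x s → f x ⊕ s) 𝟘 xs

  ∑-cong : ∀ (xs : List A) {f g : A → C} → (∀ {x} → x ∈ₗ xs → f x ≡ g x) → ∑ xs f ≡ ∑ xs g
  ∑-cong []       eq = refl
  ∑-cong (x ∷ xs) eq = cong₂ _⊕_ (eq (here refl)) (∑-cong xs (eq ∘ there))

  ∑-cong′ : ∀ (xs : List A) {f g : A → C} → f ≗ g → ∑ xs f ≡ ∑ xs g
  ∑-cong′ xs eq = ∑-cong xs λ {x} _ → eq x

  ∑-zero : ∀ (xs : List A) {f : A → C} → (∀ {x} → x ∈ₗ xs → f x ≡ 𝟘) → ∑ xs f ≡ 𝟘
  ∑-zero []       eq = refl
  ∑-zero (x ∷ xs) eq =
    trans (cong₂ _⊕_ (eq (here refl)) (∑-zero xs (eq ∘ there))) (+-identityˡ 𝟘)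

  private
    interchange : ∀ a b c d → (a ⊕ b) ⊕ (c ⊕ d) ≡ (a ⊕ c) ⊕ (b ⊕ d)
    interchange a b c d = begin
      (a ⊕ b) ⊕ (c ⊕ d)   ≡⟨ +-assoc a b (c ⊕ d) ⟩
      a ⊕ (b ⊕ (c ⊕ d))   ≡⟨ cong (a ⊕_) (+-assoc b c d) ⟨
      a ⊕ ((b ⊕ c) ⊕ d)   ≡⟨ cong (λ t → a ⊕ (t ⊕ d)) (+-comm b c) ⟩
      a ⊕ ((c ⊕ b) ⊕ d)   ≡⟨ cong (a ⊕_) (+-assoc c b d) ⟩
      a ⊕ (c ⊕ (b ⊕ d))   ≡⟨ +-assoc a c (b ⊕ d) ⟨
      (a ⊕ c) ⊕ (b ⊕ d)   ∎
      where open ≡-Reasoning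

  ∑-+ : ∀ (xs : List A) (f g : A → C) → ∑ xs (λ x → f x ⊕ g x) ≡ ∑ xs f ⊕ ∑ xs g
  ∑-+ []       f g = sym (+-identityˡ 𝟘)
  ∑-+ (x ∷ xs) f g = trans (cong (_ ⊕_) (∑-+ xs f g)) (interchange _ _ _ _)

  ∑-*ˡ : ∀ c (xs : List A) (f : A → C) → c ⊗ ∑ xs f ≡ ∑ xs (λ x → c ⊗ f x)
  ∑-*ˡ c []       f = zeroʳ c
  ∑-*ˡ c (x ∷ xs) f = trans (distribˡ c _ _) (cong (_ ⊕_) (∑-*ˡ c xs f))

  ∑-*ʳ : ∀ c (xs : List A) (f : A → C) → ∑ xs f ⊗ c ≡ ∑ xs (λ x → f x ⊗ c)
  ∑-*ʳ c []       f = zeroˡ c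
  ∑-*ʳ c (x ∷ xs) f = trans (distribʳ c _ _) (cong (_ ⊕_) (∑-*ʳ c xs f))

  ∑-comm : ∀ (xs : List A) (ys : List B) (f : A → B → C) →
           ∑ xs (λ x → ∑ ys (f x)) ≡ ∑ ys (λ y → ∑ xs (λ x → f x y))
  ∑-comm []       ys f = sym (∑-zero ys λ _ → refl)
  ∑-comm (x ∷ xs) ys f =
    trans (cong (_ ⊕_) (∑-comm xs ys f)) (sym (∑-+ ys (f x) _))

  ∑-single : ∀ {xs : List A} {x} {f : A → C} → Unique xs → x ∈ₗ xs →
             (∀ y → x ≢ y → f y ≡ 𝟘) → ∑ xs f ≡ f x
  ∑-single {xs = x ∷ xs} (x∉ AllPairs.∷ _) (here refl) off =
    trans (cong (_ ⊕_) (∑-zero xs λ y∈ → off _ (All.lookup x∉ y∈))) (+-identityʳ _)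
  ∑-single {xs = y ∷ xs} (y∉ AllPairs.∷ uniq) (there x∈) off =
    trans (cong₂ _⊕_ (off y (All.lookup y∉ x∈ ∘ sym)) (∑-single uniq x∈ off)) (+-identityˡ _)

  ∑-map : ∀ (g : A → B) xs (f : B → C) → ∑ (map g xs) f ≡ ∑ xs (f ∘ g)
  ∑-map g []       f = refl
  ∑-map g (x ∷ xs) f = cong (_ ⊕_) (∑-map g xs f)

  ∑-filter : ∀ {P : Pred A 0ℓ} (P? : Decidable P) xs (f : A → C) →
             ∑ (filter P? xs) f ≡ ∑ xs (λ x → if does (P? x) then f x else 𝟘)
  ∑-filter P? []       f = refl
  ∑-filter P? (x ∷ xs) f with does (P? x)
  ... | true  = cong (f x ⊕_) (∑-filter P? xs f)
  ... | false = trans (∑-filter P? xs f) (sym (+-identityˡ _))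

  ∑-++ : ∀ xs ys (f : A → C) → ∑ (xs ++ ys) f ≡ ∑ xs f ⊕ ∑ ys f
  ∑-++ []       ys f = sym (+-identityˡ _)
  ∑-++ (x ∷ xs) ys f = trans (cong (_ ⊕_) (∑-++ xs ys f)) (sym (+-assoc _ _ _))

  ∑-cartesianProduct : ∀ (xs : List A) (ys : List B) (f : A × B → C) →
                       ∑ (cartesianProduct xs ys) f ≡ ∑ xs (λ x → ∑ ys (λ y → f (x , y)))
  ∑-cartesianProduct []       ys f = refl
  ∑-cartesianProduct (x ∷ xs) ys f = trans (∑-++ (map (x ,_) ys) _ f)
    (cong₂ _⊕_ (∑-map (x ,_) ys f) (∑-cartesianProduct xs ys f))

-- Coefficients of products of linear forms

-- Used at ℤ for coefficients and at ℕ for counting edges, so no subtraction is asked for. Absence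
-- of zero divisors and characteristic 0 keep the constants produced by repeated differentiation
-- nonzero.
record Domain : Set₁ where
  infixl 6 _+_
  infixl 7 _*_
  field
    R                     : Set
    _+_ _*_               : Op₂ R
    0# 1#                 : R
    isCommutativeSemiring : IsCommutativeSemiring _≡_ _+_ _*_ 0# 1#
    _≟0                   : ∀ x → Dec (x ≡ 0#)
    *-≢0                  : ∀ {x y} → x ≢ 0# → y ≢ 0# → x * y ≢ 0#

  ⌞_⌟ : ℕ → R
  ⌞ n ⌟ = fold 0# (1# +_) n

  field
    ⌞suc⌟≢0 : ∀ n → ⌞ suc n ⌟ ≢ 0#

  open IsCommutativeSemiring isCommutativeSemiring public
    using (+-assoc; +-comm; +-identityˡ; +-identityʳ; *-assoc; *-comm; *-identityˡ; *-identityʳ;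
           distribˡ; distribʳ; zeroˡ; zeroʳ)
  open Summation isCommutativeSemiring public

  1≢0 : 1# ≢ 0#
  1≢0 1≡0 = ⌞suc⌟≢0 0 (trans (+-identityʳ 1#) 1≡0)

  ⌞1⌟-* : ∀ x → ⌞ 1 ⌟ * x ≡ x
  ⌞1⌟-* x = trans (cong (_* x) (+-identityʳ 1#)) (*-identityˡ x)

  *-left-comm : ∀ x y z → x * (y * z) ≡ y * (x * z)
  *-left-comm x y z =
    trans (sym (*-assoc x y z)) (trans (cong (_* z) (*-comm x y)) (*-assoc y x z))

  *-distribˡ² : ∀ w x y z → w * (x * (y + z)) ≡ w * (x * y) + w * (x * z)
  *-distribˡ² w x y z = trans (cong (w *_) (distribˡ x y z)) (distribˡ w _ _)

  *-zeroʳ² : ∀ x y {z} → z ≡ 0# → x * (y * z) ≡ 0#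
  *-zeroʳ² x y refl = trans (cong (x *_) (zeroʳ y)) (zeroʳ x)

  ∑≢0⇒∃ : ∀ {A : Set} (xs : List A) {f : A → R} → ∑ xs f ≢ 0# → ∃[ x ] x ∈ₗ xs × f x ≢ 0#
  ∑≢0⇒∃ []           ≢0 = contradiction refl ≢0
  ∑≢0⇒∃ (x ∷ xs) {f} ≢0 with f x ≟0
  ... | no  fx≢0 = x , here refl , fx≢0
  ... | yes fx≡0 with ∑≢0⇒∃ xs (λ ∑≡0 → ≢0 (trans (cong₂ _+_ fx≡0 ∑≡0) (+-identityˡ 0#)))
  ...   | y , y∈ , fy≢0 = y , there y∈ , fy≢0

  -- Guards the truncated subtraction in `_⊖_`: a monomial without x_e has coefficient 0 in x_e F.
  down : ℕ → R → R
  down zero    z = 0#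
  down (suc _) z = z

  down-* : ∀ n c z → down n (c * z) ≡ c * down n z
  down-* zero    c z = sym (zeroʳ c)
  down-* (suc _) c z = refl

  down-∑ : ∀ n {B : Set} (xs : List B) f → down n (∑ xs f) ≡ ∑ xs (down n ∘ f)
  down-∑ zero    xs f = sym (∑-zero xs λ _ → refl)
  down-∑ (suc _) xs f = refl

-- A formal series is given by its coefficient at each exponent vector
-- A → ℕ.  Only the values of an exponent vector on vs matter.
module Expansion (𝓡 : Domain) {A : Set} (_≟_ : DecidableEquality A) (vs : List A) where

  open Domain 𝓡

  Exponents Series : Set
  Exponents = A → ℕ
  Series    = Exponents → R

  -- Exponent vectors are functions, and identities such as that of `M ⊕ e ⊖ e` with `M` hold only
  -- pointwise. A series has to respect them.
  Extensional : Series → Set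
  Extensional F = ∀ {M N} → M ≗ N → F M ≡ F N

  infixl 6 _⊕_ _⊖_

  _⊕_ _⊖_ : Exponents → A → Exponents
  (M ⊕ e) x = if does (x ≟ e) then suc (M x) else M x
  (M ⊖ e) x = if does (x ≟ e) then ℕ.pred (M x) else M x

  ⊕-same : ∀ M e → (M ⊕ e) e ≡ suc (M e)
  ⊕-same M e rewrite dec-true (e ≟ e) refl = refl

  ⊕-diff : ∀ M {e x} → x ≢ e → (M ⊕ e) x ≡ M x
  ⊕-diff M {e} {x} x≢e rewrite dec-false (x ≟ e) x≢e = refl

  ⊖-same : ∀ M e → (M ⊖ e) e ≡ ℕ.pred (M e)
  ⊖-same M e rewrite dec-true (e ≟ e) refl = refl

  ⊖-diff : ∀ M {e x} → x ≢ e → (M ⊖ e) x ≡ M x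
  ⊖-diff M {e} {x} x≢e rewrite dec-false (x ≟ e) x≢e = refl

  ⊕-cong : ∀ {M N} e → M ≗ N → M ⊕ e ≗ N ⊕ e
  ⊕-cong e M≗N x with does (x ≟ e)
  ... | true  = cong suc (M≗N x)
  ... | false = M≗N x

  ⊖-cong : ∀ {M N} e → M ≗ N → M ⊖ e ≗ N ⊖ e
  ⊖-cong e M≗N x with does (x ≟ e)
  ... | true  = cong ℕ.pred (M≗N x)
  ... | false = M≗N x

  ⊖-≤ : ∀ M e x → (M ⊖ e) x ℕ.≤ M x
  ⊖-≤ M e x with does (x ≟ e)
  ... | true  = ℕ.pred[n]≤n
  ... | false = ℕ.≤-refl

  shrink : ∀ M e x → M x ≡ 0 → (M ⊖ e) x ≡ 0
  shrink M e x Mx≡0 = ℕ.n≤0⇒n≡0 (subst ((M ⊖ e) x ℕ.≤_) Mx≡0 (⊖-≤ M e x))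

  ⊕-⊖ : ∀ M e → (M ⊕ e) ⊖ e ≗ M
  ⊕-⊖ M e x with does (x ≟ e)
  ... | true  = refl
  ... | false = refl

  ⊖-⊕ : ∀ M e {k} → M e ≡ suc k → (M ⊖ e) ⊕ e ≗ M
  ⊖-⊕ M e Me≡ x with x ≟ e
  ... | no  _    = refl
  ... | yes refl rewrite Me≡ = refl

  ⊕-⊖-comm : ∀ M {e e′} → e ≢ e′ → (M ⊕ e) ⊖ e′ ≗ (M ⊖ e′) ⊕ e
  ⊕-⊖-comm M {e} {e′} e≢e′ x with x ≟ e | x ≟ e′
  ... | yes refl | yes refl = contradiction refl e≢e′
  ... | yes _    | no  _    = refl
  ... | no  _    | yes _    = refl
  ... | no  _    | no  _    = refl

  -- The coefficients of x_e F and of ∂F/∂x_e.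
  shift ∂ : A → Series → Series
  shift e F M = down (M e) (F (M ⊖ e))
  ∂     e F M = ⌞ suc (M e) ⌟ * F (M ⊕ e)

  -- The product with the linear form ∑ ℓ_e x_e, and the directional derivative along D.
  mul deriv : (A → R) → Series → Series
  mul   ℓ F M = ∑ vs λ e → ℓ e * shift e F M
  deriv D F M = ∑ vs λ e → D e * ∂ e F M

  -- The derivative of the linear form ℓ along D, which is a constant.
  ⟨_,_⟩ : (A → R) → (A → R) → R
  ⟨ ℓ , D ⟩ = ∑ vs λ e → ℓ e * D e

  one : Series
  one M = if does (All.all? (λ e → M e ℕ.≟ 0) vs) then 1# else 0#

  coef : ∀ {I : Set} → (I → A → R) → List I → Series
  coef ρ = foldr (mul ∘ ρ) one

  one≡1 : ∀ {M} → (∀ {e} → e ∈ₗ vs → M e ≡ 0) → one M ≡ 1#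
  one≡1 {M} M≡0 rewrite dec-true (All.all? (λ e → M e ℕ.≟ 0) vs) (All.tabulate M≡0) = refl

  one≡0 : ∀ {M} → ¬ All (λ e → M e ≡ 0) vs → one M ≡ 0#
  one≡0 {M} M≢0 rewrite dec-false (All.all? (λ e → M e ℕ.≟ 0) vs) M≢0 = refl

  one-ext : Extensional one
  one-ext {M} {N} M≗N with All.all? (λ e → M e ℕ.≟ 0) vs
  ... | yes M≡0 = sym (one≡1 λ e∈ → trans (sym (M≗N _)) (All.lookup M≡0 e∈))
  ... | no  M≢0 = sym (one≡0 (M≢0 ∘ All.map (trans (M≗N _))))

  shift-cong : ∀ e {F G} M → F ≗ G → shift e F M ≡ shift e G M
  shift-cong e M F≗G = cong (down (M e)) (F≗G _)

  shift-ext : ∀ e {F} → Extensional F → Extensional (shift e F)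
  shift-ext e F-ext M≗N = cong₂ down (M≗N e) (F-ext (⊖-cong e M≗N))

  mul-ext : ∀ ℓ {F} → Extensional F → Extensional (mul ℓ F)
  mul-ext ℓ F-ext M≗N = ∑-cong′ vs λ e → cong (ℓ e *_) (shift-ext e F-ext M≗N)

  mul-cong : ∀ {ℓ ℓ′ F G} → ℓ ≗ ℓ′ → F ≗ G → mul ℓ F ≗ mul ℓ′ G
  mul-cong ℓ≗ F≗G M = ∑-cong′ vs λ e → cong₂ _*_ (ℓ≗ e) (shift-cong e M F≗G)

  deriv-ext : ∀ D {F} → Extensional F → Extensional (deriv D F)
  deriv-ext D F-ext M≗N = ∑-cong′ vs λ e → cong (D e *_)
    (cong₂ _*_ (cong (⌞_⌟ ∘ suc) (M≗N e)) (F-ext (⊕-cong e M≗N)))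

  coef-ext : ∀ {I : Set} (ρ : I → A → R) is → Extensional (coef ρ is)
  coef-ext ρ []       = one-ext
  coef-ext ρ (i ∷ is) = mul-ext (ρ i) (coef-ext ρ is)

  mul-scale : ∀ ℓ c F M → mul ℓ (λ N → c * F N) M ≡ c * mul ℓ F M
  mul-scale ℓ c F M = begin
    ∑ vs (λ e → ℓ e * down (M e) (c * F (M ⊖ e)))   ≡⟨ ∑-cong′ vs (λ e → trans
      (cong (ℓ e *_) (down-* (M e) c _)) (*-left-comm (ℓ e) c _)) ⟩
    ∑ vs (λ e → c * (ℓ e * shift e F M))             ≡⟨ ∑-*ˡ c vs _ ⟨
    c * mul ℓ F M                                       ∎
    where open ≡-Reasoning

  mul-zero : ∀ ℓ {F} → (∀ N → F N ≡ 0#) → ∀ M → mul ℓ F M ≡ 0#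
  mul-zero ℓ F≡0 M = ∑-zero vs λ {e} _ →
    trans (cong (λ z → ℓ e * down (M e) z) (F≡0 _)) (trans (cong (ℓ e *_) (down-0 (M e))) (zeroʳ (ℓ e)))
    where
    down-0 : ∀ n → down n 0# ≡ 0#
    down-0 zero    = refl
    down-0 (suc _) = refl

  -- For e = e′ the factor M e + 1 of the derivative splits into 1, which gives F M, and M e, which
  -- is the factor that `∂ e F` has at `M ⊖ e`. If M e = 0, only the first part is there.
  ∂-shift : ∀ {F} → Extensional F → ∀ e e′ M →
            ∂ e (shift e′ F) M ≡ (if does (e ≟ e′) then F M else 0#) + shift e′ (∂ e F) M
  ∂-shift {F} F-ext e e′ M with e ≟ e′
  ... | no e≢e′ rewrite ⊕-diff M (e≢e′ ∘ sym) = begin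
    ⌞ suc (M e) ⌟ * down (M e′) (F (M ⊕ e ⊖ e′))          ≡⟨ down-* (M e′) _ _ ⟨
    down (M e′) (⌞ suc (M e) ⌟ * F (M ⊕ e ⊖ e′))          ≡⟨ cong (λ z → down (M e′) (⌞ suc (M e) ⌟ * z)) (F-ext (⊕-⊖-comm M e≢e′)) ⟩
    down (M e′) (⌞ suc (M e) ⌟ * F (M ⊖ e′ ⊕ e))          ≡⟨ +-identityˡ _ ⟨
    0# + down (M e′) (⌞ suc (M e) ⌟ * F (M ⊖ e′ ⊕ e))   ∎
    where open ≡-Reasoning
  ... | yes refl rewrite ⊕-same M e with M e in Me≡
  ...   | zero  = trans (trans (⌞1⌟-* _) (F-ext (⊕-⊖ M e))) (sym (+-identityʳ _))
  ...   | suc k = begin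
    ⌞ suc (suc k) ⌟ * F (M ⊕ e ⊖ e)        ≡⟨ cong (⌞ suc (suc k) ⌟ *_) (F-ext (⊕-⊖ M e)) ⟩
    (1# + ⌞ suc k ⌟) * F M               ≡⟨ trans (distribʳ (F M) 1# _) (cong (_+ ⌞ suc k ⌟ * F M) (*-identityˡ _)) ⟩
    F M + ⌞ suc k ⌟ * F M                ≡⟨ cong (λ z → F M + ⌞ suc k ⌟ * z) (F-ext (⊖-⊕ M e Me≡)) ⟨
    F M + ⌞ suc k ⌟ * F (M ⊖ e ⊕ e)      ∎
    where open ≡-Reasoning

  deriv-+ : ∀ D F G M → deriv D (λ N → F N + G N) M ≡ deriv D F M + deriv D G M
  deriv-+ D F G M = trans (∑-cong′ vs λ e → *-distribˡ² (D e) _ _ _) (∑-+ vs _ _)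

  deriv-scale : ∀ D c F M → deriv D (λ N → c * F N) M ≡ c * deriv D F M
  deriv-scale D c F M = trans (∑-cong′ vs λ e → trans (cong (D e *_) (*-left-comm _ c _)) (*-left-comm (D e) c _)) (sym (∑-*ˡ c vs _))

  deriv-cong : ∀ D {F G} → F ≗ G → deriv D F ≗ deriv D G
  deriv-cong D F≗G M = ∑-cong′ vs λ e → cong (λ z → D e * (_ * z)) (F≗G _)

  deriv-zero : ∀ D {F} → (∀ N → F N ≡ 0#) → ∀ M → deriv D F M ≡ 0#
  deriv-zero D F≡0 M = ∑-zero vs λ {e} _ →
    *-zeroʳ² (D e) _ (F≡0 _)

  deriv^ : (A → R) → ℕ → Series → Series
  deriv^ D zero    F = F
  deriv^ D (suc j) F = deriv D (deriv^ D j F)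

  deriv^-ext : ∀ D j {F} → Extensional F → Extensional (deriv^ D j F)
  deriv^-ext D zero    F-ext = F-ext
  deriv^-ext D (suc j) F-ext = deriv-ext D (deriv^-ext D j F-ext)

  module _ (unique : Unique vs) where

    leibniz : ∀ D ℓ {F} → Extensional F → ∀ M →
              deriv D (mul ℓ F) M ≡ ⟨ ℓ , D ⟩ * F M + mul ℓ (deriv D F) M
    leibniz D ℓ {F} F-ext M = begin
      ∑ vs (λ e → D e * (⌞ suc (M e) ⌟ * ∑ vs (λ e′ → ℓ e′ * shift e′ F (M ⊕ e))))
        ≡⟨ ∑-cong′ vs (λ e → trans (cong (D e *_) (∑-*ˡ _ vs _)) (∑-*ˡ _ vs _)) ⟩
      ∑ vs (λ e → ∑ vs (λ e′ → D e * (⌞ suc (M e) ⌟ * (ℓ e′ * shift e′ F (M ⊕ e)))))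
        ≡⟨ ∑-cong′ vs (λ e → ∑-cong′ vs (λ e′ → cong (D e *_)
             (trans (*-left-comm _ (ℓ e′) _) (cong (ℓ e′ *_) (∂-shift F-ext e e′ M))))) ⟩
      ∑ vs (λ e → ∑ vs (λ e′ → D e * (ℓ e′ * (diag e e′ + shift e′ (∂ e F) M))))
        ≡⟨ ∑-cong′ vs (λ e → trans (∑-cong′ vs λ e′ → *-distribˡ² (D e) (ℓ e′) _ _) (∑-+ vs _ _)) ⟩
      ∑ vs (λ e → ∑ vs (λ e′ → D e * (ℓ e′ * diag e e′))
                  + ∑ vs (λ e′ → D e * (ℓ e′ * shift e′ (∂ e F) M)))
        ≡⟨ ∑-+ vs _ _ ⟩
      ∑ vs (λ e → ∑ vs (λ e′ → D e * (ℓ e′ * diag e e′)))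
        + ∑ vs (λ e → ∑ vs (λ e′ → D e * (ℓ e′ * shift e′ (∂ e F) M)))
        ≡⟨ cong₂ _+_ diagonal offDiagonal ⟩
      ⟨ ℓ , D ⟩ * F M + mul ℓ (deriv D F) M   ∎
      where
      open ≡-Reasoning
      diag : A → A → R
      diag e e′ = if does (e ≟ e′) then F M else 0#
      diagonal : ∑ vs (λ e → ∑ vs (λ e′ → D e * (ℓ e′ * diag e e′))) ≡ ⟨ ℓ , D ⟩ * F M
      diagonal = trans
        (∑-cong vs λ {e} e∈ → trans
          (∑-single unique e∈ λ e′ e≢e′ → *-zeroʳ² (D e) (ℓ e′)
            (cong (if_then F M else 0#) (dec-false (e ≟ e′) e≢e′)))
          (trans (cong (λ b → D e * (ℓ e * (if b then F M else 0#))) (dec-true (e ≟ e) refl))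
                 (trans (*-left-comm (D e) (ℓ e) _) (sym (*-assoc (ℓ e) (D e) _)))))
        (sym (∑-*ʳ (F M) vs _))
      offDiagonal : ∑ vs (λ e → ∑ vs (λ e′ → D e * (ℓ e′ * shift e′ (∂ e F) M)))
                    ≡ mul ℓ (deriv D F) M
      offDiagonal = trans (∑-comm vs vs _) (∑-cong′ vs λ e′ → begin
        ∑ vs (λ e → D e * (ℓ e′ * shift e′ (∂ e F) M))     ≡⟨ ∑-cong′ vs (λ e → *-left-comm (D e) (ℓ e′) _) ⟩
        ∑ vs (λ e → ℓ e′ * (D e * shift e′ (∂ e F) M))     ≡⟨ ∑-*ˡ (ℓ e′) vs _ ⟨
        ℓ e′ * ∑ vs (λ e → D e * shift e′ (∂ e F) M)
          ≡⟨ cong (ℓ e′ *_) (∑-cong′ vs λ e → sym (down-* (M e′) (D e) _)) ⟩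
        ℓ e′ * ∑ vs (λ e → down (M e′) (D e * ∂ e F (M ⊖ e′)))
          ≡⟨ cong (ℓ e′ *_) (down-∑ (M e′) vs _) ⟨
        ℓ e′ * shift e′ (deriv D F) M                        ∎)

    -- Second derivatives of a linear form vanish, so of the general Leibniz formula there remain
    -- the terms in which ℓ is differentiated once or not at all.
    leibniz^ : ∀ D ℓ {F} → Extensional F → ∀ j M →
               deriv^ D (suc j) (mul ℓ F) M ≡
               (⌞ suc j ⌟ * ⟨ ℓ , D ⟩) * deriv^ D j F M + mul ℓ (deriv^ D (suc j) F) M
    leibniz^ D ℓ {F} F-ext zero M =
      trans (leibniz D ℓ F-ext M)
            (cong (λ z → z * F M + mul ℓ (deriv D F) M) (sym (⌞1⌟-* _)))
    leibniz^ D ℓ {F} F-ext (suc j) M = begin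
      deriv D (deriv^ D (suc j) (mul ℓ F)) M
        ≡⟨ deriv-cong D (leibniz^ D ℓ F-ext j) M ⟩
      deriv D (λ N → (⌞ suc j ⌟ * s) * deriv^ D j F N + mul ℓ (deriv^ D (suc j) F) N) M
        ≡⟨ deriv-+ D (λ N → (⌞ suc j ⌟ * s) * deriv^ D j F N) (mul ℓ (deriv^ D (suc j) F)) M ⟩
      deriv D (λ N → (⌞ suc j ⌟ * s) * deriv^ D j F N) M + deriv D (mul ℓ (deriv^ D (suc j) F)) M
        ≡⟨ cong₂ _+_ (deriv-scale D _ (deriv^ D j F) M) (leibniz D ℓ (deriv^-ext D (suc j) F-ext) M) ⟩
      (⌞ suc j ⌟ * s) * G + (s * G + 𝑟)
        ≡⟨ collect ⌞ suc j ⌟ ⟩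
      ((1# + ⌞ suc j ⌟) * s) * G + 𝑟   ∎
      where
      open ≡-Reasoning
      s = ⟨ ℓ , D ⟩
      G = deriv^ D (suc j) F M
      𝑟 = mul ℓ (deriv^ D (suc (suc j)) F) M
      collect : ∀ m → (m * s) * G + (s * G + 𝑟) ≡ ((1# + m) * s) * G + 𝑟
      collect m = begin
        (m * s) * G + (s * G + 𝑟)        ≡⟨ +-assoc _ _ 𝑟 ⟨
        ((m * s) * G + s * G) + 𝑟        ≡⟨ cong (_+ 𝑟) (+-comm _ _) ⟩
        (s * G + (m * s) * G) + 𝑟        ≡⟨ cong (_+ 𝑟) (distribʳ G s _) ⟨
        (s + m * s) * G + 𝑟              ≡⟨ cong (λ z → (z + m * s) * G + 𝑟) (*-identityˡ s) ⟨
        (1# * s + m * s) * G + 𝑟         ≡⟨ cong (λ z → z * G + 𝑟) (distribʳ s 1# m) ⟨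
        ((1# + m) * s) * G + 𝑟           ∎

    deriv^-mul-null : ∀ D ℓ {F} → Extensional F → ⟨ ℓ , D ⟩ ≡ 0# → ∀ j →
                      deriv^ D j (mul ℓ F) ≗ mul ℓ (deriv^ D j F)
    deriv^-mul-null D ℓ F-ext s≡0 zero    M = refl
    deriv^-mul-null D ℓ {F} F-ext s≡0 (suc j) M = trans (leibniz^ D ℓ F-ext j M)
      (trans (cong (λ s → (⌞ suc j ⌟ * s) * deriv^ D j F M + 𝑟) s≡0)
             (trans (cong (λ z → z * deriv^ D j F M + 𝑟) (zeroʳ (⌞ suc j ⌟)))
                    (trans (cong (_+ 𝑟) (zeroˡ _)) (+-identityˡ 𝑟))))
      where 𝑟 = mul ℓ (deriv^ D (suc j) F) M

    module _ {I : Set} (ρ : I → A → R) (D : A → R) {Q : Pred I 0ℓ} (Q? : Decidable Q)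
             (null : ∀ {i} → Q i → ⟨ ρ i , D ⟩ ≡ 0#)
             (nonnull : ∀ {i} → ¬ Q i → ⟨ ρ i , D ⟩ ≢ 0#) where

      -- Each row that D does not annihilate absorbs exactly one derivative.
      deriv^-coef : ∀ is → let c = length (filter (¬? ∘ Q?) is) in
        (∀ M → deriv^ D (suc c) (coef ρ is) M ≡ 0#) ×
        ∃[ κ ] κ ≢ 0# × (∀ M → deriv^ D c (coef ρ is) M ≡ κ * coef ρ (filter Q? is) M)
      deriv^-coef [] = deriv-one , 1# , 1≢0 , λ M → sym (*-identityˡ _)
        where
        deriv-one : ∀ M → deriv D one M ≡ 0#
        deriv-one M = ∑-zero vs λ {e} e∈ → begin
          D e * (⌞ suc (M e) ⌟ * one (M ⊕ e))
            ≡⟨ cong (λ z → D e * (⌞ suc (M e) ⌟ * z))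
                 (one≡0 λ M≡0 → ℕ.1+n≢0 (trans (sym (⊕-same M e)) (All.lookup M≡0 e∈))) ⟩
          D e * (⌞ suc (M e) ⌟ * 0#)  ≡⟨ cong (D e *_) (zeroʳ (⌞ suc (M e) ⌟)) ⟩
          D e * 0#                    ≡⟨ zeroʳ (D e) ⟩
          0#                            ∎
          where open ≡-Reasoning
      deriv^-coef (i ∷ is) with deriv^-coef is | Q? i
      ... | vanish , κ , κ≢0 , lead | yes Qi =
        (λ M → trans (deriv^-mul-null D (ρ i) (coef-ext ρ is) (null Qi) (suc c) M)
                     (mul-zero (ρ i) vanish M)) ,
        κ , κ≢0 , λ M → trans (deriv^-mul-null D (ρ i) (coef-ext ρ is) (null Qi) c M)
                          (trans (mul-cong {ρ i} (λ _ → refl) lead M) (mul-scale (ρ i) κ (coef ρ (filter Q? is)) M))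
        where c = length (filter (¬? ∘ Q?) is)
      ... | vanish , κ , κ≢0 , lead | no ¬Qi =
        (λ M → trans (leibniz^ D (ρ i) (coef-ext ρ is) (suc c) M)
                 (trans (cong₂ _+_ (trans (cong (_ *_) (vanish M)) (zeroʳ (⌞ suc (suc c) ⌟ * s)))
                                     (mul-zero (ρ i) (deriv-zero D vanish) M))
                        (+-identityˡ 0#))) ,
        -- Accumulated over the rows, κ is c! times the product of the nonzero pairings.
        (⌞ suc c ⌟ * s) * κ , *-≢0 (*-≢0 (⌞suc⌟≢0 c) (nonnull ¬Qi)) κ≢0 , λ M → begin
          deriv^ D (suc c) (mul (ρ i) (coef ρ is)) M   ≡⟨ leibniz^ D (ρ i) (coef-ext ρ is) c M ⟩
          (⌞ suc c ⌟ * s) * deriv^ D c (coef ρ is) M + mul (ρ i) (deriv^ D (suc c) (coef ρ is)) M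
            ≡⟨ cong₂ (λ x y → (⌞ suc c ⌟ * s) * x + y) (lead M) (mul-zero (ρ i) vanish M) ⟩
          (⌞ suc c ⌟ * s) * (κ * coef ρ (filter Q? is) M) + 0#
            ≡⟨ trans (+-identityʳ _) (sym (*-assoc (⌞ suc c ⌟ * s) κ _)) ⟩
          ((⌞ suc c ⌟ * s) * κ) * coef ρ (filter Q? is) M   ∎
        where
        open ≡-Reasoning
        c = length (filter (¬? ∘ Q?) is)
        s = ⟨ ρ i , D ⟩

      -- A coefficient of a derivative is a sum over variables x of coefficients at `M ⊕ x`,
      -- weighted by D x. Following a nonzero term back through c derivatives raises c exponents in
      -- all, each in a variable where D is nonzero.
      deriv^≢0⇒∃ : ∀ c {F M} → deriv^ D c F M ≢ 0# →
        ∃[ N ] F N ≢ 0# × (∀ e → N e ℕ.≤ M e ℕ.+ c) × (∀ e → D e ≡ 0# → N e ℕ.≤ M e)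
      deriv^≢0⇒∃ zero    {M = M} ≢0 = M , ≢0 , (λ e → ℕ.m≤m+n (M e) 0) , λ e _ → ℕ.≤-refl
      deriv^≢0⇒∃ (suc c) {F} {M} ≢0
        with x , x∈ , term≢0 ← ∑≢0⇒∃ vs ≢0
        with N , FN≢0 , N≤ , N≤′ ← deriv^≢0⇒∃ c {F} {M ⊕ x} (λ ≡0 → term≢0
               (trans (cong (λ z → D x * (⌞ suc (M x) ⌟ * z)) ≡0)
                      (trans (cong (D x *_) (zeroʳ (⌞ suc (M x) ⌟))) (zeroʳ (D x)))))
        = N , FN≢0 , (λ e → ℕ.≤-trans (N≤ e) (bound e)) , λ e De≡0 → ℕ.≤-trans (N≤′ e De≡0) (bound′ e De≡0)
        where
        bound : ∀ e → (M ⊕ x) e ℕ.+ c ℕ.≤ M e ℕ.+ suc c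
        bound e with does (e ≟ x)
        ... | true  = ℕ.≤-reflexive (sym (ℕ.+-suc (M e) c))
        ... | false = ℕ.+-monoʳ-≤ (M e) (ℕ.n≤1+n c)
        bound′ : ∀ e → D e ≡ 0# → (M ⊕ x) e ℕ.≤ M e
        bound′ e De≡0 with e ≟ x
        ... | no  _    = ℕ.≤-refl
        ... | yes refl = contradiction (trans (cong (_* ∂ x (deriv^ D c F) M) De≡0) (zeroˡ _)) term≢0

      -- The form in which elimination is used: one derivative is spent per row outside Q, so the
      -- number of these rows bounds the growth of each exponent.
      coef-eliminate : ∀ is {M} → coef ρ (filter Q? is) M ≢ 0# →
        ∃[ N ] coef ρ is N ≢ 0# ×
               (∀ e → N e ℕ.≤ M e ℕ.+ length (filter (¬? ∘ Q?) is)) ×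
               (∀ e → D e ≡ 0# → N e ℕ.≤ M e)
      coef-eliminate is {M} ≢0 with _ , κ , κ≢0 , lead ← deriv^-coef is =
        deriv^≢0⇒∃ (length (filter (¬? ∘ Q?) is)) λ ≡0 → *-≢0 κ≢0 ≢0 (trans (sym (lead M)) ≡0)

    -- With D the unit vector at e, a row pairs to its entry at e, so elimination discards the rows
    -- that involve x_e. Every other row still has a nonzero entry at a later variable; once `es` is
    -- exhausted, no row can be left.
    coef-nonzero : ∀ {I : Set} (ρ : I → A → R) es → (∀ {e} → e ∈ₗ es → e ∈ₗ vs) → ∀ is →
                   (∀ {i} → i ∈ₗ is → ∃[ e ] e ∈ₗ es × ρ i e ≢ 0#) →
                   ∃[ M ] coef ρ is M ≢ 0#
    coef-nonzero ρ []       es⊆ []       nz =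
      (λ _ → 0) , λ one≡0 → 1≢0 (trans (sym (one≡1 λ _ → refl)) one≡0)
    coef-nonzero ρ []       es⊆ (i ∷ is) nz = case nz (here refl) of λ { (_ , () , _) }
    coef-nonzero {I} ρ (e ∷ es) es⊆ is   nz =
      let M , ≢0 = coef-nonzero ρ es (es⊆ ∘ there) (filter Q? is) nz′
          N , ≢0′ , _ = coef-eliminate ρ D Q? (trans (pairing _)) (λ ¬Q → ¬Q ∘ trans (sym (pairing _))) is ≢0
      in N , ≢0′
      where
      D : A → R
      D x = if does (x ≟ e) then 1# else 0#
      Q? : Decidable (λ i → ρ i e ≡ 0#)
      Q? i = ρ i e ≟0
      pairing : ∀ i → ⟨ ρ i , D ⟩ ≡ ρ i e
      pairing i = trans
        (∑-single unique (es⊆ (here refl)) λ y e≢y → trans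
          (cong (λ b → ρ i y * (if b then 1# else 0#)) (dec-false (y ≟ e) (e≢y ∘ sym))) (zeroʳ _))
        (trans (cong (λ b → ρ i e * (if b then 1# else 0#)) (dec-true (e ≟ e) refl)) (*-identityʳ _))
      nz′ : ∀ {i} → i ∈ₗ filter Q? is → ∃[ e′ ] e′ ∈ₗ es × ρ i e′ ≢ 0#
      nz′ i∈ with i∈is , ρie≡0 ← ∈-filter⁻ Q? {xs = is} i∈ with nz i∈is
      ... | _  , here refl , ≢0 = contradiction ρie≡0 ≢0
      ... | e′ , there e′∈ , ≢0 = e′ , e′∈ , ≢0

  infixl 6 _⊞_

  _⊞_ : Exponents → Exponents → Exponents
  (M ⊞ N) e = M e ℕ.+ N e

  one-⊞ : ∀ M N → one (M ⊞ N) ≡ one M * one N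
  one-⊞ M N with All.all? (λ e → M e ℕ.≟ 0) vs | All.all? (λ e → N e ℕ.≟ 0) vs
  ... | no  M≢0 | _ = trans (one≡0 (M≢0 ∘ All.map (λ {e} → ℕ.m+n≡0⇒m≡0 (M e)))) (sym (zeroˡ _))
  ... | yes _   | no N≢0 =
    trans (one≡0 (N≢0 ∘ All.map (λ {e} → ℕ.m+n≡0⇒n≡0 (M e)))) (sym (zeroʳ _))
  ... | yes M≡0 | yes N≡0 =
    trans (one≡1 λ e∈ → cong₂ ℕ._+_ (All.lookup M≡0 e∈) (All.lookup N≡0 e∈)) (sym (*-identityˡ 1#))

  module _ {I : Set} (ρ : I → A → R) {P : Pred I 0ℓ} (P? : Decidable P) where

    -- When the product is expanded at the monomial M + N, a row in P can pick only variables where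
    -- N vanishes, so it uses up part of M, and the other rows use up N. Hence the sum over all
    -- choices factors. The two families may share variables, provided that M and N both vanish
    -- there.
    coef-split : ∀ is {M N} →
      (∀ {i} → i ∈ₗ is → P i → ∀ e → ρ i e ≡ 0# ⊎ N e ≡ 0) →
      (∀ {i} → i ∈ₗ is → ¬ P i → ∀ e → ρ i e ≡ 0# ⊎ M e ≡ 0) →
      coef ρ is (M ⊞ N) ≡ coef ρ (filter P? is) M * coef ρ (filter (¬? ∘ P?) is) N
    coef-split []       {M} {N} offN offM = one-⊞ M N
    coef-split (i ∷ is) {M} {N} offN offM with P? i
    ... | yes Pi = trans (∑-cong′ vs term) (sym (∑-*ʳ _ vs _))
      where
      F = coef ρ (filter P? is)
      c = coef ρ (filter (¬? ∘ P?) is) N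
      term : ∀ e → ρ i e * shift e (coef ρ is) (M ⊞ N) ≡ (ρ i e * shift e F M) * c
      term e with offN (here refl) Pi e
      ... | inj₁ ρ≡0 rewrite ρ≡0 | zeroˡ (shift e (coef ρ is) (M ⊞ N)) | zeroˡ (shift e F M) = sym (zeroˡ c)
      ... | inj₂ Ne≡0 = trans (cong (ρ i e *_) (begin
        down (M e ℕ.+ N e) (coef ρ is (M ⊞ N ⊖ e))
          ≡⟨ cong₂ down (trans (cong (M e ℕ.+_) Ne≡0) (ℕ.+-identityʳ _)) (coef-ext ρ is regroup) ⟩
        down (M e) (coef ρ is (M ⊖ e ⊞ N))
          ≡⟨ cong (down (M e)) (trans (coef-split is (offN ∘ there)
               λ i∈ ¬P x → Sum.map₂ (shrink M e x) (offM (there i∈) ¬P x)) (*-comm _ c)) ⟩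
        down (M e) (c * F (M ⊖ e))   ≡⟨ down-* (M e) c _ ⟩
        c * shift e F M              ≡⟨ *-comm c _ ⟩
        shift e F M * c              ∎)) (sym (*-assoc _ _ c))
        where
        open ≡-Reasoning
        regroup : M ⊞ N ⊖ e ≗ M ⊖ e ⊞ N
        regroup x with x ≟ e
        ... | no  _    = refl
        ... | yes refl rewrite Ne≡0 | ℕ.+-identityʳ (M e) = sym (ℕ.+-identityʳ _)
    ... | no ¬Pi = trans (∑-cong′ vs term) (sym (∑-*ˡ c vs _))
      where
      F = coef ρ (filter (¬? ∘ P?) is)
      c = coef ρ (filter P? is) M
      term : ∀ e → ρ i e * shift e (coef ρ is) (M ⊞ N) ≡ c * (ρ i e * shift e F N)
      term e with offM (here refl) ¬Pi e
      ... | inj₁ ρ≡0 rewrite ρ≡0 | zeroˡ (shift e (coef ρ is) (M ⊞ N)) | zeroˡ (shift e F N) = sym (zeroʳ c)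
      ... | inj₂ Me≡0 = trans (cong (ρ i e *_) (begin
        down (M e ℕ.+ N e) (coef ρ is (M ⊞ N ⊖ e))
          ≡⟨ cong₂ down (cong (ℕ._+ N e) Me≡0) (coef-ext ρ is regroup) ⟩
        down (N e) (coef ρ is (M ⊞ (N ⊖ e)))
          ≡⟨ cong (down (N e)) (coef-split is
               (λ i∈ Pi x → Sum.map₂ (shrink N e x) (offN (there i∈) Pi x)) (offM ∘ there)) ⟩
        down (N e) (c * F (N ⊖ e))   ≡⟨ down-* (N e) c _ ⟩
        c * shift e F N              ∎)) (*-left-comm _ c _)
        where
        open ≡-Reasoning
        regroup : M ⊞ N ⊖ e ≗ M ⊞ (N ⊖ e)
        regroup x with x ≟ e
        ... | no  _    = refl
        ... | yes refl rewrite Me≡0 = refl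

module _ (𝓡 : Domain) {A B : Set} (_≟A_ : DecidableEquality A) (_≟B_ : DecidableEquality B)
         {vs : List A} {ws : List B} {ι : A → B} (ι-injective : ∀ {x y} → ι x ≡ ι y → x ≡ y)
         {Q : Pred B 0ℓ} (Q? : Decidable Q) (ws↾Q≡vs : filter Q? ws ≡ map ι vs) where

  open Domain 𝓡
  private
    module EA = Expansion 𝓡 _≟A_ vs
    module EB = Expansion 𝓡 _≟B_ ws

  -- Variables outside Q cannot be picked because M vanishes on them, so the sums over `ws` reduce
  -- to the image of `vs`. This serves twice: for a copy of H inside the box product, and for
  -- passing between edges as pairs and edges as indices.
  coef-embed : ∀ {I J : Set} {ρ : I → A → R} {σ : J → B → R} {κ : I → J} →
               (∀ i e → σ (κ i) (ι e) ≡ ρ i e) →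
               ∀ is {M} → (∀ {e} → ¬ Q e → M e ≡ 0) →
               EB.coef σ (map κ is) M ≡ EA.coef ρ is (M ∘ ι)
  coef-embed ρ≡ [] {M} off with All.all? (λ e → M (ι e) ℕ.≟ 0) vs
  ... | no  M≢0 = EB.one≡0 λ M≡0 → M≢0 (All.tabulate λ e∈ →
    All.lookup M≡0 (proj₁ (∈-filter⁻ Q? {xs = ws} (subst (_ ∈ₗ_) (sym ws↾Q≡vs) (∈-map⁺ ι e∈)))))
  ... | yes M≡0 = EB.one≡1 zero-on-ws
    where
    zero-on-ws : ∀ {e} → e ∈ₗ ws → M e ≡ 0
    zero-on-ws {e} e∈ with Q? e
    ... | no ¬Qe = off ¬Qe
    ... | yes Qe with _ , x∈ , refl ← ∈-map⁻ ι (subst (e ∈ₗ_) ws↾Q≡vs (∈-filter⁺ Q? e∈ Qe)) =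
      All.lookup M≡0 x∈
  coef-embed {ρ = ρ} {σ} {κ} ρ≡ (i ∷ is) {M} off = begin
    ∑ ws g                                          ≡⟨ ∑-cong′ ws supported ⟨
    ∑ ws (λ e → if does (Q? e) then g e else 0#)    ≡⟨ ∑-filter Q? ws g ⟨
    ∑ (filter Q? ws) g                              ≡⟨ cong (λ es → ∑ es g) ws↾Q≡vs ⟩
    ∑ (map ι vs) g                                  ≡⟨ ∑-map ι vs g ⟩
    ∑ vs (g ∘ ι)                                    ≡⟨ ∑-cong′ vs (λ e → cong₂ _*_ (ρ≡ i e)
      (cong (down (M (ι e))) (trans (coef-embed ρ≡ is (off⊖ e)) (EA.coef-ext ρ is (lower e))))) ⟩
    EA.coef ρ (i ∷ is) (M ∘ ι)                      ∎
    where
    open ≡-Reasoning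
    g = λ e → σ (κ i) e * EB.shift e (EB.coef σ (map κ is)) M
    supported : ∀ e → (if does (Q? e) then g e else 0#) ≡ g e
    supported e with Q? e
    ... | yes _  = refl
    ... | no ¬Qe rewrite off ¬Qe = sym (zeroʳ _)
    off⊖ : ∀ e {x} → ¬ Q x → (M EB.⊖ ι e) x ≡ 0
    off⊖ e {x} ¬Qx = EB.shrink M (ι e) x (off ¬Qx)
    lower : ∀ e → (M EB.⊖ ι e) ∘ ι ≗ (M ∘ ι) EA.⊖ e
    lower e x with x ≟A e
    ... | yes refl = EB.⊖-same M (ι e)
    ... | no  x≢e  = EB.⊖-diff M (x≢e ∘ ι-injective)

-- The polynomials P G as products of linear forms

ℤ-domain : Domain
ℤ-domain = record
  { R = ℤ ; _+_ = ℤ._+_ ; _*_ = ℤ._*_ ; 0# = 0ℤ ; 1# = 1ℤ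
  ; isCommutativeSemiring = ℤ.+-*-isCommutativeSemiring
  ; _≟0 = ℤ._≟ 0ℤ
  ; *-≢0 = λ {x} x≢0 y≢0 xy≡0 → Sum.[ x≢0 , y≢0 ]′ (ℤ.i*j≡0⇒i≡0∨j≡0 x xy≡0)
  ; ⌞suc⌟≢0 = λ n ≡0 → case trans (sym (fold-+ (suc n))) ≡0 of λ ()
  }
  where
  fold-+ : ∀ n → fold 0ℤ (λ z → 1ℤ ℤ.+ z) n ≡ ℤ.+ n
  fold-+ zero    = refl
  fold-+ (suc n) = cong (λ z → 1ℤ ℤ.+ z) (fold-+ n)

lookup≤h : ∀ {m} (M : Monomial m) i → Vec.lookup M i ℕ.≤ h M
lookup≤h (x Vec.∷ M) Fin.zero    = ℕ.m≤m⊔n x (h M)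
lookup≤h (x Vec.∷ M) (Fin.suc i) = ℕ.≤-trans (lookup≤h M i) (ℕ.m≤n⊔m x (h M))

h-tabulate≤ : ∀ {m k} {f : Fin m → ℕ} → (∀ i → f i ℕ.≤ k) → h (Vec.tabulate f) ℕ.≤ k
h-tabulate≤ {zero}  f≤k = ℕ.z≤n
h-tabulate≤ {suc m} f≤k = ℕ.⊔-lub (f≤k Fin.zero) (h-tabulate≤ (f≤k ∘ Fin.suc))

module _ {m : ℕ} where

  private
    _≡?_ : (N M : Monomial m) → Dec (N ≡ M)
    _≡?_ = Vec.≡-dec ℕ._≟_

  coeff≢0⇒∈monomials : ∀ (p : Poly m) {M} → coeff p M ≢ 0ℤ → M ∈ₗ monomials p
  coeff≢0⇒∈monomials p {M} ≢0 = ∈-filter⁺ _ (occurs p ≢0) ≢0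
    where
    occurs : ∀ q → coeff q M ≢ 0ℤ → M ∈ₗ map proj₂ q
    occurs []            ≢0 = contradiction refl ≢0
    occurs ((c , N) ∷ q) ≢0 with N ≡? M
    ... | yes refl = here refl
    ... | no  _    = there (occurs q ≢0)

  coeff≢0⇒mindₚ≤ : ∀ (p : Poly m) {M k} → coeff p M ≢ 0ℤ → h M ℕ.≤ k → mindₚ p ≤∞ [ k ]
  coeff≢0⇒mindₚ≤ p {M} ≢0 hM≤k
    with map h (monomials p) | ∈-map⁺ h (coeff≢0⇒∈monomials p ≢0)
  ... | x ∷ xs | here refl = Sup.[ ℕ.≤-trans (min≤⊤ x xs) hM≤k ]
  ... | x ∷ xs | there h∈  = Sup.[ ℕ.≤-trans (All.lookup (min≤xs x xs) h∈) hM≤k ]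

  coeff≢0⇒mindₚ≡ : ∀ (p : Poly m) {M} → coeff p M ≢ 0ℤ →
                   ∃[ N ] coeff p N ≢ 0ℤ × mindₚ p ≡ [ h N ]
  coeff≢0⇒mindₚ≡ p ≢0
    with map h (monomials p) in eq | ∈-map⁺ h (coeff≢0⇒∈monomials p ≢0)
  ... | x ∷ xs | _ = attained (attains (argmin-sel id x xs))
    where
    attains : min x xs ≡ x ⊎ min x xs ∈ₗ xs → min x xs ∈ₗ map h (monomials p)
    attains (inj₁ ≡x) = subst (min x xs ∈ₗ_) (sym eq) (here ≡x)
    attains (inj₂ ∈xs) = subst (min x xs ∈ₗ_) (sym eq) (there ∈xs)
    attained : min x xs ∈ₗ map h (monomials p) → ∃[ N ] coeff p N ≢ 0ℤ × [ min x xs ] ≡ [ h N ]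
    attained min∈ with N , N∈ , min≡ ← ∈-map⁻ h min∈ =
      N , proj₂ (∈-filter⁻ _ {xs = map proj₂ p} N∈) , cong [_] min≡

  open Domain ℤ-domain using (down; ∑)
  open Expansion ℤ-domain (Fin._≟_ {m}) (allFin m)

  coeff-++ : ∀ p q (M : Monomial m) → coeff (p ++ q) M ≡ coeff p M ℤ.+ coeff q M
  coeff-++ []            q M = sym (ℤ.+-identityˡ _)
  coeff-++ ((c , N) ∷ p) q M with does (N ≡? M)
  ... | true  = trans (cong (λ z → c ℤ.+ z) (coeff-++ p q M)) (sym (ℤ.+-assoc c (coeff p M) _))
  ... | false = coeff-++ p q M

  series : Poly m → Series
  series p M = coeff p (Vec.tabulate M)

  private
    unit : Fin m → Monomial m
    unit e = Vec.replicate m 0 Vec.[ e ]≔ 1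

    lookup-unit : ∀ e N x → Vec.lookup (Vec.zipWith ℕ._+_ (unit e) N) x ≡ (Vec.lookup N ⊕ e) x
    lookup-unit e N x with x Fin.≟ e
    ... | yes refl = trans (Vec.lookup-zipWith ℕ._+_ x (unit e) N)
                       (cong (ℕ._+ Vec.lookup N x) (Vec.lookup∘updateAt x (Vec.replicate m 0)))
    ... | no  x≢e  = trans (Vec.lookup-zipWith ℕ._+_ x (unit e) N)
                       (cong (ℕ._+ Vec.lookup N x) (trans
                         (Vec.lookup∘updateAt′ x e x≢e (Vec.replicate m 0)) (Vec.lookup-replicate x 0)))

    from-lookup : ∀ (N : Monomial m) {f} → Vec.lookup N ≗ f → N ≡ Vec.tabulate f
    from-lookup N eq = trans (sym (Vec.tabulate∘lookup N)) (Vec.tabulate-cong eq)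

    to-lookup : ∀ {N : Monomial m} {f} → N ≡ Vec.tabulate f → Vec.lookup N ≗ f
    to-lookup {f = f} refl = Vec.lookup∘tabulate f

  -- The exponent of x_e times a term N equals M exactly when M e > 0 and N is `M ⊖ e`, which is
  -- what `shift` encodes.
  series-monomial-* : ∀ c e q M →
    series (map (λ (d , N) → c ℤ.* d , Vec.zipWith ℕ._+_ (unit e) N) q) M ≡ c ℤ.* shift e (series q) M
  series-monomial-* c e [] M = sym (trans (cong (c ℤ.*_) (down-0 (M e))) (ℤ.*-zeroʳ c))
    where
    down-0 : ∀ n → down n 0ℤ ≡ 0ℤ
    down-0 zero    = refl
    down-0 (suc _) = refl
  series-monomial-* c e ((d , N) ∷ q) M with M e in Me≡ | series-monomial-* c e q M
  ... | zero | ih rewrite dec-false (Vec.zipWith ℕ._+_ (unit e) N ≡? Vec.tabulate M)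
                    (λ eq → ℕ.1+n≢0 (trans (sym (⊕-same (Vec.lookup N) e))
                      (trans (sym (lookup-unit e N e)) (trans (to-lookup eq e) Me≡)))) = ih
  ... | suc k | ih with N ≡? Vec.tabulate (M ⊖ e)
  ...   | yes N≡ rewrite dec-true (Vec.zipWith ℕ._+_ (unit e) N ≡? Vec.tabulate M)
                    (from-lookup _ λ x → trans (lookup-unit e N x)
                      (trans (⊕-cong e (to-lookup N≡) x) (⊖-⊕ M e Me≡ x))) =
    trans (cong (λ z → c ℤ.* d ℤ.+ z) ih) (sym (ℤ.*-distribˡ-+ c d _))
  ...   | no  N≢ rewrite dec-false (Vec.zipWith ℕ._+_ (unit e) N ≡? Vec.tabulate M)
                    (λ eq → N≢ (from-lookup N λ x → trans (sym (⊕-⊖ (Vec.lookup N) e x))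
                      (⊖-cong e (λ y → trans (sym (lookup-unit e N y)) (to-lookup eq y)) x))) = ih

  series-1ₚ : series 1ₚ ≗ one
  series-1ₚ M with All.all? (λ e → M e ℕ.≟ 0) (allFin m)
  ... | yes M≡0 rewrite dec-true (Vec.replicate m 0 ≡? Vec.tabulate M) (from-lookup _ λ x →
                    trans (Vec.lookup-replicate x 0) (sym (All.lookup M≡0 (∈-allFin x)))) = refl
  ... | no  M≢0 rewrite dec-false (Vec.replicate m 0 ≡? Vec.tabulate M) (λ eq → M≢0 (All.tabulate λ {x} _ →
                    trans (sym (to-lookup eq x)) (Vec.lookup-replicate x 0))) = refl

  sumOfVars : ℤ → List (Fin m) → Poly m
  sumOfVars c = map λ e → c , unit e

  series-sumOfVars-* : ∀ c es q M →
    series (sumOfVars c es *ₚ q) M ≡ ∑ es (λ e → c ℤ.* shift e (series q) M)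
  series-sumOfVars-* c []       q M = refl
  series-sumOfVars-* c (e ∷ es) q M = trans (coeff-++ (map _ q) (sumOfVars c es *ₚ q) (Vec.tabulate M))
    (cong₂ ℤ._+_ (series-monomial-* c e q M) (series-sumOfVars-* c es q M))

-- Defined on pairs of vertices rather than on edge indices: H and G □ H number their edges
-- separately, and pairs allow an edge of H to be compared with its copies.
incidence : ∀ {n} → Fin n → Fin n × Fin n → ℤ
incidence v (a , b) = if does ((v Fin.≟ a) ⊎-dec (v Fin.≟ b)) then 1ℤ else 0ℤ

-- row (u , v) e is the coefficient of the variable of e in X_v − X_u.
row : ∀ {n} → Fin n × Fin n → Fin n × Fin n → ℤ
row (u , v) e = incidence v e ℤ.- incidence u e

module _ {n} (G : Graph n) where

  private m = size G

  open Domain ℤ-domain using (∑; ∑-cong′; ∑-filter; ∑-+)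
  open Expansion ℤ-domain (Fin._≟_ {m}) (allFin m)

  X≡sumOfVars : ∀ v → X G v ≡ sumOfVars 1ℤ (incidentEdges G v)
  X≡sumOfVars v = concat-vars (incidentEdges G v)
    where
    concat-vars : ∀ es → foldr _+ₚ_ 0ₚ (map var es) ≡ sumOfVars 1ℤ es
    concat-vars []       = refl
    concat-vars (e ∷ es) = cong (_ ∷_) (concat-vars es)

  X-X≡sumOfVars : ∀ u v → X G v -ₚ X G u ≡
                  sumOfVars 1ℤ (incidentEdges G v) ++ sumOfVars -1ℤ (incidentEdges G u)
  X-X≡sumOfVars u v rewrite X≡sumOfVars u | X≡sumOfVars v =
    cong (sumOfVars 1ℤ (incidentEdges G v) ++_) (sym (List.map-∘ (incidentEdges G u)))

  series-X-X-* : ∀ u v q → series ((X G v -ₚ X G u) *ₚ q) ≗ mul (λ e → row (u , v) (ends G e)) (series q)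
  series-X-X-* u v q M = begin
    series ((X G v -ₚ X G u) *ₚ q) M
      ≡⟨ cong (λ p → series (p *ₚ q) M) (X-X≡sumOfVars u v) ⟩
    series ((sumOfVars 1ℤ (incidentEdges G v) ++ sumOfVars -1ℤ (incidentEdges G u)) *ₚ q) M
      ≡⟨ cong (λ p → series p M) (List.cartesianProductWith-distribʳ-++ _
           (sumOfVars 1ℤ (incidentEdges G v)) (sumOfVars -1ℤ (incidentEdges G u)) q) ⟩
    series (sumOfVars 1ℤ (incidentEdges G v) *ₚ q ++ sumOfVars -1ℤ (incidentEdges G u) *ₚ q) M
      ≡⟨ coeff-++ (sumOfVars 1ℤ (incidentEdges G v) *ₚ q) _ (Vec.tabulate M) ⟩
    series (sumOfVars 1ℤ (incidentEdges G v) *ₚ q) M ℤ.+ series (sumOfVars -1ℤ (incidentEdges G u) *ₚ q) M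
      ≡⟨ cong₂ ℤ._+_ (expand 1ℤ v) (expand -1ℤ u) ⟩
    ∑ (allFin m) (term 1ℤ v) ℤ.+ ∑ (allFin m) (term -1ℤ u)
      ≡⟨ ∑-+ (allFin m) (term 1ℤ v) (term -1ℤ u) ⟨
    ∑ (allFin m) (λ e → term 1ℤ v e ℤ.+ term -1ℤ u e)
      ≡⟨ ∑-cong′ (allFin m) collect ⟩
    mul (λ e → row (u , v) (ends G e)) (series q) M   ∎
    where
    open ≡-Reasoning
    s : Fin m → ℤ
    s e = shift e (series q) M
    term : ℤ → Fin n → Fin m → ℤ
    term c w e = if does ((w Fin.≟ proj₁ (ends G e)) ⊎-dec (w Fin.≟ proj₂ (ends G e))) then c ℤ.* s e else 0ℤ
    expand : ∀ c w → series (sumOfVars c (incidentEdges G w) *ₚ q) M ≡ ∑ (allFin m) (term c w)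
    expand c w = trans (series-sumOfVars-* c (incidentEdges G w) q M)
      (∑-filter (λ e → (w Fin.≟ proj₁ (ends G e)) ⊎-dec (w Fin.≟ proj₂ (ends G e))) (allFin m) _)
    collect : ∀ e → term 1ℤ v e ℤ.+ term -1ℤ u e ≡ row (u , v) (ends G e) ℤ.* s e
    collect e with does ((v Fin.≟ proj₁ (ends G e)) ⊎-dec (v Fin.≟ proj₂ (ends G e)))
                 | does ((u Fin.≟ proj₁ (ends G e)) ⊎-dec (u Fin.≟ proj₂ (ends G e)))
    ... | true  | true  = sym (ℤ.*-distribʳ-+ (s e) 1ℤ -1ℤ)
    ... | true  | false = ℤ.+-identityʳ _
    ... | false | true  = ℤ.+-identityˡ _
    ... | false | false = refl

  series-P : series (P G (const true)) ≗ coef (λ f e → row (ends G f) (ends G e)) (allFin m)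
  series-P = go (allFin m)
    where
    go : ∀ fs → series (foldr _*ₚ_ 1ₚ (map (λ f → X G (proj₂ (ends G f)) -ₚ X G (proj₁ (ends G f))) fs))
              ≗ coef (λ f e → row (ends G f) (ends G e)) fs
    go []       M = series-1ₚ M
    go (f ∷ fs) M = trans (series-X-X-* _ _ _ M) (mul-cong {λ e → row (ends G f) (ends G e)} (λ _ → refl) (go fs) M)

  map-ends : map (ends G) (allFin m) ≡ edges G
  map-ends = trans (List.map-tabulate id (ends G)) (List.tabulate-lookup (edges G))

-- Edges of a box product

filter-map : ∀ {A B : Set} {P : Pred B 0ℓ} {Q : Pred A 0ℓ} (P? : Decidable P) (Q? : Decidable Q) {f : A → B} →
             (∀ {x} → P (f x) → Q x) → (∀ {x} → Q x → P (f x)) →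
             ∀ xs → filter P? (map f xs) ≡ map f (filter Q? xs)
filter-map P? Q? P⇒Q Q⇒P []       = refl
filter-map P? Q? {f} P⇒Q Q⇒P (x ∷ xs) with Q? x | filter-map P? Q? {f} P⇒Q Q⇒P xs
... | yes Qx | ih = trans (List.filter-accept P? (Q⇒P Qx)) (cong (f x ∷_) ih)
... | no ¬Qx | ih = trans (List.filter-reject P? (¬Qx ∘ P⇒Q)) ih

module _ {A : Set} where

  filter-filter : ∀ {P Q R : Pred A 0ℓ} (P? : Decidable P) (Q? : Decidable Q) (R? : Decidable R) →
                  (∀ {x} → P x → Q x → R x) → (∀ {x} → R x → P x × Q x) →
                  ∀ xs → filter P? (filter Q? xs) ≡ filter R? xs
  filter-filter P? Q? R? PQ⇒R R⇒PQ []       = refl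
  filter-filter P? Q? R? PQ⇒R R⇒PQ (x ∷ xs) with Q? x | filter-filter P? Q? R? PQ⇒R R⇒PQ xs
  ... | no ¬Qx | ih = trans ih (sym (List.filter-reject R? (¬Qx ∘ proj₂ ∘ R⇒PQ)))
  ... | yes Qx | ih with P? x
  ...   | yes Px = trans (cong (x ∷_) ih) (sym (List.filter-accept R? (PQ⇒R Px Qx)))
  ...   | no ¬Px = trans ih (sym (List.filter-reject R? (¬Px ∘ proj₁ ∘ R⇒PQ)))

  filter-cartesianProduct :
    ∀ {B : Set} {P : Pred A 0ℓ} {Q : Pred B 0ℓ} (P? : Decidable P) (Q? : Decidable Q) xs ys →
    filter (λ (x , y) → P? x ×-dec Q? y) (cartesianProduct xs ys) ≡
    cartesianProduct (filter P? xs) (filter Q? ys)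
  filter-cartesianProduct P? Q? []       ys = refl
  filter-cartesianProduct {P = P} {Q} P? Q? (x ∷ xs) ys = begin
    filter PQ? (map (x ,_) ys ++ cartesianProduct xs ys)
      ≡⟨ List.filter-++ PQ? (map (x ,_) ys) _ ⟩
    filter PQ? (map (x ,_) ys) ++ filter PQ? (cartesianProduct xs ys)
      ≡⟨ cong (filter PQ? (map (x ,_) ys) ++_) (filter-cartesianProduct P? Q? xs ys) ⟩
    filter PQ? (map (x ,_) ys) ++ cartesianProduct (filter P? xs) (filter Q? ys)
      ≡⟨ head (P? x) ⟩
    cartesianProduct (filter P? (x ∷ xs)) (filter Q? ys)  ∎
    where
    open ≡-Reasoning
    PQ? = λ z → P? (proj₁ z) ×-dec Q? (proj₂ z)
    head : Dec (P x) →
           filter PQ? (map (x ,_) ys) ++ cartesianProduct (filter P? xs) (filter Q? ys) ≡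
           cartesianProduct (filter P? (x ∷ xs)) (filter Q? ys)
    head (yes Px) rewrite List.filter-accept P? {xs = xs} Px =
      cong (_++ _) (filter-map PQ? Q? proj₂ (Px ,_) ys)
    head (no ¬Px) rewrite List.filter-reject P? {xs = xs} ¬Px =
      cong (_++ cartesianProduct (filter P? xs) (filter Q? ys)) (List.filter-none PQ? {map (x ,_) ys} (All.tabulate λ z∈ → case ∈-map⁻ (x ,_) z∈ of
        λ { (_ , _ , refl) → ¬Px ∘ proj₁ }))

map-cartesianProduct : ∀ {A B C D : Set} (f : A → B) (g : C → D) xs ys →
  cartesianProduct (map f xs) (map g ys) ≡ map (λ (x , y) → f x , g y) (cartesianProduct xs ys)
map-cartesianProduct f g []       ys = refl
map-cartesianProduct f g (x ∷ xs) ys = begin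
  map (f x ,_) (map g ys) ++ cartesianProduct (map f xs) (map g ys)
    ≡⟨ cong₂ _++_ (trans (sym (List.map-∘ ys)) (List.map-∘ ys)) (map-cartesianProduct f g xs ys) ⟩
  map fg (map (x ,_) ys) ++ map fg (cartesianProduct xs ys)
    ≡⟨ List.map-++ fg (map (x ,_) ys) _ ⟨
  map fg (map (x ,_) ys ++ cartesianProduct xs ys)   ∎
  where
  open ≡-Reasoning
  fg = λ z → f (proj₁ z) , g (proj₂ z)

allFin-suc : ∀ n → allFin (suc n) ≡ Fin.zero ∷ map Fin.suc (allFin n)
allFin-suc n = cong (Fin.zero ∷_) (sym (List.map-tabulate id Fin.suc))

filter-≡-allFin : ∀ {n} (v : Fin n) → filter (Fin._≟ v) (allFin n) ≡ v ∷ []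
filter-≡-allFin {suc n} Fin.zero = trans (cong (filter (Fin._≟ Fin.zero)) (allFin-suc n))
  (cong (Fin.zero ∷_) (List.filter-none (Fin._≟ Fin.zero) {map Fin.suc (allFin n)} (All.tabulate λ x∈ → case ∈-map⁻ Fin.suc x∈ of
    λ { (_ , _ , refl) () })))
filter-≡-allFin {suc n} (Fin.suc v) = trans (cong (filter (Fin._≟ Fin.suc v)) (allFin-suc n))
  (trans (filter-map (Fin._≟ Fin.suc v) (Fin._≟ v) Fin.suc-injective (cong Fin.suc) (allFin n))
         (cong (map Fin.suc) (filter-≡-allFin v)))

allFin-+ : ∀ m n → allFin (m ℕ.+ n) ≡ map (_↑ˡ n) (allFin m) ++ map (m ↑ʳ_) (allFin n)
allFin-+ zero    n = sym (List.map-id (allFin n))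
allFin-+ (suc m) n = begin
  allFin (suc (m ℕ.+ n))
    ≡⟨ allFin-suc (m ℕ.+ n) ⟩
  Fin.zero ∷ map Fin.suc (allFin (m ℕ.+ n))
    ≡⟨ cong (λ xs → Fin.zero ∷ map Fin.suc xs) (allFin-+ m n) ⟩
  Fin.zero ∷ map Fin.suc (map (_↑ˡ n) (allFin m) ++ map (m ↑ʳ_) (allFin n))
    ≡⟨ cong (Fin.zero ∷_) (List.map-++ Fin.suc (map (_↑ˡ n) (allFin m)) _) ⟩
  Fin.zero ∷ map Fin.suc (map (_↑ˡ n) (allFin m)) ++ map Fin.suc (map (m ↑ʳ_) (allFin n))
    ≡⟨ cong₂ (λ xs ys → Fin.zero ∷ xs ++ ys)
         (trans (sym (List.map-∘ (allFin m))) (List.map-∘ (allFin m))) (sym (List.map-∘ (allFin n))) ⟩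
  Fin.zero ∷ map (_↑ˡ n) (map Fin.suc (allFin m)) ++ map (suc m ↑ʳ_) (allFin n)
    ≡⟨ cong (λ xs → map (_↑ˡ n) xs ++ map (suc m ↑ʳ_) (allFin n)) (allFin-suc m) ⟨
  map (_↑ˡ n) (allFin (suc m)) ++ map (suc m ↑ʳ_) (allFin n)   ∎
  where open ≡-Reasoning

allFin-* : ∀ g n → allFin (g ℕ.* n) ≡ map (λ (w , a) → combine w a) (cartesianProduct (allFin g) (allFin n))
allFin-* zero    n = refl
allFin-* (suc g) n = begin
  allFin (n ℕ.+ g ℕ.* n)
    ≡⟨ allFin-+ n (g ℕ.* n) ⟩
  map (_↑ˡ (g ℕ.* n)) (allFin n) ++ map (n ↑ʳ_) (allFin (g ℕ.* n))
    ≡⟨ cong₂ _++_ (List.map-∘ (allFin n)) (cong (map (n ↑ʳ_)) (allFin-* g n)) ⟩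
  map cmb (map (Fin.zero ,_) (allFin n)) ++ map (n ↑ʳ_) (map cmb (cartesianProduct (allFin g) (allFin n)))
    ≡⟨ cong (map cmb (map (Fin.zero ,_) (allFin n)) ++_)
         (trans (sym (List.map-∘ (cartesianProduct (allFin g) (allFin n)))) (List.map-∘ (cartesianProduct (allFin g) (allFin n)))) ⟩
  map cmb (map (Fin.zero ,_) (allFin n)) ++ map cmb (map (λ z → Fin.suc (proj₁ z) , proj₂ z) (cartesianProduct (allFin g) (allFin n)))
    ≡⟨ List.map-++ cmb (map (Fin.zero ,_) (allFin n)) _ ⟨
  map cmb (map (Fin.zero ,_) (allFin n) ++ map (λ z → Fin.suc (proj₁ z) , proj₂ z) (cartesianProduct (allFin g) (allFin n)))
    ≡⟨ cong (λ xs → map cmb (map (Fin.zero ,_) (allFin n) ++ xs)) (trans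
         (sym (map-cartesianProduct Fin.suc id (allFin g) (allFin n)))
         (cong (cartesianProduct (map Fin.suc (allFin g))) (List.map-id (allFin n)))) ⟩
  map cmb (cartesianProduct (Fin.zero ∷ map Fin.suc (allFin g)) (allFin n))
    ≡⟨ cong (λ xs → map cmb (cartesianProduct xs (allFin n))) (allFin-suc g) ⟨
  map cmb (cartesianProduct (allFin (suc g)) (allFin n))   ∎
  where
  open ≡-Reasoning
  cmb : ∀ {g n} → Fin g × Fin n → Fin (g ℕ.* n)
  cmb z = combine (proj₁ z) (proj₂ z)

-- Edge lists, degrees and sums of indicators

module _ (𝓡 : Domain) where
  open Domain 𝓡

  card≡∑ : ∀ {n} (p : Subset n) → ⌞ card p ⌟ ≡ ∑ (allFin n) (λ x → if Vec.lookup p x then 1# else 0#)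
  card≡∑ Vec.[] = refl
  card≡∑ {suc n} (b Vec.∷ p) = trans (step b) (cong (λ z → (if b then 1# else 0#) + z) (trans (card≡∑ p)
    (trans (sym (∑-map Fin.suc (allFin n) bit)) (cong (λ xs → ∑ xs bit) (List.map-tabulate id Fin.suc)))))
    where
    bit : Fin (suc n) → R
    bit x = if Vec.lookup (b Vec.∷ p) x then 1# else 0#
    step : ∀ b → ⌞ card (b Vec.∷ p) ⌟ ≡ (if b then 1# else 0#) + ⌞ card p ⌟
    step true  = refl
    step false = sym (+-identityˡ _)

lookup-injective : ∀ {A : Set} {xs : List A} → Unique xs →
                   ∀ {i j} → List.lookup xs i ≡ List.lookup xs j → i ≡ j
lookup-injective (x∉ AllPairs.∷ _)    {Fin.zero}  {Fin.zero}  _  = refl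
lookup-injective (x∉ AllPairs.∷ _)    {Fin.zero}  {Fin.suc j} eq = contradiction eq (All.lookup x∉ (∈-lookup j))
lookup-injective (x∉ AllPairs.∷ _)    {Fin.suc i} {Fin.zero}  eq = contradiction (sym eq) (All.lookup x∉ (∈-lookup i))
lookup-injective (_  AllPairs.∷ uniq) {Fin.suc i} {Fin.suc j} eq = cong Fin.suc (lookup-injective uniq eq)

module _ {n} (H : Graph n) where

  Edge : Pred (Fin n × Fin n) 0ℓ
  Edge (u , v) = u Fin.< v × Adj H u v

  Edge? : Decidable Edge
  Edge? (u , v) = (u Fin.<? v) ×-dec Adj? H u v

  edges-unique : Unique (edges H)
  edges-unique = Unique.filter⁺ Edge? (Unique.cartesianProduct⁺ (Unique.allFin⁺ n) (Unique.allFin⁺ n))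

  ∈-edges⁺ : ∀ {e} → Edge e → e ∈ₗ edges H
  ∈-edges⁺ = ∈-filter⁺ Edge? (∈-cartesianProduct⁺ (∈-allFin _) (∈-allFin _))

  ends-Edge : ∀ i → Edge (ends H i)
  ends-Edge i = proj₂ (∈-filter⁻ Edge? {xs = cartesianProduct (allFin n) (allFin n)} (∈-lookup i))

  ends-injective : ∀ {i j} → ends H i ≡ ends H j → i ≡ j
  ends-injective = lookup-injective edges-unique

  ends-surjective : ∀ {u v} → Adj H u v → ∃[ i ] (ends H i ≡ (u , v) ⊎ ends H i ≡ (v , u))
  ends-surjective {u} {v} uv with Fin.<-cmp u v
  ... | tri< u<v _ _ = Any.index (∈-edges⁺ (u<v , uv)) , inj₁ (sym (Any.lookup-index (∈-edges⁺ (u<v , uv))))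
  ... | tri≈ _ u≡v _ = contradiction uv (irrefl H u≡v)
  ... | tri> _ _ v<u = Any.index (∈-edges⁺ (v<u , symm H uv)) , inj₂ (sym (Any.lookup-index (∈-edges⁺ (v<u , symm H uv))))

module ∑ℤ = Domain ℤ-domain

ℕ-domain : Domain
ℕ-domain = record
  { R = ℕ ; _+_ = ℕ._+_ ; _*_ = ℕ._*_ ; 0# = 0 ; 1# = 1
  ; isCommutativeSemiring = ℕ.+-*-isCommutativeSemiring
  ; _≟0 = ℕ._≟ 0
  ; *-≢0 = λ {x} x≢0 y≢0 xy≡0 → Sum.[ x≢0 , y≢0 ]′ (ℕ.m*n≡0⇒m≡0∨n≡0 x xy≡0)
  ; ⌞suc⌟≢0 = λ _ ()
  }

module ∑ℕ = Domain ℕ-domain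

⌞⌟≡id : ∀ k → ∑ℕ.⌞ k ⌟ ≡ k
⌞⌟≡id zero    = refl
⌞⌟≡id (suc k) = cong suc (⌞⌟≡id k)

length≡∑1 : ∀ {A : Set} (xs : List A) → length xs ≡ ∑ℕ.∑ xs (λ _ → 1)
length≡∑1 []       = refl
length≡∑1 (x ∷ xs) = cong suc (length≡∑1 xs)

∑-mono-≤ : ∀ {A : Set} (xs : List A) {f g : A → ℕ} → (∀ x → f x ℕ.≤ g x) → ∑ℕ.∑ xs f ℕ.≤ ∑ℕ.∑ xs g
∑-mono-≤ []       f≤g = ℕ.z≤n
∑-mono-≤ (x ∷ xs) f≤g = ℕ.+-mono-≤ (f≤g x) (∑-mono-≤ xs f≤g)

∑-allFin-const : ∀ n c → ∑ℕ.∑ (allFin n) (λ _ → c) ≡ n ℕ.* c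
∑-allFin-const zero    c = refl
∑-allFin-const (suc n) c = cong (c ℕ.+_) (begin
  ∑ℕ.∑ (List.tabulate Fin.suc) const-c        ≡⟨ cong (λ xs → ∑ℕ.∑ xs const-c) (List.map-tabulate id Fin.suc) ⟨
  ∑ℕ.∑ (map Fin.suc (allFin n)) const-c       ≡⟨ ∑ℕ.∑-map Fin.suc (allFin n) const-c ⟩
  ∑ℕ.∑ (allFin n) (λ _ → c)                   ≡⟨ ∑-allFin-const n c ⟩
  n ℕ.* c                                     ∎)
  where
  open ≡-Reasoning
  const-c : Fin (suc n) → ℕ
  const-c _ = c

module _ (𝓡 : Domain) where
  open Domain 𝓡

  indicator : ∀ {P : Set} → Dec P → R
  indicator P? = if does P? then 1# else 0#

  ∑-indicator : ∀ {n} (v : Fin n) (f : Fin n → R) →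
                ∑ (allFin n) (λ x → indicator (x Fin.≟ v) * f x) ≡ f v
  ∑-indicator {n} v f = trans
    (∑-single (Unique.allFin⁺ n) (∈-allFin v) λ y v≢y →
      trans (cong (λ b → (if b then 1# else 0#) * f y) (dec-false (y Fin.≟ v) (v≢y ∘ sym))) (zeroˡ (f y)))
    (trans (cong (λ b → (if b then 1# else 0#) * f v) (dec-true (v Fin.≟ v) refl)) (*-identityˡ (f v)))

  ∑-vertices : ∀ g n (f : Fin (g ℕ.* n) → R) →
               ∑ (allFin (g ℕ.* n)) f ≡ ∑ (allFin g) (λ w → ∑ (allFin n) (λ a → f (combine w a)))
  ∑-vertices g n f = begin
    ∑ (allFin (g ℕ.* n)) f
      ≡⟨ cong (λ xs → ∑ xs f) (allFin-* g n) ⟩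
    ∑ (map (λ (w , a) → combine w a) (cartesianProduct (allFin g) (allFin n))) f
      ≡⟨ ∑-map (λ (w , a) → combine w a) (cartesianProduct (allFin g) (allFin n)) f ⟩
    ∑ (cartesianProduct (allFin g) (allFin n)) (λ (w , a) → f (combine w a))
      ≡⟨ ∑-cartesianProduct (allFin g) (allFin n) _ ⟩
    ∑ (allFin g) (λ w → ∑ (allFin n) (λ a → f (combine w a)))   ∎
    where open ≡-Reasoning

lookup-neighbours : ∀ {n} (H : Graph n) v u → Vec.lookup (neighbours H v) u ≡ does (Adj? H v u)
lookup-neighbours H v u = Vec.lookup∘tabulate (λ u → does (Adj? H v u)) u

∈-neighbours⁺ : ∀ {n} (H : Graph n) {v u} → Adj H v u → u ∈ neighbours H v
∈-neighbours⁺ H {v} {u} vu = Vec.lookup⇒[]= u _ (trans (lookup-neighbours H v u) (dec-true (Adj? H v u) vu))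

∈-neighbours⁻ : ∀ {n} (H : Graph n) {v u} → u ∈ neighbours H v → Adj H v u
∈-neighbours⁻ H {v} {u} u∈ = decidable-stable (Adj? H v u) λ ¬vu →
  case trans (sym (Vec.[]=⇒lookup u∈)) (trans (lookup-neighbours H v u) (dec-false (Adj? H v u) ¬vu)) of λ ()

module _ {n} (H : Graph n) where

  open ∑ℤ

  -- Each neighbour c of a accounts for exactly one listed edge, (a , c) or (c , a) according to the
  -- order of the two vertices.
  ∑-incidence : ∀ a → ∑ (edges H) (incidence a) ≡ ⌞ degree H a ⌟
  ∑-incidence a = begin
    ∑ (edges H) (incidence a)
      ≡⟨ ∑-filter (Edge? H) (cartesianProduct (allFin n) (allFin n)) (incidence a) ⟩
    ∑ (cartesianProduct (allFin n) (allFin n)) (λ e → if does (Edge? H e) then incidence a e else 0ℤ)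
      ≡⟨ ∑-cartesianProduct (allFin n) (allFin n) (λ e → if does (Edge? H e) then incidence a e else 0ℤ) ⟩
    ∑ (allFin n) (λ b → ∑ (allFin n) (λ c → if does (Edge? H (b , c)) then incidence a (b , c) else 0ℤ))
      ≡⟨ ∑-cong′ (allFin n) (λ b → trans (∑-cong′ (allFin n) (λ c → endpoint b c (Edge? H (b , c)))) (∑-+ (allFin n) (λ c → δ b ℤ.* w b c) (λ c → δ c ℤ.* w b c))) ⟩
    ∑ (allFin n) (λ b → ∑ (allFin n) (λ c → δ b ℤ.* w b c) ℤ.+ ∑ (allFin n) (λ c → δ c ℤ.* w b c))
      ≡⟨ ∑-+ (allFin n) (λ b → ∑ (allFin n) (λ c → δ b ℤ.* w b c)) (λ b → ∑ (allFin n) (λ c → δ c ℤ.* w b c)) ⟩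
    ∑ (allFin n) (λ b → ∑ (allFin n) (λ c → δ b ℤ.* w b c)) ℤ.+ ∑ (allFin n) (λ b → ∑ (allFin n) (λ c → δ c ℤ.* w b c))
      ≡⟨ cong₂ ℤ._+_
           (trans (∑-comm (allFin n) (allFin n) (λ b c → δ b ℤ.* w b c))
                  (∑-cong′ (allFin n) λ c → ∑-indicator ℤ-domain a (λ b → w b c)))
           (∑-cong′ (allFin n) λ b → ∑-indicator ℤ-domain a (w b)) ⟩
    ∑ (allFin n) (w a) ℤ.+ ∑ (allFin n) (λ b → w b a)
      ≡⟨ ∑-+ (allFin n) (w a) (λ b → w b a) ⟨
    ∑ (allFin n) (λ c → w a c ℤ.+ w c a)
      ≡⟨ ∑-cong′ (allFin n) bothOrders ⟩
    ∑ (allFin n) (λ c → if Vec.lookup (neighbours H a) c then 1ℤ else 0ℤ)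
      ≡⟨ card≡∑ ℤ-domain (neighbours H a) ⟨
    ⌞ degree H a ⌟   ∎
    where
    open ≡-Reasoning
    δ : Fin n → ℤ
    δ b = indicator ℤ-domain (b Fin.≟ a)
    w : Fin n → Fin n → ℤ
    w b c = indicator ℤ-domain (Edge? H (b , c))
    toℤ : Bool → ℤ
    toℤ b = if b then 1ℤ else 0ℤ
    endpoint : ∀ b c (bc? : Dec (Edge H (b , c))) →
               (if does bc? then incidence a (b , c) else 0ℤ) ≡
               δ b ℤ.* indicator ℤ-domain bc? ℤ.+ δ c ℤ.* indicator ℤ-domain bc?
    endpoint b c (no  _) = sym (cong₂ ℤ._+_ (ℤ.*-zeroʳ (δ b)) (ℤ.*-zeroʳ (δ c)))
    endpoint b c (yes (b<c , _))
      rewrite does-⇔ (mk⇔ sym sym) (b Fin.≟ a) (a Fin.≟ b) | does-⇔ (mk⇔ sym sym) (c Fin.≟ a) (a Fin.≟ c)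
      with a Fin.≟ b | a Fin.≟ c
    ... | yes refl | yes refl = contradiction b<c (ℕ.<-irrefl refl)
    ... | yes _    | no _     = refl
    ... | no _     | yes _    = refl
    ... | no _     | no _     = refl
    bothOrders : ∀ c → w a c ℤ.+ w c a ≡ (if Vec.lookup (neighbours H a) c then 1ℤ else 0ℤ)
    bothOrders c rewrite lookup-neighbours H a c with Fin.<-cmp a c
    ... | tri< a<c _ c≮a = trans
      (cong₂ (λ p q → toℤ p ℤ.+ toℤ q)
        (does-⇔ (mk⇔ proj₂ (a<c ,_)) (Edge? H (a , c)) (Adj? H a c))
        (dec-false (Edge? H (c , a)) (c≮a ∘ proj₁)))
      (ℤ.+-identityʳ _)
    ... | tri≈ a≮c a≡c c≮a = trans
      (cong₂ (λ p q → toℤ p ℤ.+ toℤ q)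
        (dec-false (Edge? H (a , c)) (a≮c ∘ proj₁)) (dec-false (Edge? H (c , a)) (c≮a ∘ proj₁)))
      (cong toℤ (sym (dec-false (Adj? H a c) λ ac → irrefl H a≡c ac)))
    ... | tri> a≮c _ c<a = trans
      (cong₂ (λ p q → toℤ p ℤ.+ toℤ q)
        (dec-false (Edge? H (a , c)) (a≮c ∘ proj₁))
        (does-⇔ (mk⇔ (symm H ∘ proj₂) (λ ac → c<a , symm H ac)) (Edge? H (c , a)) (Adj? H a c)))
      (ℤ.+-identityˡ _)

-- The copies of H inside G □ H

module BoxProduct {g n} (G : Graph g) (H : Graph n) where

  private
    V = Fin (g ℕ.* n)
    K = G □ H

  copy : V → Fin g
  copy x = proj₁ (remQuot n x)

  pos : V → Fin n
  pos x = proj₂ (remQuot {g} n x)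

  embed : Fin g → Fin n × Fin n → V × V
  embed v (a , b) = combine v a , combine v b

  copy-combine : ∀ (w : Fin g) (a : Fin n) → copy (combine w a) ≡ w
  copy-combine w a = cong proj₁ (Fin.remQuot-combine w a)

  pos-combine : ∀ (w : Fin g) (a : Fin n) → pos (combine w a) ≡ a
  pos-combine w a = cong proj₂ (Fin.remQuot-combine w a)

  combine-copy-pos : ∀ x → combine (copy x) (pos x) ≡ x
  combine-copy-pos = Fin.combine-remQuot {g} n

  embed-injective : ∀ v {e e′} → embed v e ≡ embed v e′ → e ≡ e′
  embed-injective v {a , b} {a′ , b′} eq = cong₂ _,_
    (Fin.combine-injectiveʳ v a v a′ (cong proj₁ eq)) (Fin.combine-injectiveʳ v b v b′ (cong proj₂ eq))

  InCopy : Fin g → Pred (V × V) 0ℓ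
  InCopy v (x , y) = copy x ≡ v × copy y ≡ v

  InCopy? : ∀ v → Decidable (InCopy v)
  InCopy? v (x , y) = (copy x Fin.≟ v) ×-dec (copy y Fin.≟ v)

  copy-vertices : ∀ v → filter (λ x → copy x Fin.≟ v) (allFin (g ℕ.* n)) ≡ map (combine v) (allFin n)
  copy-vertices v = begin
    filter (λ x → copy x Fin.≟ v) (allFin (g ℕ.* n))
      ≡⟨ cong (filter (λ x → copy x Fin.≟ v)) (allFin-* g n) ⟩
    filter (λ x → copy x Fin.≟ v) (map cmb (cartesianProduct (allFin g) (allFin n)))
      ≡⟨ filter-map (λ x → copy x Fin.≟ v) (λ z → (proj₁ z Fin.≟ v) ×-dec yes tt)
           (λ {z} eq → trans (sym (copy-combine (proj₁ z) (proj₂ z))) eq , tt)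
           (λ {z} eq → trans (copy-combine (proj₁ z) (proj₂ z)) (proj₁ eq)) (cartesianProduct (allFin g) (allFin n)) ⟩
    map cmb (filter (λ z → (proj₁ z Fin.≟ v) ×-dec yes tt) (cartesianProduct (allFin g) (allFin n)))
      ≡⟨ cong (map cmb) (filter-cartesianProduct (Fin._≟ v) (λ _ → yes tt) (allFin g) (allFin n)) ⟩
    map cmb (cartesianProduct (filter (Fin._≟ v) (allFin g)) (filter (λ _ → yes tt) (allFin n)))
      ≡⟨ cong₂ (λ xs ys → map cmb (cartesianProduct xs ys)) (filter-≡-allFin v)
           (List.filter-all (λ _ → yes tt) (All.universal (λ _ → tt) (allFin n))) ⟩
    map cmb (map (v ,_) (allFin n) ++ [])
      ≡⟨ cong (map cmb) (List.++-identityʳ _) ⟩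
    map cmb (map (v ,_) (allFin n))
      ≡⟨ List.map-∘ (allFin n) ⟨
    map (combine v) (allFin n)   ∎
    where
    open ≡-Reasoning
    cmb : Fin g × Fin n → V
    cmb z = combine (proj₁ z) (proj₂ z)

  Edge-embed⁺ : ∀ v {e} → Edge H e → Edge K (embed v e)
  Edge-embed⁺ v {a , b} (a<b , ab) = lt , subst₂ Adj′
    (sym (Fin.remQuot-combine v a)) (sym (Fin.remQuot-combine v b)) (inj₁ (refl , ab))
    where
    Adj′ : Fin g × Fin n → Fin g × Fin n → Set
    Adj′ (u , u′) (w , w′) = (u ≡ w × Adj H u′ w′) ⊎ (u′ ≡ w′ × Adj G u w)
    lt : combine v a Fin.< combine v b
    lt = subst₂ ℕ._<_ (sym (Fin.toℕ-combine v a)) (sym (Fin.toℕ-combine v b)) (ℕ.+-monoʳ-< _ a<b)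

  Edge-embed⁻ : ∀ v {e} → Edge K (embed v e) → Edge H e
  Edge-embed⁻ v {a , b} (lt , adj) = ℕ.+-cancelˡ-< (n ℕ.* Fin.toℕ v) _ _
    (subst₂ ℕ._<_ (Fin.toℕ-combine v a) (Fin.toℕ-combine v b) lt) ,
    (case adj of λ
      { (inj₁ (_ , ab)) → subst₂ (Adj H) (pos-combine v a) (pos-combine v b) ab
      ; (inj₂ (_ , vv)) → contradiction vv (irrefl G (trans (copy-combine v a) (sym (copy-combine v b)))) })

  -- `combine v` is increasing and vertices are listed lexicographically, so the copy inherits even
  -- the order of the edges of H. Equality of lists is what `coef`, a fold over a list, can use
  -- directly.
  copy-edges : ∀ v → filter (InCopy? v) (edges K) ≡ map (embed v) (edges H)
  copy-edges v = begin
    filter (InCopy? v) (filter (Edge? K) (cartesianProduct V* V*))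
      ≡⟨ filter-filter (InCopy? v) (Edge? K) EC? (λ p q → q , p) Product.swap (cartesianProduct V* V*) ⟩
    filter EC? (cartesianProduct V* V*)
      ≡⟨ filter-filter (Edge? K) (InCopy? v) EC? _,_ id (cartesianProduct V* V*) ⟨
    filter (Edge? K) (filter (InCopy? v) (cartesianProduct V* V*))
      ≡⟨ cong (filter (Edge? K)) (filter-cartesianProduct C? C? V* V*) ⟩
    filter (Edge? K) (cartesianProduct (filter C? V*) (filter C? V*))
      ≡⟨ cong (λ xs → filter (Edge? K) (cartesianProduct xs xs)) (copy-vertices v) ⟩
    filter (Edge? K) (cartesianProduct (map (combine v) (allFin n)) (map (combine v) (allFin n)))
      ≡⟨ cong (filter (Edge? K)) (map-cartesianProduct (combine v) (combine v) (allFin n) (allFin n)) ⟩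
    filter (Edge? K) (map (embed v) (cartesianProduct (allFin n) (allFin n)))
      ≡⟨ filter-map (Edge? K) (Edge? H) (Edge-embed⁻ v) (Edge-embed⁺ v) (cartesianProduct (allFin n) (allFin n)) ⟩
    map (embed v) (edges H)   ∎
    where
    open ≡-Reasoning
    V* = allFin (g ℕ.* n)
    C? = λ (x : V) → copy x Fin.≟ v
    EC? = λ (e : V × V) → Edge? K e ×-dec InCopy? v e

  ≡combine⇔ : ∀ {x v} b → copy x ≡ v → (x ≡ combine v b) ⇔ (pos x ≡ b)
  ≡combine⇔ {x} {v} b x∈v = mk⇔
    (λ eq → trans (cong pos eq) (pos-combine v b))
    (λ eq → trans (sym (combine-copy-pos x)) (cong₂ combine x∈v eq))

  incidence-embed : ∀ x v e → incidence x (embed v e) ≡ (if does (copy x Fin.≟ v) then incidence (pos x) e else 0ℤ)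
  incidence-embed x v (b , c) with copy x Fin.≟ v
  ... | yes refl rewrite does-⇔ (≡combine⇔ b refl) (x Fin.≟ combine (copy x) b) (pos x Fin.≟ b)
                       | does-⇔ (≡combine⇔ c refl) (x Fin.≟ combine (copy x) c) (pos x Fin.≟ c) = refl
  ... | no  x∉v rewrite dec-false (x Fin.≟ combine v b) (λ eq → x∉v (trans (cong copy eq) (copy-combine v b)))
                      | dec-false (x Fin.≟ combine v c) (λ eq → x∉v (trans (cong copy eq) (copy-combine v c))) = refl

  row-embed : ∀ v f e → row (embed v f) (embed v e) ≡ row f e
  row-embed v (a , b) e = cong₂ ℤ._-_ (inc b) (inc a)
    where
    inc : ∀ b → incidence (combine v b) (embed v e) ≡ incidence b e
    inc b = trans (incidence-embed (combine v b) v e) (trans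
      (cong (λ t → if t then incidence (pos (combine v b)) e else 0ℤ) (dec-true (copy (combine v b) Fin.≟ v) (copy-combine v b)))
      (cong (λ t → incidence t e) (pos-combine v b)))

-- Elimination of the copies of H

x∈p─q⇒x∉q : ∀ {k} (p q : Subset k) {x} → x ∈ p Subset.─ q → x ∉ q
x∈p─q⇒x∉q (_ Vec.∷ p) (true  Vec.∷ q) (Vec.there x∈) (Vec.there x∈q) = x∈p─q⇒x∉q p q x∈ x∈q
x∈p─q⇒x∉q (_ Vec.∷ p) (false Vec.∷ q) (Vec.there x∈) (Vec.there x∈q) = x∈p─q⇒x∉q p q x∈ x∈q

x∈p-y⇒x≢y : ∀ {k} {p : Subset k} {x y} → x ∈ p Subset.- y → x ≢ y
x∈p-y⇒x≢y {p = p} {x} x∈ refl = x∈p─q⇒x∉q p ⁅ x ⁆ x∈ (Subset.x∈⁅x⁆ x)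

module _ {g n} (G : Graph g) (H : Graph n) where

  open BoxProduct G H

  private
    V = Fin (g ℕ.* n)
    K = G □ H

    V* : List V
    V* = allFin (g ℕ.* n)

    ι : ∀ {P : Set} → Dec P → ℕ
    ι = indicator ℕ-domain

  Within : Subset g → Pred (V × V) 0ℓ
  Within S (x , y) = copy x ∈ S × copy y ∈ S

  Within? : ∀ S → Decidable (Within S)
  Within? S (x , y) = (copy x Subset.∈? S) ×-dec (copy y Subset.∈? S)

  -- Both ends lie in copy v or neither does. The negation describes the crossing edges, the ones
  -- whose factors absorb a derivative.
  SameSide : Fin g → Pred (V × V) 0ℓ
  SameSide v (x , y) = does (copy x Fin.≟ v) ≡ does (copy y Fin.≟ v)

  SameSide? : ∀ v → Decidable (SameSide v)
  SameSide? v (x , y) = does (copy x Fin.≟ v) Bool.≟ does (copy y Fin.≟ v)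

  -- A crossing edge changes the copy, so it comes from G and keeps its position. It is determined
  -- by that position, for which there are n choices, and by a neighbour of v in S.
  crossing-count : ∀ S v → length (filter (¬? ∘ SameSide? v) (filter (Within? S) (edges K)))
                           ℕ.≤ n ℕ.* card (neighbours G v ∩ S)
  crossing-count S v = begin
    length (filter (¬? ∘ SameSide? v) (filter (Within? S) (edges K)))
      ≡⟨ cong length (filter-filter (¬? ∘ SameSide? v) (Within? S) crossing? (λ p q → q , p) Product.swap (edges K)) ⟩
    length (filter crossing? (edges K))
      ≡⟨ cong length (filter-filter crossing? (Edge? K) crossingEdge? (λ p q → q , p) Product.swap (cartesianProduct V* V*)) ⟩
    length (filter crossingEdge? (cartesianProduct V* V*))
      ≡⟨ trans (length≡∑1 (filter crossingEdge? (cartesianProduct V* V*))) (∑-filter crossingEdge? (cartesianProduct V* V*) (λ _ → 1)) ⟩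
    ∑ (cartesianProduct V* V*) (λ e → ι (crossingEdge? e))
      ≡⟨ ∑-cartesianProduct V* V* (λ e → ι (crossingEdge? e)) ⟩
    ∑ V* (λ x → ∑ V* (λ y → ι (crossingEdge? (x , y))))
      ≤⟨ ∑-mono-≤ V* (λ x → ∑-mono-≤ V* (λ y → oriented x y (crossingEdge? (x , y)))) ⟩
    ∑ V* (λ x → ∑ V* (λ y → lt x y ℕ.* α x y ℕ.+ lt x y ℕ.* α y x))
      ≡⟨ trans (∑-cong′ V* λ x → ∑-+ V* (λ y → lt x y ℕ.* α x y) (λ y → lt x y ℕ.* α y x))
               (∑-+ V* (λ x → ∑ V* (λ y → lt x y ℕ.* α x y)) (λ x → ∑ V* (λ y → lt x y ℕ.* α y x))) ⟩
    ∑ V* (λ x → ∑ V* (λ y → lt x y ℕ.* α x y)) ℕ.+ ∑ V* (λ x → ∑ V* (λ y → lt x y ℕ.* α y x))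
      -- An edge is listed with x < y, whichever end lies in copy v. Exchanging x and y in the
      -- second sum makes x that end in both, and then the conditions x < y and y < x exclude each
      -- other.
      ≡⟨ cong (∑ V* (λ x → ∑ V* (λ y → lt x y ℕ.* α x y)) ℕ.+_) (∑-comm V* V* (λ x y → lt x y ℕ.* α y x)) ⟩
    ∑ V* (λ x → ∑ V* (λ y → lt x y ℕ.* α x y)) ℕ.+ ∑ V* (λ x → ∑ V* (λ y → lt y x ℕ.* α x y))
      ≡⟨ trans (∑-cong′ V* λ x → ∑-+ V* (λ y → lt x y ℕ.* α x y) (λ y → lt y x ℕ.* α x y))
               (∑-+ V* (λ x → ∑ V* (λ y → lt x y ℕ.* α x y)) (λ x → ∑ V* (λ y → lt y x ℕ.* α x y))) ⟨
    ∑ V* (λ x → ∑ V* (λ y → lt x y ℕ.* α x y ℕ.+ lt y x ℕ.* α x y))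
      ≤⟨ ∑-mono-≤ V* (λ x → ∑-mono-≤ V* (λ y → unoriented x y)) ⟩
    ∑ V* (λ x → ∑ V* (α x))
      ≡⟨ ∑-vertices ℕ-domain g n (λ x → ∑ V* (α x)) ⟩
    ∑ (allFin g) (λ w → ∑ (allFin n) (λ a → ∑ V* (α (combine w a))))
      ≡⟨ ∑-cong′ (allFin g) (λ w → ∑-cong′ (allFin n) (row-sum w)) ⟩
    ∑ (allFin g) (λ w → ∑ (allFin n) (λ a → ι (w Fin.≟ v) ℕ.* card T))
      ≡⟨ ∑-comm (allFin g) (allFin n) (λ w a → ι (w Fin.≟ v) ℕ.* card T) ⟩
    ∑ (allFin n) (λ a → ∑ (allFin g) (λ w → ι (w Fin.≟ v) ℕ.* card T))
      ≡⟨ ∑-cong′ (allFin n) (λ a → ∑-indicator ℕ-domain v (λ _ → card T)) ⟩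
    ∑ (allFin n) (λ a → card T)
      ≡⟨ ∑-allFin-const n (card T) ⟩
    n ℕ.* card T   ∎
    where
    open ℕ.≤-Reasoning
    open ∑ℕ
    T = neighbours G v ∩ S
    crossing? = λ (e : V × V) → Within? S e ×-dec ¬? (SameSide? v e)
    crossingEdge? = λ (e : V × V) → Edge? K e ×-dec crossing? e
    bit : Fin g → ℕ
    bit w = if Vec.lookup T w then 1 else 0
    lt α : V → V → ℕ
    lt x y = ι (x Fin.<? y)
    -- Counts a crossing edge of copy v from its end x in that copy.
    α x y = ι (copy x Fin.≟ v) ℕ.* (ι (pos y Fin.≟ pos x) ℕ.* bit (copy y))

    α≡1 : ∀ {x y} → copy x ≡ v → pos x ≡ pos y → Adj G v (copy y) → copy y ∈ S → α x y ≡ 1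
    α≡1 {x} {y} x∈v px≡py adj y∈S
      rewrite dec-true (copy x Fin.≟ v) x∈v | dec-true (pos y Fin.≟ pos x) (sym px≡py)
            | Vec.[]=⇒lookup (Subset.x∈p∩q⁺ (∈-neighbours⁺ G adj , y∈S)) = refl

    oriented : ∀ x y (e? : Dec (Edge K (x , y) × Within S (x , y) × ¬ SameSide v (x , y))) →
               ι e? ℕ.≤ lt x y ℕ.* α x y ℕ.+ lt x y ℕ.* α y x
    oriented x y (no _) = ℕ.z≤n
    oriented x y (yes ((x<y , inj₁ (cx≡cy , _)) , _ , ¬same)) =
      contradiction (cong (λ w → does (w Fin.≟ v)) cx≡cy) ¬same
    oriented x y (yes ((x<y , inj₂ (px≡py , adj)) , (x∈S , y∈S) , ¬same)) =
      subst (λ l → 1 ℕ.≤ l ℕ.* α x y ℕ.+ l ℕ.* α y x) (sym lt≡1) (one-side (copy x Fin.≟ v) (copy y Fin.≟ v))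
      where
      lt≡1 : lt x y ≡ 1
      lt≡1 = cong (λ b → if b then 1 else 0) (dec-true (x Fin.<? y) x<y)
      one-side : Dec (copy x ≡ v) → Dec (copy y ≡ v) → 1 ℕ.≤ 1 ℕ.* α x y ℕ.+ 1 ℕ.* α y x
      one-side (yes x∈v) _ = ℕ.≤-trans
        (ℕ.≤-reflexive (sym (cong (1 ℕ.*_) (α≡1 x∈v px≡py (subst (λ w → Adj G w (copy y)) x∈v adj) y∈S)))) (ℕ.m≤m+n (1 ℕ.* α x y) _)
      one-side _ (yes y∈v) = ℕ.≤-trans
        (ℕ.≤-reflexive (sym (cong (1 ℕ.*_) (α≡1 y∈v (sym px≡py) (subst (λ w → Adj G w (copy x)) y∈v (symm G adj)) x∈S)))) (ℕ.m≤n+m (1 ℕ.* α y x) (1 ℕ.* α x y))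
      one-side (no x∉v) (no y∉v) = contradiction
        (trans (dec-false (copy x Fin.≟ v) x∉v) (sym (dec-false (copy y Fin.≟ v) y∉v))) ¬same

    unoriented : ∀ x y → lt x y ℕ.* α x y ℕ.+ lt y x ℕ.* α x y ℕ.≤ α x y
    unoriented x y = exclusive (Fin.<-cmp x y)
      where
      toℕ : Bool → ℕ
      toℕ b = if b then 1 else 0
      exclusive : Tri (x Fin.< y) (x ≡ y) (y Fin.< x) → lt x y ℕ.* α x y ℕ.+ lt y x ℕ.* α x y ℕ.≤ α x y
      exclusive (tri< x<y _ y≮x) = ℕ.≤-reflexive (trans
        (cong₂ (λ p q → toℕ p ℕ.* α x y ℕ.+ toℕ q ℕ.* α x y) (dec-true (x Fin.<? y) x<y) (dec-false (y Fin.<? x) y≮x))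
        (trans (ℕ.+-identityʳ _) (ℕ.+-identityʳ _)))
      exclusive (tri≈ x≮y _ y≮x) = ℕ.≤-trans (ℕ.≤-reflexive
        (cong₂ (λ p q → toℕ p ℕ.* α x y ℕ.+ toℕ q ℕ.* α x y) (dec-false (x Fin.<? y) x≮y) (dec-false (y Fin.<? x) y≮x)))
        ℕ.z≤n
      exclusive (tri> x≮y _ y<x) = ℕ.≤-reflexive (trans
        (cong₂ (λ p q → toℕ p ℕ.* α x y ℕ.+ toℕ q ℕ.* α x y) (dec-false (x Fin.<? y) x≮y) (dec-true (y Fin.<? x) y<x))
        (ℕ.+-identityʳ _))

    row-sum : ∀ w a → ∑ V* (α (combine w a)) ≡ ι (w Fin.≟ v) ℕ.* card T
    row-sum w a = begin-equality
      ∑ V* (α (combine w a))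
        ≡⟨ ∑-vertices ℕ-domain g n (α (combine w a)) ⟩
      ∑ (allFin g) (λ w′ → ∑ (allFin n) (λ a′ → α (combine w a) (combine w′ a′)))
        ≡⟨ ∑-cong′ (allFin g) (λ w′ → ∑-cong′ (allFin n) (λ a′ → coordinates w′ a′)) ⟩
      ∑ (allFin g) (λ w′ → ∑ (allFin n) (λ a′ → i ℕ.* (ι (a′ Fin.≟ a) ℕ.* bit w′)))
        ≡⟨ ∑-cong′ (allFin g) (λ w′ → trans (sym (∑-*ˡ i (allFin n) (λ a′ → ι (a′ Fin.≟ a) ℕ.* bit w′)))
             (cong (i ℕ.*_) (∑-indicator ℕ-domain a (λ _ → bit w′)))) ⟩
      ∑ (allFin g) (λ w′ → i ℕ.* bit w′)
        ≡⟨ ∑-*ˡ i (allFin g) bit ⟨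
      i ℕ.* ∑ (allFin g) bit
        ≡⟨ cong (i ℕ.*_) (trans (sym (card≡∑ ℕ-domain T)) (⌞⌟≡id (card T))) ⟩
      i ℕ.* card T   ∎
      where
      i = ι (w Fin.≟ v)
      coordinates : ∀ w′ a′ → α (combine w a) (combine w′ a′) ≡ i ℕ.* (ι (a′ Fin.≟ a) ℕ.* bit w′)
      coordinates w′ a′ rewrite copy-combine w a | copy-combine w′ a′ | pos-combine w a | pos-combine w′ a′ = refl

  _≟ᴱ_ : DecidableEquality (V × V)
  _≟ᴱ_ = Product.≡-dec Fin._≟_ Fin._≟_

  private
    module EK = Expansion ℤ-domain _≟ᴱ_ (edges K)
    module EH = Expansion ℤ-domain (Fin._≟_ {size H}) (allFin (size H))

    rowH : Fin (size H) → Fin (size H) → ℤ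
    rowH f e = row (ends H f) (ends H e)

  -- ∑ of ∂/∂x_e over the edges e of copy v.  As H is regular, it annihilates
  -- X_y − X_x unless exactly one of x and y lies in copy v.
  direction : Fin g → V × V → ℤ
  direction v e = indicator ℤ-domain (InCopy? v e)

  module _ {r} (regular : IsRegularOf r H) where

    open ∑ℤ

    private
      side : Fin g → V → ℤ
      side v x = if does (copy x Fin.≟ v) then ⌞ r ⌟ else 0ℤ

    ∑-incidence-embed : ∀ v x → ∑ (edges H) (incidence x ∘ embed v) ≡ side v x
    ∑-incidence-embed v x = trans (∑-cong′ (edges H) (incidence-embed x v)) (count (does (copy x Fin.≟ v)))
      where
      count : ∀ b → ∑ (edges H) (λ e → if b then incidence (pos x) e else 0ℤ) ≡ (if b then ⌞ r ⌟ else 0ℤ)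
      count true  = trans (∑-incidence H (pos x)) (cong ⌞_⌟ (regular (pos x)))
      count false = ∑-zero (edges H) λ _ → refl

    -- Only edges of copy v contribute. By regularity r of them meet a given vertex of the copy, and
    -- none meets a vertex outside it.
    ⟨row,direction⟩ : ∀ v x y → EK.⟨ row (x , y) , direction v ⟩ ≡ side v y ℤ.- side v x
    ⟨row,direction⟩ v x y = begin
      ∑ (edges K) (λ e → row (x , y) e ℤ.* direction v e)
        ≡⟨ ∑-cong′ (edges K) (λ e → select (does (InCopy? v e)) (row (x , y) e)) ⟩
      ∑ (edges K) (λ e → if does (InCopy? v e) then row (x , y) e else 0ℤ)
        ≡⟨ ∑-filter (InCopy? v) (edges K) (row (x , y)) ⟨
      ∑ (filter (InCopy? v) (edges K)) (row (x , y))
        ≡⟨ cong (λ es → ∑ es (row (x , y))) (copy-edges v) ⟩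
      ∑ (map (embed v) (edges H)) (row (x , y))
        ≡⟨ ∑-map (embed v) (edges H) (row (x , y)) ⟩
      ∑ (edges H) (λ e → incidence y (embed v e) ℤ.- incidence x (embed v e))
        ≡⟨ ∑-cong′ (edges H) (λ e → cong (λ z → incidence y (embed v e) ℤ.+ z) (sym (ℤ.-1*i≡-i (incidence x (embed v e))))) ⟩
      ∑ (edges H) (λ e → incidence y (embed v e) ℤ.+ -1ℤ ℤ.* incidence x (embed v e))
        ≡⟨ ∑-+ (edges H) (incidence y ∘ embed v) (λ e → -1ℤ ℤ.* incidence x (embed v e)) ⟩
      ∑ (edges H) (incidence y ∘ embed v) ℤ.+ ∑ (edges H) (λ e → -1ℤ ℤ.* incidence x (embed v e))
        ≡⟨ cong₂ ℤ._+_ (∑-incidence-embed v y) (trans (sym (∑-*ˡ -1ℤ (edges H) (incidence x ∘ embed v)))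
             (trans (cong (-1ℤ ℤ.*_) (∑-incidence-embed v x)) (ℤ.-1*i≡-i (side v x)))) ⟩
      side v y ℤ.- side v x   ∎
      where
      open ≡-Reasoning
      select : ∀ b z → z ℤ.* (if b then 1ℤ else 0ℤ) ≡ (if b then z else 0ℤ)
      select true  z = ℤ.*-identityʳ z
      select false z = ℤ.*-zeroʳ z

    sameSide⇒null : ∀ v {f} → SameSide v f → EK.⟨ row f , direction v ⟩ ≡ 0ℤ
    sameSide⇒null v {x , y} same = trans (⟨row,direction⟩ v x y) (ℤ.i≡j⇒i-j≡0 {side v y} {side v x}
      (cong (λ b → if b then ⌞ r ⌟ else 0ℤ) (sym same)))

    ¬sameSide⇒nonnull : ⌞ r ⌟ ≢ 0ℤ → ∀ v {f} → ¬ SameSide v f → EK.⟨ row f , direction v ⟩ ≢ 0ℤ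
    ¬sameSide⇒nonnull r≢0 v {x , y} ¬same ≡0 = differ (does (copy x Fin.≟ v)) (does (copy y Fin.≟ v)) ¬same
      (ℤ.i-j≡0⇒i≡j (side v y) (side v x) (trans (sym (⟨row,direction⟩ v x y)) ≡0))
      where
      differ : ∀ p q → p ≢ q → (if q then ⌞ r ⌟ else 0ℤ) ≢ (if p then ⌞ r ⌟ else 0ℤ)
      differ true  true  p≢q _  = p≢q refl
      differ false false p≢q _  = p≢q refl
      differ true  false _   eq = r≢0 (sym eq)
      differ false true  _   eq = r≢0 eq

  -- Z holds for the copies of x and y and fails for those of a and b, so the two edges share no
  -- end. It is used with Z meaning equality to v and with its negation.
  row-disjoint : ∀ {Z : Fin g → Set} {x y a b} → (∀ {c} → Z c → c ≢ copy a × c ≢ copy b) →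
                 Z (copy x) × Z (copy y) → row (x , y) (a , b) ≡ 0ℤ
  row-disjoint {Z} {x} {y} {a} {b} sep (zx , zy) = cong₂ ℤ._-_ (no-incidence zy) (no-incidence zx)
    where
    no-incidence : ∀ {x} → Z (copy x) → incidence x (a , b) ≡ 0ℤ
    no-incidence {x} zx = cong (λ t → if t then 1ℤ else 0ℤ) (dec-false ((x Fin.≟ a) ⊎-dec (x Fin.≟ b))
      Sum.[ (λ { refl → proj₁ (sep zx) refl }) , (λ { refl → proj₂ (sep zx) refl }) ])

  module _ (M : Fin (size H) → ℕ) where

    private
      ι* : Fin g → Fin (size H) → V × V
      ι* v i = embed v (ends H i)

      extension : ∀ {v e} → Dec (∃[ i ] ι* v i ≡ e) → ℕ
      extension (yes (i , _)) = M i
      extension (no _)        = 0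

    -- The monomial M transported to copy v. The index of an edge is found by search, and
    -- injectivity of the embedding makes it unique.
    onCopy : Fin g → V × V → ℕ
    onCopy v e = extension (Fin.any? λ i → ι* v i ≟ᴱ e)

    onCopy-≤ : ∀ {b} → (∀ i → M i ℕ.≤ b) → ∀ v e → onCopy v e ℕ.≤ b
    onCopy-≤ M≤b v e with Fin.any? (λ i → ι* v i ≟ᴱ e)
    ... | yes (i , _) = M≤b i
    ... | no _        = ℕ.z≤n

    onCopy-off : ∀ v {e} → ¬ InCopy v e → onCopy v e ≡ 0
    onCopy-off v {e} ∉v with Fin.any? (λ i → ι* v i ≟ᴱ e)
    ... | yes (i , refl) = contradiction (copy-combine v _ , copy-combine v _) ∉v
    ... | no _           = refl

    onCopy-embed : ∀ v i → onCopy v (ι* v i) ≡ M i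
    onCopy-embed v i with Fin.any? (λ j → ι* v j ≟ᴱ ι* v i)
    ... | yes (j , eq) = cong M (ends-injective H (embed-injective v eq))
    ... | no  ∄        = contradiction (i , refl) ∄

    -- The factors of edges in copy v also contain variables of edges leading to other copies.
    -- `onCopy v` vanishes on those, and what remains is P H in the variables of the copy.
    coef-onCopy : ∀ v → EK.coef row (filter (InCopy? v) (edges K)) (onCopy v) ≡ EH.coef rowH (allFin (size H)) M
    coef-onCopy v = begin
      EK.coef row (filter (InCopy? v) (edges K)) (onCopy v)
        ≡⟨ cong (λ fs → EK.coef row fs (onCopy v)) edges≡ ⟩
      EK.coef row (map (ι* v) (allFin (size H))) (onCopy v)
        ≡⟨ coef-embed ℤ-domain Fin._≟_ _≟ᴱ_ {allFin (size H)} {edges K} (ends-injective H ∘ embed-injective v) (InCopy? v) edges≡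
             {ρ = rowH} {σ = row} {κ = ι* v} (λ f e → row-embed v (ends H f) (ends H e)) (allFin (size H)) (onCopy-off v) ⟩
      EH.coef rowH (allFin (size H)) (onCopy v ∘ ι* v)
        ≡⟨ EH.coef-ext rowH (allFin (size H)) (onCopy-embed v) ⟩
      EH.coef rowH (allFin (size H)) M   ∎
      where
      open ≡-Reasoning
      edges≡ : filter (InCopy? v) (edges K) ≡ map (ι* v) (allFin (size H))
      edges≡ = trans (copy-edges v) (trans (cong (map (embed v)) (sym (map-ends H))) (sym (List.map-∘ (allFin (size H)))))

    module _ {r} (regular : IsRegularOf r H) (r≢0 : ∑ℤ.⌞ r ⌟ ≢ 0ℤ)
             {d} (degenerate : Degenerate d G) {b} (M≤b : ∀ i → M i ℕ.≤ b)
             (M-occurs : EH.coef rowH (allFin (size H)) M ≢ 0ℤ) where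

      within-⊆ : ∀ {S v e} → Within (S Subset.- v) e → Within S e
      within-⊆ {S} {v} (x∈ , y∈) = Subset.p─q⊆p S ⁅ v ⁆ x∈ , Subset.p─q⊆p S ⁅ v ⁆ y∈

      inCopy⇒∉ : ∀ {S v e} → InCopy v e → ¬ Within (S Subset.- v) e
      inCopy⇒∉ (x∈v , _) (x∈ , _) = x∈p-y⇒x≢y x∈ x∈v

      within⇒∉ : ∀ {S v e} → Within (S Subset.- v) e → copy (proj₁ e) ≢ v × copy (proj₂ e) ≢ v
      within⇒∉ (x∈ , y∈) = x∈p-y⇒x≢y x∈ , x∈p-y⇒x≢y y∈

      -- An edge within S that does not cross lies in copy v or within S - v. Rows of the two kinds
      -- have only variables of crossing edges in common, where N and `onCopy v` both vanish, so the
      -- coefficient factors into two nonzero ones.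
      splits : ∀ {S v N} → v ∈ S → EK.coef row (filter (Within? (S Subset.- v)) (edges K)) N ≢ 0ℤ →
               (∀ e → ¬ Within (S Subset.- v) e → N e ≡ 0) →
               EK.coef row (filter (SameSide? v) (filter (Within? S) (edges K))) (N EK.⊞ onCopy v) ≢ 0ℤ
      splits {S} {v} {N} v∈S N-occurs N-off ≡0 =
        Domain.*-≢0 ℤ-domain N-occurs (subst (_≢ 0ℤ) (sym (coef-onCopy v)) M-occurs) (begin
          EK.coef row (filter (Within? (S Subset.- v)) (edges K)) N ℤ.* EK.coef row (filter (InCopy? v) (edges K)) (onCopy v)
            ≡⟨ cong₂ (λ fs gs → EK.coef row fs N ℤ.* EK.coef row gs (onCopy v)) remaining inside ⟨
          EK.coef row (filter (Within? (S Subset.- v)) fs) N ℤ.* EK.coef row (filter (¬? ∘ Within? (S Subset.- v)) fs) (onCopy v)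
            ≡⟨ EK.coef-split row (Within? (S Subset.- v)) fs apart₁ apart₂ ⟨
          EK.coef row fs (N EK.⊞ onCopy v)
            ≡⟨ ≡0 ⟩
          0ℤ   ∎)
        where
        open ≡-Reasoning
        fs = filter (SameSide? v) (filter (Within? S) (edges K))
        null? = λ (f : V × V) → SameSide? v f ×-dec Within? S f
        fs≡ : fs ≡ filter null? (edges K)
        fs≡ = filter-filter (SameSide? v) (Within? S) null? _,_ id (edges K)

        sameSide : ∀ {x y} → copy x ≢ v → copy y ≢ v → SameSide v (x , y)
        sameSide x∉v y∉v = trans (dec-false (_ Fin.≟ v) x∉v) (sym (dec-false (_ Fin.≟ v) y∉v))

        inside⇒ : ∀ {f} → ¬ Within (S Subset.- v) f → SameSide v f × Within S f → InCopy v f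
        inside⇒ {x , y} f∉ (same , x∈S , y∈S) with copy x Fin.≟ v | copy y Fin.≟ v
        ... | yes x∈v | yes y∈v = x∈v , y∈v
        ... | no  x∉v | no  y∉v = contradiction (Subset.x∈p∧x≢y⇒x∈p-y x∈S x∉v , Subset.x∈p∧x≢y⇒x∈p-y y∈S y∉v) f∉

        remaining : filter (Within? (S Subset.- v)) fs ≡ filter (Within? (S Subset.- v)) (edges K)
        remaining = trans (cong (filter (Within? (S Subset.- v))) fs≡)
          (filter-filter (Within? (S Subset.- v)) null? (Within? (S Subset.- v)) (λ p _ → p)
            (λ {f} f∈ → f∈ , sameSide (proj₁ (within⇒∉ {e = f} f∈)) (proj₂ (within⇒∉ {e = f} f∈)) , within-⊆ {e = f} f∈) (edges K))

        inside : filter (¬? ∘ Within? (S Subset.- v)) fs ≡ filter (InCopy? v) (edges K)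
        inside = trans (cong (filter (¬? ∘ Within? (S Subset.- v))) fs≡)
          (filter-filter (¬? ∘ Within? (S Subset.- v)) null? (InCopy? v) inside⇒
            (λ {f} f∈v@(x∈v , y∈v) → inCopy⇒∉ {e = f} f∈v ,
              trans (dec-true (_ Fin.≟ v) x∈v) (sym (dec-true (_ Fin.≟ v) y∈v)) ,
              subst (_∈ S) (sym x∈v) v∈S , subst (_∈ S) (sym y∈v) v∈S) (edges K))

        apart₁ : ∀ {f} → f ∈ₗ fs → Within (S Subset.- v) f → ∀ e → row f e ≡ 0ℤ ⊎ onCopy v e ≡ 0
        apart₁ {f} _ f∈ e with InCopy? v e
        ... | no  e∉v         = inj₂ (onCopy-off v e∉v)
        ... | yes (a∈v , b∈v) = inj₁ (row-disjoint
          (λ c∈ → subst₂ (λ s t → _ ≢ s × _ ≢ t) (sym a∈v) (sym b∈v) (c∈ , c∈)) f∈′)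
          where f∈′ = within⇒∉ {e = f} f∈

        apart₂ : ∀ {f} → f ∈ₗ fs → ¬ Within (S Subset.- v) f → ∀ e → row f e ≡ 0ℤ ⊎ N e ≡ 0
        apart₂ {f} f∈fs f∉ e with Within? (S Subset.- v) e
        ... | no  e∉ = inj₂ (N-off e e∉)
        ... | yes e∈ = inj₁ (row-disjoint (λ c∈v → (λ eq → proj₁ e∉v (trans (sym eq) c∈v)) , (λ eq → proj₂ e∉v (trans (sym eq) c∈v)))
          (inside⇒ f∉ (proj₂ (∈-filter⁻ null? {xs = edges K} (subst (f ∈ₗ_) fs≡ f∈fs)))))
          where e∉v = within⇒∉ {e = e} e∈

      -- The bound does not grow with the number of copies: N vanishes on copy v when that copy is
      -- added, and the elimination raises exponents nowhere else. The support condition in the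
      -- conclusion carries this through the induction, in which k bounds the size of S.
      occurs-within : ∀ k S → card S ℕ.≤ k →
        ∃[ N ] EK.coef row (filter (Within? S) (edges K)) N ≢ 0ℤ ×
               (∀ e → N e ℕ.≤ n ℕ.* d ℕ.+ b) ×
               (∀ e → ¬ Within S e → N e ≡ 0)
      occurs-within k S ∣S∣≤k with Subset.nonempty? S
      ... | no S-empty = (λ _ → 0) , occurs , (λ _ → ℕ.z≤n) , λ _ _ → refl
        where
        occurs : EK.coef row (filter (Within? S) (edges K)) (λ _ → 0) ≢ 0ℤ
        occurs = subst (λ fs → EK.coef row fs (λ _ → 0) ≢ 0ℤ)
          (sym (List.filter-none (Within? S) (All.universal (λ e e∈S → S-empty (_ , proj₁ e∈S)) (edges K))))
          λ ≡0 → case trans (sym (EK.one≡1 {λ _ → 0} λ _ → refl)) ≡0 of λ ()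
      occurs-within zero    S ∣S∣≤0 | yes (_ , v∈S) = contradiction (ℕ.<-≤-trans (Subset.x∈p⇒∣p-x∣<∣p∣ v∈S) ∣S∣≤0) λ ()
      occurs-within (suc k) S ∣S∣≤k | yes S-nonempty
        with v , v∈S , deg≤d ← degenerate S S-nonempty
        with N , N-occurs , N≤ , N-off ← occurs-within k (S Subset.- v)
               (ℕ.≤-pred (ℕ.<-≤-trans (Subset.x∈p⇒∣p-x∣<∣p∣ v∈S) ∣S∣≤k))
        with N′ , N′-occurs , N′≤ , N′≤-off ← EK.coef-eliminate (edges-unique K) row (direction v) (SameSide? v)
               (λ {f} → sameSide⇒null regular v {f}) (λ {f} → ¬sameSide⇒nonnull regular r≢0 v {f})
               (filter (Within? S) (edges K)) {N EK.⊞ onCopy v} (splits v∈S N-occurs N-off)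
        = N′ , N′-occurs , bound , off
        where
        bound : ∀ e → N′ e ℕ.≤ n ℕ.* d ℕ.+ b
        bound e with InCopy? v e
        ... | yes e∈v = begin
          N′ e                          ≤⟨ N′≤ e ⟩
          N e ℕ.+ onCopy v e ℕ.+ _      ≡⟨ cong (λ z → z ℕ.+ onCopy v e ℕ.+ _) (N-off e (inCopy⇒∉ e∈v)) ⟩
          onCopy v e ℕ.+ _              ≤⟨ ℕ.+-mono-≤ (onCopy-≤ M≤b v e) (ℕ.≤-trans (crossing-count S v) (ℕ.*-monoʳ-≤ n deg≤d)) ⟩
          b ℕ.+ n ℕ.* d                 ≡⟨ ℕ.+-comm b (n ℕ.* d) ⟩
          n ℕ.* d ℕ.+ b                 ∎
          where open ℕ.≤-Reasoning
        ... | no e∉v = begin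
          N′ e                  ≤⟨ N′≤-off e (cong (λ t → if t then 1ℤ else 0ℤ) (dec-false (InCopy? v e) e∉v)) ⟩
          N e ℕ.+ onCopy v e    ≡⟨ cong (N e ℕ.+_) (onCopy-off v e∉v) ⟩
          N e ℕ.+ 0             ≡⟨ ℕ.+-identityʳ (N e) ⟩
          N e                   ≤⟨ N≤ e ⟩
          n ℕ.* d ℕ.+ b         ∎
          where open ℕ.≤-Reasoning
        off : ∀ e → ¬ Within S e → N′ e ≡ 0
        off e e∉S = ℕ.n≤0⇒n≡0 (begin
          N′ e                  ≤⟨ N′≤-off e (cong (λ t → if t then 1ℤ else 0ℤ) (dec-false (InCopy? v e) e∉v)) ⟩
          N e ℕ.+ onCopy v e    ≡⟨ cong₂ ℕ._+_ (N-off e (e∉S ∘ within-⊆)) (onCopy-off v e∉v) ⟩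
          0                     ∎)
          where
          open ℕ.≤-Reasoning
          e∉v : ¬ InCopy v e
          e∉v (refl , y∈v) = e∉S (v∈S , subst (_∈ S) (sym y∈v) v∈S)

-- A monomial of P H, and the resulting one of P (G □ H)

module _ {n} (H : Graph n) where

  otherNeighbour : ∀ {v} → 2 ℕ.≤ degree H v → ∀ u → ∃[ w ] Adj H v w × u ≢ w
  otherNeighbour {v} 2≤deg u with Fin.any? (λ w → Adj? H v w ×-dec ¬? (u Fin.≟ w))
  ... | yes found = found
  ... | no  ∄     = contradiction (ℕ.≤-trans 2≤deg (subst (degree H v ℕ.≤_) (Subset.∣⁅x⁆∣≡1 u) (Subset.p⊆q⇒∣p∣≤∣q∣ only-u))) λ { (ℕ.s≤s ()) }
    where
    only-u : neighbours H v ⊆ ⁅ u ⁆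
    only-u {w} w∈ = subst (_∈ ⁅ u ⁆) (decidable-stable (u Fin.≟ w) λ u≢w → ∄ (w , ∈-neighbours⁻ H w∈ , u≢w)) (Subset.x∈⁅x⁆ u)

  -- Since v has a neighbour w other than u, the variable of the edge vw occurs in X_v but not in
  -- X_u. For an isolated edge the two sums would coincide and the factor would be 0.
  row-nonzero : (∀ v → 2 ℕ.≤ degree H v) → ∀ i → ∃[ j ] row (ends H i) (ends H j) ≢ 0ℤ
  row-nonzero 2≤deg i
    with u<v , uv ← ends-Edge H i
    with w , vw , u≢w ← otherNeighbour (2≤deg (proj₂ (ends H i))) (proj₁ (ends H i))
    with j , vw-ends ← ends-surjective H vw
    = j , λ ≡0 → case trans (sym (one-end vw-ends)) ≡0 of λ ()
    where
    u = proj₁ (ends H i)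
    v = proj₂ (ends H i)
    u≢v : u ≢ v
    u≢v u≡v = irrefl H u≡v uv
    toℤ : Bool → ℤ
    toℤ b = if b then 1ℤ else 0ℤ
    one-end : ends H j ≡ (v , w) ⊎ ends H j ≡ (w , v) → row (u , v) (ends H j) ≡ 1ℤ
    one-end (inj₁ eq) = trans (cong (row (u , v)) eq) (cong₂ (λ p q → toℤ p ℤ.- toℤ q)
      (dec-true ((v Fin.≟ v) ⊎-dec (v Fin.≟ w)) (inj₁ refl))
      (dec-false ((u Fin.≟ v) ⊎-dec (u Fin.≟ w)) Sum.[ u≢v , u≢w ]))
    one-end (inj₂ eq) = trans (cong (row (u , v)) eq) (cong₂ (λ p q → toℤ p ℤ.- toℤ q)
      (dec-true ((v Fin.≟ w) ⊎-dec (v Fin.≟ v)) (inj₂ refl))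
      (dec-false ((u Fin.≟ w) ⊎-dec (u Fin.≟ v)) Sum.[ u≢w , u≢v ]))

  private
    module E = Expansion ℤ-domain (Fin._≟_ {size H}) (allFin (size H))

  edgeRow : Fin (size H) → Fin (size H) → ℤ
  edgeRow f e = row (ends H f) (ends H e)

  -- No factor vanishes, so some coefficient is nonzero; the minimum defining mind H is then taken
  -- over a nonempty list and is attained.
  monomial-occurs : (∀ v → 2 ℕ.≤ degree H v) →
    ∃[ M ] mind H ≡ [ h M ] × E.coef edgeRow (allFin (size H)) (Vec.lookup M) ≢ 0ℤ
  monomial-occurs 2≤deg =
    let M , occurs = E.coef-nonzero (Unique.allFin⁺ (size H)) edgeRow (allFin (size H)) id (allFin (size H))
          λ {i} _ → let j , ≢0 = row-nonzero 2≤deg i in j , ∈-allFin j , ≢0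
        N , N-occurs , mind≡ = coeff≢0⇒mindₚ≡ (P H (const true)) λ ≡0 → occurs (trans (sym (series-P H M)) ≡0)
    in N , mind≡ , λ ≡0 → N-occurs (trans (cong (coeff (P H (const true))) (sym (Vec.tabulate∘lookup N)))
                                          (trans (series-P H (Vec.lookup N)) ≡0))

  -- Elimination works with edges as pairs of vertices, the polynomial with edge indices. This is
  -- `coef-embed` for the predicate that always holds.
  coef-edges≡coef-indices : ∀ N →
    Expansion.coef ℤ-domain (Product.≡-dec Fin._≟_ Fin._≟_) (edges H) row (edges H) N ≡
    E.coef edgeRow (allFin (size H)) (N ∘ ends H)
  coef-edges≡coef-indices N = trans
    (cong (λ fs → Expansion.coef ℤ-domain (Product.≡-dec Fin._≟_ Fin._≟_) (edges H) row fs N) (sym (map-ends H)))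
    (coef-embed ℤ-domain Fin._≟_ (Product.≡-dec Fin._≟_ Fin._≟_) {allFin (size H)} {edges H} (ends-injective H) (λ _ → yes tt)
      (trans (List.filter-all (λ _ → yes tt) (All.universal (λ _ → tt) (edges H))) (sym (map-ends H)))
      {ρ = edgeRow} {σ = row} {κ = ends H} (λ _ _ → refl) (allFin (size H)) (λ ¬tt → contradiction tt ¬tt))

module _ {g n} (d : ℕ) (G : Graph g) (H : Graph n) (degenerate : Degenerate d G)
         {r} (regular : IsRegularOf r H) (2≤r : 2 ℕ.≤ r) where

  open BoxProduct G H

  private
    r≢0 : ∀ {r} → 2 ℕ.≤ r → ∑ℤ.⌞ r ⌟ ≢ 0ℤ
    r≢0 (ℕ.s≤s {n = k} _) = Domain.⌞suc⌟≢0 ℤ-domain k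

  -- One monomial serves both claims: its exponents bound the monomial index, and they determine the
  -- list size that the Nullstellensatz needs.
  box-monomial : ∃[ b ] mind H ≡ [ b ] × ∃[ N ] (∀ e → N e ℕ.≤ n ℕ.* d ℕ.+ b) ×
    Expansion.coef ℤ-domain Fin._≟_ (allFin (size (G □ H))) (edgeRow (G □ H)) (allFin (size (G □ H))) N ≢ 0ℤ
  box-monomial =
    let M , mind≡ , M-occurs = monomial-occurs H (λ v → subst (2 ℕ.≤_) (sym (regular v)) 2≤r)
        N , N-occurs , N≤ , _ = occurs-within G H (Vec.lookup M) regular (r≢0 2≤r) degenerate
          (lookup≤h M) M-occurs (card (Subset.⊤ {g})) Subset.⊤ ℕ.≤-refl
    in h M , mind≡ , N ∘ ends (G □ H) , (λ e → N≤ (ends (G □ H) e)) , λ ≡0 → N-occurs (trans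
        (cong (λ fs → Expansion.coef ℤ-domain (_≟ᴱ_ G H) (edges (G □ H)) row fs N) all-within)
        (trans (coef-edges≡coef-indices (G □ H) N) ≡0))
    where
    all-within : filter (Within? G H Subset.⊤) (edges (G □ H)) ≡ edges (G □ H)
    all-within = List.filter-all (Within? G H Subset.⊤) (All.universal (λ _ → Subset.∈⊤ , Subset.∈⊤) (edges (G □ H)))

mind-box : ∀ {g n} (d : ℕ) (G : Graph g) (H : Graph n) {r} → Degenerate d G → IsRegularOf r H → 2 ℕ.≤ r →
           mind (G □ H) ≤∞ [ n ℕ.* d ] +∞ mind H
mind-box {n = n} d G H degenerate regular 2≤r =
  let b , mind≡ , N , N≤ , occurs = box-monomial d G H degenerate regular 2≤r
  in subst (λ m → mind (G □ H) ≤∞ [ n ℕ.* d ] +∞ m) (sym mind≡)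
       (coeff≢0⇒mindₚ≤ (P (G □ H) (const true)) (λ ≡0 → occurs (trans (sym (series-P (G □ H) N)) ≡0)) (h-tabulate≤ N≤))

twoFactor⇒2≤r : ∀ {n r} {H : Graph n} → 3 ℕ.≤ n → IsRegularOf r H → HasTwoFactor H → 2 ℕ.≤ r
twoFactor⇒2≤r {H = H} (ℕ.s≤s _) regular (F , F⊆H , F-regular) =
  subst₂ ℕ._≤_ (F-regular Fin.zero) (regular Fin.zero) (Subset.p⊆q⇒∣p∣≤∣q∣ λ u∈ →
    ∈-neighbours⁺ H (F⊆H _ _ (∈-neighbours⁻ F u∈)))

-- The Combinatorial Nullstellensatz over ℚ

module ∑ℚ = Summation (IsCommutativeRing.isCommutativeSemiring ℚ.+-*-isCommutativeRing)

-- Built directly in lowest terms with denominator 1, so that the fraction computes without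
-- normalisation.
fromℤ : ℤ → ℚ
fromℤ z = mkℚ z 0 (Coprime.sym (1-coprimeTo ℤ.∣ z ∣))

fromℤ-+ : ∀ x y → fromℤ (x ℤ.+ y) ≡ fromℤ x ℚ.+ fromℤ y
fromℤ-+ x y = ℚ.toℚᵘ-injective (ℚᵘ.≃-trans
  (ℚᵘ.*≡* (cong (ℤ._* 1ℤ) (cong₂ ℤ._+_ (sym (ℤ.*-identityʳ x)) (sym (ℤ.*-identityʳ y)))))
  (ℚᵘ.≃-sym (ℚ.toℚᵘ-homo-+ (fromℤ x) (fromℤ y))))

fromℤ-* : ∀ x y → fromℤ (x ℤ.* y) ≡ fromℤ x ℚ.* fromℤ y
fromℤ-* x y = ℚ.toℚᵘ-injective (ℚᵘ.≃-trans
  (ℚᵘ.*≡* refl)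
  (ℚᵘ.≃-sym (ℚ.toℚᵘ-homo-* (fromℤ x) (fromℤ y))))

1≤∣fromℤ∣ : ∀ {z} → z ≢ 0ℤ → 1ℚ ℚ.≤ ∣ fromℤ z ∣
1≤∣fromℤ∣ {ℤ.+ zero}     z≢0 = contradiction refl z≢0
1≤∣fromℤ∣ {ℤ.+ (suc k)}  z≢0 = ℚ.*≤* (ℤ.+≤+ (ℕ.s≤s ℕ.z≤n))
1≤∣fromℤ∣ {ℤ.-[1+ k ]}   z≢0 = ℚ.*≤* (ℤ.+≤+ (ℕ.s≤s ℕ.z≤n))

*-mono-≤-∣∣ : ∀ {p q r s} → 0ℚ ℚ.≤ p → p ℚ.≤ ∣ q ∣ → r ℚ.≤ ∣ s ∣ → p ℚ.* r ℚ.≤ ∣ q ℚ.* s ∣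
*-mono-≤-∣∣ {p} {q} {r} {s} 0≤p p≤q r≤s = begin
  p ℚ.* r           ≤⟨ ℚ.*-monoˡ-≤-nonNeg p {{ℚ.nonNegative 0≤p}} r≤s ⟩
  p ℚ.* ∣ s ∣       ≤⟨ ℚ.*-monoʳ-≤-nonNeg ∣ s ∣ {{ℚ.nonNegative (ℚ.0≤∣p∣ s)}} p≤q ⟩
  ∣ q ∣ ℚ.* ∣ s ∣   ≡⟨ ℚ.∣p*q∣≡∣p∣*∣q∣ q s ⟨
  ∣ q ℚ.* s ∣       ∎
  where open ℚ.≤-Reasoning

½+½ : ∀ x → ½ ℚ.* x ℚ.+ ½ ℚ.* x ≡ x
½+½ x = trans (sym (ℚ.*-distribʳ-+ x ½ ½)) (ℚ.*-identityˡ x)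

-- As y = x - z, a large y prevents x and z from both being small. It decides between two values in
-- the Nullstellensatz, and later limits the drift of a factor along the Cauchy sequences.
half-of-difference : ∀ {x y z t} → x ≡ y ℚ.+ z → t ℚ.≤ ∣ y ∣ → ∣ x ∣ ℚ.≤ ½ ℚ.* t → ½ ℚ.* t ℚ.≤ ∣ z ∣
half-of-difference {x} {y} {z} {t} x≡y+z t≤∣y∣ ∣x∣≤½t = ℚ.≮⇒≥ λ ∣z∣<½t → ℚ.<-irrefl refl (begin-strict
  t                          ≤⟨ t≤∣y∣ ⟩
  ∣ y ∣                      ≡⟨ cong ∣_∣ (trans (cancel y z) (cong (ℚ._- z) (sym x≡y+z))) ⟩
  ∣ x ℚ.- z ∣                ≤⟨ ℚ.∣p+q∣≤∣p∣+∣q∣ x (ℚ.- z) ⟩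
  ∣ x ∣ ℚ.+ ∣ ℚ.- z ∣        ≡⟨ cong (∣ x ∣ ℚ.+_) (ℚ.∣-p∣≡∣p∣ z) ⟩
  ∣ x ∣ ℚ.+ ∣ z ∣            <⟨ ℚ.+-mono-≤-< ∣x∣≤½t ∣z∣<½t ⟩
  ½ ℚ.* t ℚ.+ ½ ℚ.* t        ≡⟨ ½+½ t ⟩
  t                          ∎)
  where
  open ℚ.≤-Reasoning
  cancel : ∀ y z → y ≡ (y ℚ.+ z) ℚ.- z
  cancel = solve 2 (λ y z → y := (y :+ z) :- z) refl

-- This is (ε/2)^k. Each division by x_e - a contributes a factor ε, the least distance between
-- listed values, and one half is lost in passing from a difference to the larger of its two terms.
margin : ℚ → ℕ → ℚ
margin ε zero    = 1ℚ
margin ε (suc k) = ½ ℚ.* (ε ℚ.* margin ε k)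

module _ {m : ℕ} where

  private
    A = Fin m
    vs = allFin m

  open Expansion ℤ-domain (Fin._≟_ {m}) vs
  open Domain ℤ-domain using (∑; ∑-cong′; ∑-+; ∑-*ˡ; ∑-zero; down)

  linear : (A → ℤ) → (A → ℚ) → ℚ
  linear ℓ w = ∑ℚ.∑ vs λ e → fromℤ (ℓ e) ℚ.* w e

  infixl 6 _⟨+⟩_

  -- The index bounds the degree.
  data Expr : ℕ → Set where
    con    : ∀ {k} → ℤ → Expr k
    _⟨+⟩_  : ∀ {k} → Expr k → Expr k → Expr k
    scale  : ∀ {k} → ℤ → Expr k → Expr k
    affine : ∀ {k} → ℚ → (A → ℤ) → Expr k → Expr (suc k)

  ⟦_⟧ : ∀ {k} → Expr k → (A → ℚ) → ℚ
  ⟦ con z ⟧      w = fromℤ z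
  ⟦ p ⟨+⟩ q ⟧      w = ⟦ p ⟧ w ℚ.+ ⟦ q ⟧ w
  ⟦ scale z p ⟧    w = fromℤ z ℚ.* ⟦ p ⟧ w
  ⟦ affine c ℓ p ⟧ w = (c ℚ.+ linear ℓ w) ℚ.* ⟦ p ⟧ w

  -- For p : Expr k, the coefficients of p in degree k, forgetting the
  -- constant terms of the affine forms.
  top : ∀ {k} → Expr k → Series
  top (con z)      M = z ℤ.* one M
  top (p ⟨+⟩ q)      M = top p M ℤ.+ top q M
  top (scale z p)    M = z ℤ.* top p M
  top (affine c ℓ p)   = mul ℓ (top p)

  _[_≔_] : ∀ {B : Set} → (A → B) → A → B → A → B
  (w [ e ≔ a ]) x = if does (x Fin.≟ e) then a else w x

  ≔-same : ∀ {B : Set} (w : A → B) e a → (w [ e ≔ a ]) e ≡ a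
  ≔-same w e a rewrite dec-true (e Fin.≟ e) refl = refl

  substitute : ∀ {k} → A → ℚ → Expr k → Expr k
  substitute e a (con z)      = con z
  substitute e a (p ⟨+⟩ q)      = substitute e a p ⟨+⟩ substitute e a q
  substitute e a (scale z p)    = scale z (substitute e a p)
  substitute e a (affine c ℓ p) = affine (c ℚ.+ fromℤ (ℓ e) ℚ.* a) (ℓ [ e ≔ 0ℤ ]) (substitute e a p)

  -- The quotient of p − substitute e a p by x_e − a.
  quotient : ∀ {k} → A → ℚ → Expr (suc k) → Expr k
  quotient e a (con z)              = con 0ℤ
  quotient e a (p ⟨+⟩ q)              = quotient e a p ⟨+⟩ quotient e a q
  quotient e a (scale z p)            = scale z (quotient e a p)
  quotient {zero}  e a (affine c ℓ p) = scale (ℓ e) (substitute e a p)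
  quotient {suc k} e a (affine c ℓ p) = affine c ℓ (quotient e a p) ⟨+⟩ scale (ℓ e) (substitute e a p)

  linear-cong : ∀ ℓ {w w′} → w ≗ w′ → linear ℓ w ≡ linear ℓ w′
  linear-cong ℓ w≗w′ = ∑ℚ.∑-cong′ vs λ e → cong (fromℤ (ℓ e) ℚ.*_) (w≗w′ e)

  ⟦⟧-cong : ∀ {k} (p : Expr k) {w w′} → w ≗ w′ → ⟦ p ⟧ w ≡ ⟦ p ⟧ w′
  ⟦⟧-cong (con z)      w≗w′ = refl
  ⟦⟧-cong (p ⟨+⟩ q)      w≗w′ = cong₂ ℚ._+_ (⟦⟧-cong p w≗w′) (⟦⟧-cong q w≗w′)
  ⟦⟧-cong (scale z p)    w≗w′ = cong (fromℤ z ℚ.*_) (⟦⟧-cong p w≗w′)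
  ⟦⟧-cong (affine c ℓ p) w≗w′ = cong₂ (λ x y → (c ℚ.+ x) ℚ.* y) (linear-cong ℓ w≗w′) (⟦⟧-cong p w≗w′)

  top-ext : ∀ {k} (p : Expr k) → Extensional (top p)
  top-ext (con z)      M≗N = cong (z ℤ.*_) (one-ext M≗N)
  top-ext (p ⟨+⟩ q)      M≗N = cong₂ ℤ._+_ (top-ext p M≗N) (top-ext q M≗N)
  top-ext (scale z p)    M≗N = cong (z ℤ.*_) (top-ext p M≗N)
  top-ext (affine c ℓ p) M≗N = mul-ext ℓ (top-ext p) M≗N

  linear-split : ∀ ℓ w e → linear ℓ w ≡ linear (ℓ [ e ≔ 0ℤ ]) w ℚ.+ fromℤ (ℓ e) ℚ.* w e
  linear-split ℓ w e = begin
    linear ℓ w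
      ≡⟨ ∑ℚ.∑-cong′ vs splitTerm ⟩
    ∑ℚ.∑ vs (λ x → fromℤ ((ℓ [ e ≔ 0ℤ ]) x) ℚ.* w x ℚ.+ atE x)
      ≡⟨ ∑ℚ.∑-+ vs (λ x → fromℤ ((ℓ [ e ≔ 0ℤ ]) x) ℚ.* w x) atE ⟩
    linear (ℓ [ e ≔ 0ℤ ]) w ℚ.+ ∑ℚ.∑ vs atE
      ≡⟨ cong (linear (ℓ [ e ≔ 0ℤ ]) w ℚ.+_) (∑ℚ.∑-single (Unique.allFin⁺ m) (∈-allFin e)
           (λ x e≢x → cong (if_then fromℤ (ℓ e) ℚ.* w e else 0ℚ) (dec-false (x Fin.≟ e) (e≢x ∘ sym)))) ⟩
    linear (ℓ [ e ≔ 0ℤ ]) w ℚ.+ atE e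
      ≡⟨ cong (λ b → linear (ℓ [ e ≔ 0ℤ ]) w ℚ.+ (if b then fromℤ (ℓ e) ℚ.* w e else 0ℚ)) (dec-true (e Fin.≟ e) refl) ⟩
    linear (ℓ [ e ≔ 0ℤ ]) w ℚ.+ fromℤ (ℓ e) ℚ.* w e   ∎
    where
    open ≡-Reasoning
    atE : A → ℚ
    atE x = if does (x Fin.≟ e) then fromℤ (ℓ e) ℚ.* w e else 0ℚ
    splitTerm : ∀ x → fromℤ (ℓ x) ℚ.* w x ≡ fromℤ ((ℓ [ e ≔ 0ℤ ]) x) ℚ.* w x ℚ.+ atE x
    splitTerm x with x Fin.≟ e
    ... | yes refl = sym (trans (cong (ℚ._+ fromℤ (ℓ x) ℚ.* w x) (ℚ.*-zeroˡ (w x))) (ℚ.+-identityˡ (fromℤ (ℓ x) ℚ.* w x)))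
    ... | no  _    = sym (ℚ.+-identityʳ (fromℤ (ℓ x) ℚ.* w x))

  linear-≔0 : ∀ ℓ w e a → linear (ℓ [ e ≔ 0ℤ ]) (w [ e ≔ a ]) ≡ linear (ℓ [ e ≔ 0ℤ ]) w
  linear-≔0 ℓ w e a = ∑ℚ.∑-cong′ vs term
    where
    term : ∀ x → fromℤ ((ℓ [ e ≔ 0ℤ ]) x) ℚ.* (w [ e ≔ a ]) x ≡ fromℤ ((ℓ [ e ≔ 0ℤ ]) x) ℚ.* w x
    term x with x Fin.≟ e
    ... | yes _ = trans (ℚ.*-zeroˡ a) (sym (ℚ.*-zeroˡ (w x)))
    ... | no  _ = refl

  linear-≔ : ∀ ℓ w e a → linear ℓ (w [ e ≔ a ]) ≡ linear (ℓ [ e ≔ 0ℤ ]) w ℚ.+ fromℤ (ℓ e) ℚ.* a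
  linear-≔ ℓ w e a = trans (linear-split ℓ (w [ e ≔ a ]) e)
    (cong₂ (λ x y → x ℚ.+ fromℤ (ℓ e) ℚ.* y) (linear-≔0 ℓ w e a) (≔-same w e a))

  ⟦substitute⟧ : ∀ {k} e a (p : Expr k) w → ⟦ substitute e a p ⟧ w ≡ ⟦ p ⟧ (w [ e ≔ a ])
  ⟦substitute⟧ e a (con z)      w = refl
  ⟦substitute⟧ e a (p ⟨+⟩ q)      w = cong₂ ℚ._+_ (⟦substitute⟧ e a p w) (⟦substitute⟧ e a q w)
  ⟦substitute⟧ e a (scale z p)    w = cong (fromℤ z ℚ.*_) (⟦substitute⟧ e a p w)
  ⟦substitute⟧ e a (affine c ℓ p) w = cong₂ ℚ._*_
    (trans (regroup c (fromℤ (ℓ e) ℚ.* a) (linear (ℓ [ e ≔ 0ℤ ]) w)) (cong (c ℚ.+_) (sym (linear-≔ ℓ w e a))))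
    (⟦substitute⟧ e a p w)
    where
    regroup : ∀ x y z → (x ℚ.+ y) ℚ.+ z ≡ x ℚ.+ (z ℚ.+ y)
    regroup x y z = trans (ℚ.+-assoc x y z) (cong (x ℚ.+_) (ℚ.+-comm y z))

  ⟦⟧-constant : ∀ (p : Expr 0) w w′ → ⟦ p ⟧ w ≡ ⟦ p ⟧ w′
  ⟦⟧-constant (con z)   w w′ = refl
  ⟦⟧-constant (p ⟨+⟩ q)   w w′ = cong₂ ℚ._+_ (⟦⟧-constant p w w′) (⟦⟧-constant q w w′)
  ⟦⟧-constant (scale z p) w w′ = cong (fromℤ z ℚ.*_) (⟦⟧-constant p w w′)

  -- For an affine factor L, with a subscript a for the substitution x_e = a, L p - L_a p_a = L (p -
  -- p_a) + (L - L_a) p_a, and L - L_a is ℓ e (x_e - a). If p has degree 0, the first summand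
  -- vanishes.
  ⟦quotient⟧ : ∀ {k} e a (p : Expr (suc k)) w →
    ⟦ p ⟧ w ≡ (w e ℚ.- a) ℚ.* ⟦ quotient e a p ⟧ w ℚ.+ ⟦ p ⟧ (w [ e ≔ a ])
  ⟦quotient⟧ e a (con z) w = sym (trans (cong (ℚ._+ fromℤ z) (ℚ.*-zeroʳ (w e ℚ.- a))) (ℚ.+-identityˡ (fromℤ z)))
  ⟦quotient⟧ e a (p ⟨+⟩ q) w = trans (cong₂ ℚ._+_ (⟦quotient⟧ e a p w) (⟦quotient⟧ e a q w))
    (collect (w e ℚ.- a) (⟦ quotient e a p ⟧ w) (⟦ quotient e a q ⟧ w) (⟦ p ⟧ (w [ e ≔ a ])) (⟦ q ⟧ (w [ e ≔ a ])))
    where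
    collect : ∀ t x y x′ y′ → (t ℚ.* x ℚ.+ x′) ℚ.+ (t ℚ.* y ℚ.+ y′) ≡ t ℚ.* (x ℚ.+ y) ℚ.+ (x′ ℚ.+ y′)
    collect = solve 5 (λ t x y x′ y′ → (t :* x :+ x′) :+ (t :* y :+ y′) := t :* (x :+ y) :+ (x′ :+ y′)) refl
  ⟦quotient⟧ e a (scale z p) w = trans (cong (fromℤ z ℚ.*_) (⟦quotient⟧ e a p w))
    (collect (fromℤ z) (w e ℚ.- a) (⟦ quotient e a p ⟧ w) (⟦ p ⟧ (w [ e ≔ a ])))
    where
    collect : ∀ s t x x′ → s ℚ.* (t ℚ.* x ℚ.+ x′) ≡ t ℚ.* (s ℚ.* x) ℚ.+ s ℚ.* x′
    collect = solve 4 (λ s t x x′ → s :* (t :* x :+ x′) := t :* (s :* x) :+ s :* x′) refl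
  ⟦quotient⟧ {zero} e a (affine c ℓ p) w = begin
    (c ℚ.+ linear ℓ w) ℚ.* ⟦ p ⟧ w
      ≡⟨ cong₂ (λ x y → (c ℚ.+ x) ℚ.* y) (linear-split ℓ w e) (⟦⟧-constant p w (w [ e ≔ a ])) ⟩
    (c ℚ.+ (ℓ₀ ℚ.+ s ℚ.* w e)) ℚ.* f
      ≡⟨ divide c ℓ₀ s (w e) a f ⟩
    (w e ℚ.- a) ℚ.* (s ℚ.* f) ℚ.+ (c ℚ.+ (ℓ₀ ℚ.+ s ℚ.* a)) ℚ.* f
      ≡⟨ cong₂ (λ x y → (w e ℚ.- a) ℚ.* (s ℚ.* x) ℚ.+ (c ℚ.+ y) ℚ.* f) (⟦substitute⟧ e a p w) (linear-≔ ℓ w e a) ⟨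
    (w e ℚ.- a) ℚ.* (s ℚ.* ⟦ substitute e a p ⟧ w) ℚ.+ (c ℚ.+ linear ℓ (w [ e ≔ a ])) ℚ.* f   ∎
    where
    open ≡-Reasoning
    ℓ₀ = linear (ℓ [ e ≔ 0ℤ ]) w
    s = fromℤ (ℓ e)
    f = ⟦ p ⟧ (w [ e ≔ a ])
    divide : ∀ c l s x a f → (c ℚ.+ (l ℚ.+ s ℚ.* x)) ℚ.* f ≡ (x ℚ.- a) ℚ.* (s ℚ.* f) ℚ.+ (c ℚ.+ (l ℚ.+ s ℚ.* a)) ℚ.* f
    divide = solve 6 (λ c l s x a f → (c :+ (l :+ s :* x)) :* f := (x :- a) :* (s :* f) :+ (c :+ (l :+ s :* a)) :* f) refl
  ⟦quotient⟧ {suc k} e a (affine c ℓ p) w = begin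
    (c ℚ.+ linear ℓ w) ℚ.* ⟦ p ⟧ w
      ≡⟨ cong₂ (λ x y → (c ℚ.+ x) ℚ.* y) (linear-split ℓ w e) (⟦quotient⟧ e a p w) ⟩
    (c ℚ.+ (ℓ₀ ℚ.+ s ℚ.* w e)) ℚ.* ((w e ℚ.- a) ℚ.* q ℚ.+ f)
      ≡⟨ divide c ℓ₀ s (w e) a q f ⟩
    (w e ℚ.- a) ℚ.* ((c ℚ.+ (ℓ₀ ℚ.+ s ℚ.* w e)) ℚ.* q ℚ.+ s ℚ.* f) ℚ.+ (c ℚ.+ (ℓ₀ ℚ.+ s ℚ.* a)) ℚ.* f
      ≡⟨ cong₂ (λ x y → (w e ℚ.- a) ℚ.* ((c ℚ.+ x) ℚ.* q ℚ.+ s ℚ.* y) ℚ.+ (c ℚ.+ (ℓ₀ ℚ.+ s ℚ.* a)) ℚ.* f)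
           (linear-split ℓ w e) (⟦substitute⟧ e a p w) ⟨
    (w e ℚ.- a) ℚ.* ((c ℚ.+ linear ℓ w) ℚ.* q ℚ.+ s ℚ.* ⟦ substitute e a p ⟧ w) ℚ.+ (c ℚ.+ (ℓ₀ ℚ.+ s ℚ.* a)) ℚ.* f
      ≡⟨ cong (λ y → (w e ℚ.- a) ℚ.* ((c ℚ.+ linear ℓ w) ℚ.* q ℚ.+ s ℚ.* ⟦ substitute e a p ⟧ w) ℚ.+ (c ℚ.+ y) ℚ.* f)
           (linear-≔ ℓ w e a) ⟨
    (w e ℚ.- a) ℚ.* ((c ℚ.+ linear ℓ w) ℚ.* q ℚ.+ s ℚ.* ⟦ substitute e a p ⟧ w) ℚ.+ (c ℚ.+ linear ℓ (w [ e ≔ a ])) ℚ.* f   ∎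
    where
    open ≡-Reasoning
    ℓ₀ = linear (ℓ [ e ≔ 0ℤ ]) w
    s = fromℤ (ℓ e)
    q = ⟦ quotient e a p ⟧ w
    f = ⟦ p ⟧ (w [ e ≔ a ])
    divide : ∀ c l s x a q f → (c ℚ.+ (l ℚ.+ s ℚ.* x)) ℚ.* ((x ℚ.- a) ℚ.* q ℚ.+ f) ≡
      (x ℚ.- a) ℚ.* ((c ℚ.+ (l ℚ.+ s ℚ.* x)) ℚ.* q ℚ.+ s ℚ.* f) ℚ.+ (c ℚ.+ (l ℚ.+ s ℚ.* a)) ℚ.* f
    divide = solve 7 (λ c l s x a q f → (c :+ (l :+ s :* x)) :* ((x :- a) :* q :+ f) :=
      (x :- a) :* ((c :+ (l :+ s :* x)) :* q :+ s :* f) :+ (c :+ (l :+ s :* a)) :* f) refl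

  -- The counterpart of `down`: it keeps the coefficients of monomials free of x_e.
  at0 : ℕ → ℤ → ℤ
  at0 zero    z = z
  at0 (suc _) z = 0ℤ

  at0-+ : ∀ n x y → at0 n (x ℤ.+ y) ≡ at0 n x ℤ.+ at0 n y
  at0-+ zero    x y = refl
  at0-+ (suc _) x y = refl

  at0-* : ∀ n c z → at0 n (c ℤ.* z) ≡ c ℤ.* at0 n z
  at0-* zero    c z = refl
  at0-* (suc _) c z = sym (ℤ.*-zeroʳ c)

  one-at0 : ∀ e M → one M ≡ at0 (M e) (one M)
  one-at0 e M with M e in Me≡
  ... | zero  = refl
  ... | suc k = one≡0 λ M≡0 → case trans (sym (All.lookup M≡0 (∈-allFin e))) Me≡ of λ ()

  one-⊕ : ∀ M e → one (M ⊕ e) ≡ 0ℤ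
  one-⊕ M e = one≡0 λ M≡0 → case trans (sym (All.lookup M≡0 (∈-allFin e))) (⊕-same M e) of λ ()

  -- Putting a number for x_e lowers the degree of every monomial containing x_e, so only those free
  -- of x_e survive in top degree.
  top-substitute : ∀ {k} e a (p : Expr k) M → top (substitute e a p) M ≡ at0 (M e) (top p M)
  top-substitute e a (con z)   M = trans (cong (z ℤ.*_) (one-at0 e M)) (sym (at0-* (M e) z (one M)))
  top-substitute e a (p ⟨+⟩ q) M = trans (cong₂ ℤ._+_ (top-substitute e a p M) (top-substitute e a q M))
    (sym (at0-+ (M e) (top p M) (top q M)))
  top-substitute e a (scale z p) M = trans (cong (z ℤ.*_) (top-substitute e a p M)) (sym (at0-* (M e) z (top p M)))
  top-substitute e a (affine c ℓ p) M = trans (∑-cong′ vs term) (at0-∑ (M e))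
    where
    at0-∑ : ∀ n → ∑ vs (λ x → at0 n (ℓ x ℤ.* shift x (top p) M)) ≡ at0 n (∑ vs λ x → ℓ x ℤ.* shift x (top p) M)
    at0-∑ zero    = refl
    at0-∑ (suc _) = ∑-zero vs λ _ → refl
    at0-0 : ∀ n → at0 n 0ℤ ≡ 0ℤ
    at0-0 zero    = refl
    at0-0 (suc _) = refl
    commute : ∀ m n z → down m (at0 n z) ≡ at0 n (down m z)
    commute zero    n z = sym (at0-0 n)
    commute (suc _) n z = refl
    term : ∀ x → (ℓ [ e ≔ 0ℤ ]) x ℤ.* shift x (top (substitute e a p)) M ≡ at0 (M e) (ℓ x ℤ.* shift x (top p) M)
    term x with x Fin.≟ e
    ... | no x≢e = trans (cong (ℓ x ℤ.*_) (trans
      (cong (down (M x)) (trans (top-substitute e a p (M ⊖ x))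
        (cong (λ n → at0 n (top p (M ⊖ x))) (⊖-diff M (x≢e ∘ sym)))))
      (commute (M x) (M e) (top p (M ⊖ x))))) (sym (at0-* (M e) (ℓ x) (shift x (top p) M)))
    ... | yes refl with M x
    ...   | zero  = sym (ℤ.*-zeroʳ (ℓ x))
    ...   | suc _ = refl

  shift-⊕ : ∀ {F} → Extensional F → ∀ e x M →
    shift x F (M ⊕ e) ≡ shift x (λ N → F (N ⊕ e)) M ℤ.+ (if does (x Fin.≟ e) then at0 (M e) (F M) else 0ℤ)
  shift-⊕ {F} F-ext e x M with x Fin.≟ e
  ... | no x≢e = trans (cong (down (M x)) (F-ext (⊕-⊖-comm M (x≢e ∘ sym)))) (sym (ℤ.+-identityʳ _))
  ... | yes refl = trans (F-ext (⊕-⊖ M x)) (step (M x) refl)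
    where
    step : ∀ n → M x ≡ n → F M ≡ down n (F (M ⊖ x ⊕ x)) ℤ.+ at0 n (F M)
    step zero    _   = sym (ℤ.+-identityˡ (F M))
    step (suc _) Mx≡ = trans (F-ext (λ y → sym (⊖-⊕ M x Mx≡ y))) (sym (ℤ.+-identityʳ _))

  -- Passing to coefficients at `N ⊕ e` means (F - F₀) / x_e, where F₀ is F at x_e = 0. For the
  -- product ℓ F this yields ℓ (F - F₀) / x_e + ℓ e F₀, the recursion that also defines `quotient`.
  mul-⊕ : ∀ ℓ {F} → Extensional F → ∀ e M →
    mul ℓ F (M ⊕ e) ≡ mul ℓ (λ N → F (N ⊕ e)) M ℤ.+ ℓ e ℤ.* at0 (M e) (F M)
  mul-⊕ ℓ {F} F-ext e M = begin
    mul ℓ F (M ⊕ e)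
      ≡⟨ ∑-cong′ vs (λ x → trans (cong (ℓ x ℤ.*_) (shift-⊕ F-ext e x M)) (ℤ.*-distribˡ-+ (ℓ x) (shift x (λ N → F (N ⊕ e)) M) (atE x))) ⟩
    ∑ vs (λ x → ℓ x ℤ.* shift x (λ N → F (N ⊕ e)) M ℤ.+ ℓ x ℤ.* atE x)
      ≡⟨ ∑-+ vs (λ x → ℓ x ℤ.* shift x (λ N → F (N ⊕ e)) M) (λ x → ℓ x ℤ.* atE x) ⟩
    mul ℓ (λ N → F (N ⊕ e)) M ℤ.+ ∑ vs (λ x → ℓ x ℤ.* atE x)
      ≡⟨ cong (λ z → mul ℓ (λ N → F (N ⊕ e)) M ℤ.+ z) (trans
           (Domain.∑-single ℤ-domain (Unique.allFin⁺ m) (∈-allFin e)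
             (λ x e≢x → trans (cong (λ b → ℓ x ℤ.* (if b then at0 (M e) (F M) else 0ℤ)) (dec-false (x Fin.≟ e) (e≢x ∘ sym))) (ℤ.*-zeroʳ (ℓ x))))
           (cong (λ b → ℓ e ℤ.* (if b then at0 (M e) (F M) else 0ℤ)) (dec-true (e Fin.≟ e) refl))) ⟩
    mul ℓ (λ N → F (N ⊕ e)) M ℤ.+ ℓ e ℤ.* at0 (M e) (F M)   ∎
    where
    open ≡-Reasoning
    atE : A → ℤ
    atE x = if does (x Fin.≟ e) then at0 (M e) (F M) else 0ℤ

  top₀-⊕ : ∀ (p : Expr 0) M e → top p (M ⊕ e) ≡ 0ℤ
  top₀-⊕ (con z)     M e = trans (cong (z ℤ.*_) (one-⊕ M e)) (ℤ.*-zeroʳ z)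
  top₀-⊕ (p ⟨+⟩ q)   M e = cong₂ ℤ._+_ (top₀-⊕ p M e) (top₀-⊕ q M e)
  top₀-⊕ (scale z p) M e = trans (cong (z ℤ.*_) (top₀-⊕ p M e)) (ℤ.*-zeroʳ z)

  -- In top degree, division by x_e - a is division by x_e, whatever a is.
  top-quotient : ∀ {k} e a (p : Expr (suc k)) M → top (quotient e a p) M ≡ top p (M ⊕ e)
  top-quotient e a (con z)     M = sym (trans (cong (z ℤ.*_) (one-⊕ M e)) (ℤ.*-zeroʳ z))
  top-quotient e a (p ⟨+⟩ q)   M = cong₂ ℤ._+_ (top-quotient e a p M) (top-quotient e a q M)
  top-quotient e a (scale z p) M = cong (z ℤ.*_) (top-quotient e a p M)
  top-quotient {zero} e a (affine c ℓ p) M = sym (trans (mul-⊕ ℓ (top-ext p) e M) (trans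
    (cong₂ ℤ._+_ (mul-zero ℓ (λ N → top₀-⊕ p N e) M) (cong (ℓ e ℤ.*_) (sym (top-substitute e a p M))))
    (ℤ.+-identityˡ (ℓ e ℤ.* top (substitute e a p) M))))
  top-quotient {suc k} e a (affine c ℓ p) M = sym (trans (mul-⊕ ℓ (top-ext p) e M)
    (cong₂ ℤ._+_ (mul-cong {ℓ} (λ _ → refl) (λ N → sym (top-quotient e a p N)) M) (cong (ℓ e ℤ.*_) (sym (top-substitute e a p M)))))

  -- An expression of index 0 contains no affine form, the only place for rational constants. Its
  -- value is therefore an integer independent of the lists, at least 1 in absolute value if
  -- nonzero.
  top₀ : ∀ (p : Expr 0) {M} w → (∀ e → M e ≡ 0) → ⟦ p ⟧ w ≡ fromℤ (top p M)
  top₀ (con z)     w M≡0 = cong fromℤ (sym (trans (cong (z ℤ.*_) (one≡1 λ _ → M≡0 _)) (ℤ.*-identityʳ z)))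
  top₀ (p ⟨+⟩ q)   {M} w M≡0 = trans (cong₂ ℚ._+_ (top₀ p w M≡0) (top₀ q w M≡0)) (sym (fromℤ-+ (top p M) (top q M)))
  top₀ (scale z p) {M} w M≡0 = trans (cong (fromℤ z ℚ.*_) (top₀ p w M≡0)) (sym (fromℤ-* z (top p M)))

  total : Exponents → ℕ
  total M = ∑ℕ.∑ vs M

  total-⊕ : ∀ M e → total (M ⊕ e) ≡ suc (total M)
  total-⊕ M e = begin
    total (M ⊕ e)
      ≡⟨ ∑ℕ.∑-cong′ vs term ⟩
    ∑ℕ.∑ vs (λ x → indicator ℕ-domain (x Fin.≟ e) ℕ.* 1 ℕ.+ M x)
      ≡⟨ ∑ℕ.∑-+ vs (λ x → indicator ℕ-domain (x Fin.≟ e) ℕ.* 1) M ⟩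
    ∑ℕ.∑ vs (λ x → indicator ℕ-domain (x Fin.≟ e) ℕ.* 1) ℕ.+ total M
      ≡⟨ cong (ℕ._+ total M) (∑-indicator ℕ-domain e (λ _ → 1)) ⟩
    suc (total M)   ∎
    where
    open ≡-Reasoning
    term : ∀ x → (M ⊕ e) x ≡ indicator ℕ-domain (x Fin.≟ e) ℕ.* 1 ℕ.+ M x
    term x with does (x Fin.≟ e)
    ... | true  = refl
    ... | false = refl

  total-⊖ : ∀ M e {k} → M e ≢ 0 → total M ≡ suc k → total (M ⊖ e) ≡ k
  total-⊖ M e Me≢0 total≡ with M e in Me≡
  ... | zero  = contradiction refl Me≢0
  ... | suc _ = ℕ.suc-injective (trans (sym (total-⊕ (M ⊖ e) e)) (trans (∑ℕ.∑-cong′ vs (⊖-⊕ M e Me≡)) total≡))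

  -- A product of linear forms is homogeneous. So every monomial that occurs has the full degree, as
  -- the Nullstellensatz demands.
  coef≢0⇒total : ∀ {I : Set} (ρ : I → A → ℤ) is {M} → coef ρ is M ≢ 0ℤ → total M ≡ length is
  coef≢0⇒total ρ [] {M} ≢0 with All.all? (λ e → M e ℕ.≟ 0) vs
  ... | yes M≡0 = ∑ℕ.∑-zero vs λ x∈ → All.lookup M≡0 x∈
  ... | no  _   = contradiction refl ≢0
  coef≢0⇒total ρ (i ∷ is) {M} ≢0 with Domain.∑≢0⇒∃ ℤ-domain vs {λ e → ρ i e ℤ.* shift e (coef ρ is) M} ≢0
  ... | e , _ , term≢0 with M e in Me≡
  ...   | zero  = contradiction (ℤ.*-zeroʳ (ρ i e)) term≢0
  ...   | suc _ = trans (sym (∑ℕ.∑-cong′ vs (⊖-⊕ M e Me≡))) (trans (total-⊕ (M ⊖ e) e)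
    (cong suc (coef≢0⇒total ρ is λ ≡0 → term≢0 (trans (cong (ρ i e ℤ.*_) ≡0) (ℤ.*-zeroʳ (ρ i e))))))

  -- Induction on the degree: f(w) − f(w[e ≔ a]) = (w_e − a) q(w), and where
  -- the right-hand side is large one of the two values of f is.
  nullstellensatz : ∀ {K} {ε} → 0ℚ ℚ.≤ ε → (a : A → Fin K → ℚ) →
    (∀ e i j → i ≢ j → ε ℚ.≤ ∣ a e i ℚ.- a e j ∣) →
    ∀ {k} (p : Expr k) M → total M ≡ k → top p M ≢ 0ℤ → (∀ e → M e ℕ.< K) →
    Σ[ c ∈ (A → Fin K) ] (∀ e → Fin.toℕ (c e) ℕ.≤ M e) × margin ε k ℚ.≤ ∣ ⟦ p ⟧ (λ e → a e (c e)) ∣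
  nullstellensatz 0≤ε a gap {zero} p M total≡0 top≢0 M<K =
    (λ e → Fin.fromℕ< (M<K e)) , (λ e → ℕ.≤-reflexive (Fin.toℕ-fromℕ< (M<K e))) ,
    subst (λ z → 1ℚ ℚ.≤ ∣ z ∣) (sym (top₀ p _ λ e → ∑≡0⇒≡0 vs total≡0 (∈-allFin e))) (1≤∣fromℤ∣ top≢0)
    where
    ∑≡0⇒≡0 : ∀ xs → ∑ℕ.∑ xs M ≡ 0 → ∀ {x} → x ∈ₗ xs → M x ≡ 0
    ∑≡0⇒≡0 (x ∷ xs) ≡0 (here refl) = ℕ.m+n≡0⇒m≡0 (M x) ≡0
    ∑≡0⇒≡0 (x ∷ xs) ≡0 (there x∈)  = ∑≡0⇒≡0 xs (ℕ.m+n≡0⇒n≡0 (M x) ≡0) x∈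
  nullstellensatz {K} {ε} 0≤ε a gap {suc k} p M total≡ top≢0 M<K
    with e , _ , Me≢0 ← ∑ℕ.∑≢0⇒∃ vs (λ ≡0 → ℕ.1+n≢0 (trans (sym total≡) ≡0)) = conclude (recurse (M e) refl)
    where
    -- The value with index M e. The recursion uses indices at most M e - 1 at e, so this value is
    -- still free and lies at distance at least ε from the chosen one.
    last : Fin K
    last = Fin.fromℕ< (M<K e)
    q : Expr k
    q = quotient e (a e last) p

    recurse : ∀ n → M e ≡ n → Σ[ c ∈ (A → Fin K) ] (∀ x → Fin.toℕ (c x) ℕ.≤ (M ⊖ e) x) × margin ε k ℚ.≤ ∣ ⟦ q ⟧ (λ x → a x (c x)) ∣
    recurse zero    Me≡ = contradiction Me≡ Me≢0
    recurse (suc _) Me≡ = nullstellensatz 0≤ε a gap q (M ⊖ e) (total-⊖ M e Me≢0 total≡)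
      (λ ≡0 → top≢0 (trans (top-ext p (λ x → sym (⊖-⊕ M e Me≡ x))) (trans (sym (top-quotient e (a e last) p (M ⊖ e))) ≡0)))
      (λ x → ℕ.≤-<-trans (⊖-≤ M e x) (M<K x))

    conclude : Σ[ c ∈ (A → Fin K) ] (∀ x → Fin.toℕ (c x) ℕ.≤ (M ⊖ e) x) × margin ε k ℚ.≤ ∣ ⟦ q ⟧ (λ x → a x (c x)) ∣ →
               Σ[ c ∈ (A → Fin K) ] (∀ x → Fin.toℕ (c x) ℕ.≤ M x) × margin ε (suc k) ℚ.≤ ∣ ⟦ p ⟧ (λ x → a x (c x)) ∣
    conclude (c , c≤ , large) with margin ε (suc k) ℚ.≤? ∣ ⟦ p ⟧ (λ x → a x (c x)) ∣
    ... | yes done = c , (λ x → ℕ.≤-trans (c≤ x) (⊖-≤ M e x)) , done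
    ... | no ¬done = c [ e ≔ last ] , c′≤ , subst (λ z → margin ε (suc k) ℚ.≤ ∣ z ∣) (⟦⟧-cong p same)
      (half-of-difference (⟦quotient⟧ e (a e last) p w) (*-mono-≤-∣∣ 0≤ε (gap e (c e) last c≢last) large) (ℚ.<⇒≤ (ℚ.≰⇒> ¬done)))
      where
      w = λ x → a x (c x)
      c′≤ : ∀ x → Fin.toℕ ((c [ e ≔ last ]) x) ℕ.≤ M x
      c′≤ x with x Fin.≟ e
      ... | yes refl = ℕ.≤-reflexive (Fin.toℕ-fromℕ< (M<K x))
      ... | no  _    = ℕ.≤-trans (c≤ x) (⊖-≤ M e x)
      same : w [ e ≔ a e last ] ≗ λ x → a x ((c [ e ≔ last ]) x)
      same x with x Fin.≟ e
      ... | yes refl = refl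
      ... | no  _    = refl
      c≢last : c e ≢ last
      c≢last c≡ = ℕ.<-irrefl refl (begin-strict
        ℕ.pred (M e)       <⟨ ℕ.≤-reflexive (ℕ.suc-pred (M e) {{ℕ.≢-nonZero Me≢0}}) ⟩
        M e                ≡⟨ Fin.toℕ-fromℕ< (M<K e) ⟨
        Fin.toℕ last       ≡⟨ cong Fin.toℕ c≡ ⟨
        Fin.toℕ (c e)      ≤⟨ c≤ e ⟩
        (M ⊖ e) e          ≡⟨ ⊖-same M e ⟩
        ℕ.pred (M e)       ∎)
        where open ℕ.≤-Reasoning

-- Passage to the reals

*-pos : ∀ {p q} → 0ℚ ℚ.< p → 0ℚ ℚ.< q → 0ℚ ℚ.< p ℚ.* q
*-pos {p} {q} 0<p 0<q = subst (ℚ._< p ℚ.* q) (ℚ.*-zeroʳ p) (ℚ.*-monoʳ-<-pos p {{ℚ.positive 0<p}} 0<q)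

*-mono-≤-nonNeg : ∀ {p q r s} → 0ℚ ℚ.≤ p → p ℚ.≤ q → 0ℚ ℚ.≤ s → r ℚ.≤ s → p ℚ.* r ℚ.≤ q ℚ.* s
*-mono-≤-nonNeg {p} {q} {r} {s} 0≤p p≤q 0≤s r≤s = ℚ.≤-trans
  (ℚ.*-monoˡ-≤-nonNeg p {{ℚ.nonNegative 0≤p}} r≤s) (ℚ.*-monoʳ-≤-nonNeg s {{ℚ.nonNegative 0≤s}} p≤q)

0<½ : 0ℚ ℚ.< ½
0<½ = ℚ.positive⁻¹ ½

0<1 : 0ℚ ℚ.< 1ℚ
0<1 = ℚ.positive⁻¹ 1ℚ

0≤1 : 0ℚ ℚ.≤ 1ℚ
0≤1 = ℚ.<⇒≤ 0<1

divide : ∀ {b} → 0ℚ ℚ.< b → ∀ {δ} → 0ℚ ℚ.< δ → ∃[ η ] 0ℚ ℚ.< η × η ℚ.* b ≡ δ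
divide {b} 0<b {δ} 0<δ = δ ℚ.* 1/b , *-pos 0<δ (ℚ.positive⁻¹ 1/b {{ℚ.1/pos⇒pos b {{b-pos}}}}) , (begin
  (δ ℚ.* 1/b) ℚ.* b   ≡⟨ ℚ.*-assoc δ 1/b b ⟩
  δ ℚ.* (1/b ℚ.* b)   ≡⟨ cong (δ ℚ.*_) (ℚ.*-inverseˡ b {{b≢0}}) ⟩
  δ ℚ.* 1ℚ            ≡⟨ ℚ.*-identityʳ δ ⟩
  δ                   ∎)
  where
  open ≡-Reasoning
  b-pos = ℚ.positive 0<b
  b≢0 = ℚ.pos⇒nonZero b {{b-pos}}
  1/b = ℚ.1/_ b {{b≢0}}

*-cancelʳ-≤ : ∀ {b p q} → 0ℚ ℚ.< b → p ℚ.* b ℚ.≤ q ℚ.* b → p ℚ.≤ q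
*-cancelʳ-≤ {b} {p} {q} 0<b pb≤qb = ℚ.≮⇒≥ λ q<p →
  ℚ.<-irrefl refl (ℚ.<-≤-trans (ℚ.*-monoˡ-<-pos b {{ℚ.positive 0<b}} q<p) pb≤qb)

Eventually : (ℕ → Set) → Set
Eventually Φ = ∃[ N ] (∀ t → N ℕ.≤ t → Φ t)

eventually-map : ∀ {Φ Ψ : ℕ → Set} → (∀ {t} → Φ t → Ψ t) → Eventually Φ → Eventually Ψ
eventually-map f (N , φ) = N , λ t N≤t → f (φ t N≤t)

eventually-× : ∀ {Φ Ψ : ℕ → Set} → Eventually Φ → Eventually Ψ → Eventually (λ t → Φ t × Ψ t)
eventually-× (M , φ) (N , ψ) = M ℕ.⊔ N , λ t M⊔N≤t →
  φ t (ℕ.m⊔n≤o⇒m≤o M N M⊔N≤t) , ψ t (ℕ.m⊔n≤o⇒n≤o M N M⊔N≤t)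

eventually-∀ : ∀ {n} {Φ : Fin n → ℕ → Set} → (∀ x → Eventually (Φ x)) → Eventually (λ t → ∀ x → Φ x t)
eventually-∀ {zero}  φ = 0 , λ _ _ ()
eventually-∀ {suc n} φ = eventually-map (λ { (φ₀ , φ₊) Fin.zero → φ₀ ; (φ₀ , φ₊) (Fin.suc x) → φ₊ x })
  (eventually-× (φ Fin.zero) (eventually-∀ (φ ∘ Fin.suc)))

uniformly-small : ∀ {n} {Ψ : Fin n → ℚ → Set} → (∀ x {δ ε} → δ ℚ.≤ ε → Ψ x ε → Ψ x δ) →
                  (∀ x → ∃[ ε ] 0ℚ ℚ.< ε × Ψ x ε) → ∃[ ε ] 0ℚ ℚ.< ε × (∀ x → Ψ x ε)
uniformly-small {zero}  anti ψ = 1ℚ , 0<1 , λ ()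
uniformly-small {suc n} anti ψ
  with ε₀ , 0<ε₀ , ψ₀ ← ψ Fin.zero
  with ε₊ , 0<ε₊ , ψ₊ ← uniformly-small (anti ∘ Fin.suc) (ψ ∘ Fin.suc)
  with ℚ.≤-total ε₀ ε₊
... | inj₁ ε₀≤ε₊ = ε₀ , 0<ε₀ , λ { Fin.zero → ψ₀ ; (Fin.suc x) → anti (Fin.suc x) ε₀≤ε₊ (ψ₊ x) }
... | inj₂ ε₊≤ε₀ = ε₊ , 0<ε₊ , λ { Fin.zero → anti Fin.zero ε₊≤ε₀ ψ₀ ; (Fin.suc x) → ψ₊ x }

-- The bound is kept at least 1 so that surplus factors of it only weaken an upper estimate.
uniformly-large : ∀ {n} {Ψ : Fin n → ℚ → Set} → (∀ x {b c} → b ℚ.≤ c → Ψ x b → Ψ x c) →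
                  (∀ x → ∃[ b ] Ψ x b) → ∃[ b ] 1ℚ ℚ.≤ b × (∀ x → Ψ x b)
uniformly-large {zero}  mono ψ = 1ℚ , ℚ.≤-refl , λ ()
uniformly-large {suc n} mono ψ
  with b₀ , ψ₀ ← ψ Fin.zero
  with b₊ , 1≤b₊ , ψ₊ ← uniformly-large (mono ∘ Fin.suc) (ψ ∘ Fin.suc)
  with ℚ.≤-total b₀ b₊
... | inj₁ b₀≤b₊ = b₊ , 1≤b₊ , λ { Fin.zero → mono Fin.zero b₀≤b₊ ψ₀ ; (Fin.suc x) → ψ₊ x }
... | inj₂ b₊≤b₀ = b₀ , ℚ.≤-trans 1≤b₊ b₊≤b₀ , λ { Fin.zero → ψ₀ ; (Fin.suc x) → mono (Fin.suc x) b₊≤b₀ (ψ₊ x) }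

#-sym : ∀ x y → x # y → y # x
#-sym x y (ε , 0<ε , N , apart) = ε , 0<ε , N , λ i N≤i → subst (ε ℚ.≤_) (∣-∣-comm (approx x i) (approx y i)) (apart i N≤i)
  where
  ∣-∣-comm : ∀ p q → ∣ p ℚ.- q ∣ ≡ ∣ q ℚ.- p ∣
  ∣-∣-comm p q = trans (cong ∣_∣ (flip p q)) (ℚ.∣-p∣≡∣p∣ (q ℚ.- p))
    where
    flip : ∀ p q → p ℚ.- q ≡ ℚ.- (q ℚ.- p)
    flip = solve 2 (λ p q → p :- q := :- (q :- p)) refl

allPairs-# : ∀ {k} {xs : Vec ℝ k} → VecAllPairs.AllPairs _#_ xs → ∀ {i j} → i ≢ j → Vec.lookup xs i # Vec.lookup xs j
allPairs-# (x# VecAllPairs.∷ _)    {Fin.zero}  {Fin.zero}  i≢j = contradiction refl i≢j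
allPairs-# (x# VecAllPairs.∷ _)    {Fin.zero}  {Fin.suc j} _   = VecAll.lookup x# (Vec.∈-lookup j _)
allPairs-# {xs = x Vec.∷ xs} (x# VecAllPairs.∷ _) {Fin.suc i} {Fin.zero} _ = #-sym x (Vec.lookup xs i) (VecAll.lookup x# (Vec.∈-lookup i _))
allPairs-# (_  VecAllPairs.∷ xs#)  {Fin.suc i} {Fin.suc j} i≢j = allPairs-# xs# (i≢j ∘ cong Fin.suc)

bounded : ∀ x → ∃[ b ] Eventually (λ t → ∣ approx x t ∣ ℚ.≤ b)
bounded x = let N , close = cauchy x 1ℚ 0<1 in 1ℚ ℚ.+ ∣ approx x N ∣ , N , λ t N≤t → begin
  ∣ approx x t ∣                                          ≡⟨ cong ∣_∣ (telescope (approx x t) (approx x N)) ⟩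
  ∣ (approx x t ℚ.- approx x N) ℚ.+ approx x N ∣          ≤⟨ ℚ.∣p+q∣≤∣p∣+∣q∣ (approx x t ℚ.- approx x N) (approx x N) ⟩
  ∣ approx x t ℚ.- approx x N ∣ ℚ.+ ∣ approx x N ∣        ≤⟨ ℚ.+-monoˡ-≤ ∣ approx x N ∣ (ℚ.<⇒≤ (close t N N≤t ℕ.≤-refl)) ⟩
  1ℚ ℚ.+ ∣ approx x N ∣                                   ∎
  where
  open ℚ.≤-Reasoning
  telescope : ∀ p q → p ≡ (p ℚ.- q) ℚ.+ q
  telescope = solve 2 (λ p q → p := (p :- q) :+ q) refl

power : ℚ → ℕ → ℚ
power b zero    = 1ℚ
power b (suc k) = b ℚ.* power b k

1≤power : ∀ {b} → 1ℚ ℚ.≤ b → ∀ k → 1ℚ ℚ.≤ power b k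
1≤power     1≤b zero    = ℚ.≤-refl
1≤power {b} 1≤b (suc k) = *-mono-≤-nonNeg {1ℚ} {b} {1ℚ} 0≤1 1≤b (ℚ.≤-trans 0≤1 (1≤power 1≤b k)) (1≤power 1≤b k)

margin>0 : ∀ {ε} → 0ℚ ℚ.< ε → ∀ k → 0ℚ ℚ.< margin ε k
margin>0 0<ε zero    = 0<1
margin>0 0<ε (suc k) = *-pos 0<½ (*-pos 0<ε (margin>0 0<ε k))

-- Estimates for products of linear forms

module _ {m : ℕ} where

  open Expansion ℤ-domain (Fin._≟_ {m}) (allFin m)

  product : ∀ {I : Set} → (I → Fin m → ℤ) → (is : List I) → Expr {m} (length is)
  product ρ []       = con 1ℤ
  product ρ (i ∷ is) = affine 0ℚ (ρ i) (product ρ is)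

  top-product : ∀ {I : Set} (ρ : I → Fin m → ℤ) is → top (product ρ is) ≗ coef ρ is
  top-product ρ []       M = ℤ.*-identityˡ (one M)
  top-product ρ (i ∷ is) M = mul-cong {ρ i} (λ _ → refl) (top-product ρ is) M

  ∣product∣≤ : ∀ {I : Set} (ρ : I → Fin m → ℤ) {w b} → 1ℚ ℚ.≤ b → (∀ i → ∣ linear (ρ i) w ∣ ℚ.≤ b) →
               ∀ is → ∣ ⟦ product ρ is ⟧ w ∣ ℚ.≤ power b (length is)
  ∣product∣≤ ρ 1≤b ≤b []       = ℚ.≤-refl
  ∣product∣≤ ρ {w} {b} 1≤b ≤b (i ∷ is) = begin
    ∣ (0ℚ ℚ.+ linear (ρ i) w) ℚ.* ⟦ product ρ is ⟧ w ∣     ≡⟨ cong (λ z → ∣ z ℚ.* ⟦ product ρ is ⟧ w ∣) (ℚ.+-identityˡ (linear (ρ i) w)) ⟩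
    ∣ linear (ρ i) w ℚ.* ⟦ product ρ is ⟧ w ∣              ≡⟨ ℚ.∣p*q∣≡∣p∣*∣q∣ (linear (ρ i) w) (⟦ product ρ is ⟧ w) ⟩
    ∣ linear (ρ i) w ∣ ℚ.* ∣ ⟦ product ρ is ⟧ w ∣          ≤⟨ *-mono-≤-nonNeg (ℚ.0≤∣p∣ (linear (ρ i) w)) (≤b i)
                                                                (ℚ.≤-trans 0≤1 (1≤power 1≤b (length is))) (∣product∣≤ ρ 1≤b ≤b is) ⟩
    b ℚ.* power b (length is)                              ∎
    where open ℚ.≤-Reasoning

  -- All other factors are at most b, so a lower bound for the product becomes one for each single
  -- factor. The exponent is one larger than their number, which 1 ≤ b permits.
  ∣product∣≤∣factor∣ : ∀ {I : Set} (ρ : I → Fin m → ℤ) {w b} → 1ℚ ℚ.≤ b → (∀ i → ∣ linear (ρ i) w ∣ ℚ.≤ b) →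
    ∀ is {i} → i ∈ₗ is → ∣ ⟦ product ρ is ⟧ w ∣ ℚ.≤ ∣ linear (ρ i) w ∣ ℚ.* power b (length is)
  ∣product∣≤∣factor∣ ρ {w} {b} 1≤b ≤b (i ∷ is) {j} j∈ = begin
    ∣ (0ℚ ℚ.+ linear (ρ i) w) ℚ.* ⟦ product ρ is ⟧ w ∣     ≡⟨ cong (λ z → ∣ z ℚ.* ⟦ product ρ is ⟧ w ∣) (ℚ.+-identityˡ (linear (ρ i) w)) ⟩
    ∣ linear (ρ i) w ℚ.* ⟦ product ρ is ⟧ w ∣              ≡⟨ ℚ.∣p*q∣≡∣p∣*∣q∣ (linear (ρ i) w) (⟦ product ρ is ⟧ w) ⟩
    ∣ linear (ρ i) w ∣ ℚ.* ∣ ⟦ product ρ is ⟧ w ∣          ≤⟨ bound j∈ ⟩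
    ∣ linear (ρ j) w ∣ ℚ.* (b ℚ.* power b (length is))     ∎
    where
    open ℚ.≤-Reasoning
    pow = power b (length is)
    0≤pow : 0ℚ ℚ.≤ pow
    0≤pow = ℚ.≤-trans 0≤1 (1≤power 1≤b (length is))
    bound : j ∈ₗ i ∷ is → ∣ linear (ρ i) w ∣ ℚ.* ∣ ⟦ product ρ is ⟧ w ∣ ℚ.≤ ∣ linear (ρ j) w ∣ ℚ.* (b ℚ.* pow)
    bound (here refl) = *-mono-≤-nonNeg (ℚ.0≤∣p∣ (linear (ρ j) w)) ℚ.≤-refl
      (ℚ.≤-trans 0≤1 (1≤power 1≤b (suc (length is)))) (ℚ.≤-trans (∣product∣≤ ρ 1≤b ≤b is) (begin
        pow           ≡⟨ ℚ.*-identityˡ pow ⟨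
        1ℚ ℚ.* pow    ≤⟨ ℚ.*-monoʳ-≤-nonNeg pow {{ℚ.nonNegative 0≤pow}} 1≤b ⟩
        b ℚ.* pow     ∎))
    bound (there j∈) = begin
      ∣ linear (ρ i) w ∣ ℚ.* ∣ ⟦ product ρ is ⟧ w ∣
        ≤⟨ *-mono-≤-nonNeg (ℚ.0≤∣p∣ (linear (ρ i) w)) (≤b i) 0≤factor (∣product∣≤∣factor∣ ρ 1≤b ≤b is j∈) ⟩
      b ℚ.* (∣ linear (ρ j) w ∣ ℚ.* pow)
        ≡⟨ left-comm b ∣ linear (ρ j) w ∣ pow ⟩
      ∣ linear (ρ j) w ∣ ℚ.* (b ℚ.* pow)   ∎
      where
      0≤factor : 0ℚ ℚ.≤ ∣ linear (ρ j) w ∣ ℚ.* pow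
      0≤factor = *-mono-≤-nonNeg {0ℚ} {_} {0ℚ} ℚ.≤-refl (ℚ.0≤∣p∣ (linear (ρ j) w)) 0≤pow 0≤pow
      left-comm : ∀ x y z → x ℚ.* (y ℚ.* z) ≡ y ℚ.* (x ℚ.* z)
      left-comm = solve 3 (λ x y z → x :* (y :* z) := y :* (x :* z)) refl

  -- The Lipschitz constant of the linear form in the maximum norm. It controls both the size of a
  -- factor and its drift.
  slopeSum : (Fin m → ℤ) → ℚ
  slopeSum ℓ = ∑ℚ.∑ (allFin m) λ e → ∣ fromℤ (ℓ e) ∣

  ∣linear∣≤ : ∀ ℓ {w β} → 0ℚ ℚ.≤ β → (∀ e → ∣ w e ∣ ℚ.≤ β) → ∣ linear ℓ w ∣ ℚ.≤ slopeSum ℓ ℚ.* β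
  ∣linear∣≤ ℓ {w} {β} 0≤β ≤β = go (allFin m)
    where
    open ℚ.≤-Reasoning
    go : ∀ es → ∣ ∑ℚ.∑ es (λ e → fromℤ (ℓ e) ℚ.* w e) ∣ ℚ.≤ ∑ℚ.∑ es (λ e → ∣ fromℤ (ℓ e) ∣) ℚ.* β
    go []       = ℚ.≤-reflexive (sym (ℚ.*-zeroˡ β))
    go (e ∷ es) = begin
      ∣ s ℚ.* w e ℚ.+ rest ∣           ≤⟨ ℚ.∣p+q∣≤∣p∣+∣q∣ (s ℚ.* w e) rest ⟩
      ∣ s ℚ.* w e ∣ ℚ.+ ∣ rest ∣       ≤⟨ ℚ.+-mono-≤ (begin
          ∣ s ℚ.* w e ∣          ≡⟨ ℚ.∣p*q∣≡∣p∣*∣q∣ s (w e) ⟩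
          ∣ s ∣ ℚ.* ∣ w e ∣      ≤⟨ ℚ.*-monoˡ-≤-nonNeg ∣ s ∣ {{ℚ.nonNegative (ℚ.0≤∣p∣ s)}} (≤β e) ⟩
          ∣ s ∣ ℚ.* β            ∎) (go es) ⟩
      ∣ s ∣ ℚ.* β ℚ.+ slopes ℚ.* β     ≡⟨ ℚ.*-distribʳ-+ β ∣ s ∣ slopes ⟨
      (∣ s ∣ ℚ.+ slopes) ℚ.* β         ∎
      where
      s = fromℤ (ℓ e)
      rest = ∑ℚ.∑ es (λ e → fromℤ (ℓ e) ℚ.* w e)
      slopes = ∑ℚ.∑ es (λ e → ∣ fromℤ (ℓ e) ∣)

  linear-minus : ∀ ℓ w w′ → linear ℓ (λ e → w e ℚ.- w′ e) ≡ linear ℓ w ℚ.- linear ℓ w′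
  linear-minus ℓ w w′ = go (allFin m)
    where
    go : ∀ es → ∑ℚ.∑ es (λ e → fromℤ (ℓ e) ℚ.* (w e ℚ.- w′ e)) ≡
                ∑ℚ.∑ es (λ e → fromℤ (ℓ e) ℚ.* w e) ℚ.- ∑ℚ.∑ es (λ e → fromℤ (ℓ e) ℚ.* w′ e)
    go []       = refl
    go (e ∷ es) = trans (cong (fromℤ (ℓ e) ℚ.* (w e ℚ.- w′ e) ℚ.+_) (go es))
      (regroup (fromℤ (ℓ e)) (w e) (w′ e) (∑ℚ.∑ es (λ e → fromℤ (ℓ e) ℚ.* w e)) (∑ℚ.∑ es (λ e → fromℤ (ℓ e) ℚ.* w′ e)))
      where
      regroup : ∀ s x y X Y → s ℚ.* (x ℚ.- y) ℚ.+ (X ℚ.- Y) ≡ (s ℚ.* x ℚ.+ X) ℚ.- (s ℚ.* y ℚ.+ Y)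
      regroup = solve 5 (λ s x y X Y → s :* (x :- y) :+ (X :- Y) := (s :* x :+ X) :- (s :* y :+ Y)) refl

-- Weights from lists of reals

module _ {n} (G : Graph n) where

  private
    m = size G
    ρ = edgeRow G

  approx-sum : ∀ (w : Fin m → ℝ) es t →
               approx (foldr _+ℝ_ 0ℝ (map w es)) t ≡ ∑ℚ.∑ es (λ e → approx (w e) t)
  approx-sum w []       t = refl
  approx-sum w (e ∷ es) t = cong (approx (w e) t ℚ.+_) (approx-sum w es t)

  weightSum-difference : ∀ w f t → let u , v = ends G f in
    approx (weightSum G w v) t ℚ.- approx (weightSum G w u) t ≡ linear (ρ f) (λ e → approx (w e) t)
  weightSum-difference w f t = begin
    approx (weightSum G w v) t ℚ.- approx (weightSum G w u) t
      ≡⟨ cong₂ ℚ._-_ (expand v) (expand u) ⟩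
    ∑ℚ.∑ (allFin m) (at v) ℚ.- ∑ℚ.∑ (allFin m) (at u)
      ≡⟨ subtract (allFin m) ⟩
    linear (ρ f) x   ∎
    where
    open ≡-Reasoning
    u = proj₁ (ends G f)
    v = proj₂ (ends G f)
    x : Fin m → ℚ
    x e = approx (w e) t
    incident? : ∀ v e → Dec (v ≡ proj₁ (ends G e) ⊎ v ≡ proj₂ (ends G e))
    incident? v e = (v Fin.≟ proj₁ (ends G e)) ⊎-dec (v Fin.≟ proj₂ (ends G e))
    at : Fin n → Fin m → ℚ
    at v e = if does (incident? v e) then x e else 0ℚ
    expand : ∀ v → approx (weightSum G w v) t ≡ ∑ℚ.∑ (allFin m) (at v)
    expand v = trans (approx-sum w (incidentEdges G v) t) (∑ℚ.∑-filter (incident? v) (allFin m) x)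
    term : ∀ p q z → (if p then z else 0ℚ) ℚ.- (if q then z else 0ℚ) ≡
                     fromℤ ((if p then 1ℤ else 0ℤ) ℤ.- (if q then 1ℤ else 0ℤ)) ℚ.* z
    term true  true  z = trans (ℚ.+-inverseʳ z) (sym (ℚ.*-zeroˡ z))
    term true  false z = trans (ℚ.+-identityʳ z) (sym (ℚ.*-identityˡ z))
    term false true  z = trans (ℚ.+-identityˡ (ℚ.- z)) (trans (cong ℚ.-_ (sym (ℚ.*-identityˡ z))) (ℚ.neg-distribˡ-* 1ℚ z))
    term false false z = sym (ℚ.*-zeroˡ z)
    subtract : ∀ es → ∑ℚ.∑ es (at v) ℚ.- ∑ℚ.∑ es (at u) ≡ ∑ℚ.∑ es (λ e → fromℤ (ρ f e) ℚ.* x e)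
    subtract []       = refl
    subtract (e ∷ es) = trans (regroup (at v e) (at u e) (∑ℚ.∑ es (at v)) (∑ℚ.∑ es (at u)))
      (cong₂ ℚ._+_ (term (does (incident? v e)) (does (incident? u e)) (x e)) (subtract es))
      where
      regroup : ∀ x y X Y → (x ℚ.+ X) ℚ.- (y ℚ.+ Y) ≡ (x ℚ.- y) ℚ.+ (X ℚ.- Y)
      regroup = solve 4 (λ x y X Y → (x :+ X) :- (y :+ Y) := (x :- y) :+ (X :- Y)) refl

  module _ {k} (L : Fin m → Vec ℝ k) (distinct : ∀ e → VecAllPairs.AllPairs _#_ (L e)) where

    private
      val : ℕ → Fin m → Fin k → ℚ
      val t e j = approx (Vec.lookup (L e) j) t

    -- The condition i ≢ j stands inside `Eventually`, so that a common index can be taken over all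
    -- pairs, equal ones holding vacuously.
    uniform-gap : ∃[ ε ] 0ℚ ℚ.< ε × (∀ e i j → Eventually λ t → i ≢ j → ε ℚ.≤ ∣ val t e i ℚ.- val t e j ∣)
    uniform-gap =
      uniformly-small (λ e δ≤ε gap i j → weaken δ≤ε (gap i j)) λ e →
      uniformly-small (λ i δ≤ε gap j → weaken δ≤ε (gap j)) λ i →
      uniformly-small (λ j δ≤ε gap → weaken δ≤ε gap) λ j → gap-at e i j (i Fin.≟ j)
      where
      weaken : ∀ {e i j δ ε} → δ ℚ.≤ ε → Eventually (λ t → i ≢ j → ε ℚ.≤ ∣ val t e i ℚ.- val t e j ∣) →
               Eventually (λ t → i ≢ j → δ ℚ.≤ ∣ val t e i ℚ.- val t e j ∣)
      weaken δ≤ε (N , gap) = N , λ t N≤t i≢j → ℚ.≤-trans δ≤ε (gap t N≤t i≢j)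
      gap-at : ∀ e i j → Dec (i ≡ j) → ∃[ ε ] 0ℚ ℚ.< ε × Eventually (λ t → i ≢ j → ε ℚ.≤ ∣ val t e i ℚ.- val t e j ∣)
      gap-at e i j (yes i≡j) = 1ℚ , 0<1 , 0 , λ _ _ i≢j → contradiction i≡j i≢j
      gap-at e i j (no i≢j)  = let ε , 0<ε , N , gap = allPairs-# (distinct e) i≢j in ε , 0<ε , N , λ t N≤t _ → gap t N≤t

    uniform-bound : ∃[ b ] 1ℚ ℚ.≤ b × (∀ e j → Eventually λ t → ∣ val t e j ∣ ℚ.≤ b)
    uniform-bound =
      uniformly-large (λ e b≤c bnd j → weaken b≤c (bnd j)) λ e →
      let b , _ , bnd = uniformly-large (λ j b≤c bnd → weaken b≤c bnd) (λ j → bounded (Vec.lookup (L e) j)) in b , bnd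
      where
      weaken : ∀ {e j b c} → b ℚ.≤ c → Eventually (λ t → ∣ val t e j ∣ ℚ.≤ b) → Eventually (λ t → ∣ val t e j ∣ ℚ.≤ c)
      weaken b≤c (N , bnd) = N , λ t N≤t → ℚ.≤-trans (bnd t N≤t) b≤c

    uniform-slope : ∃[ s ] 1ℚ ℚ.≤ s × (∀ f → slopeSum (ρ f) ℚ.≤ s)
    uniform-slope = uniformly-large (λ _ b≤c ≤b → ℚ.≤-trans ≤b b≤c) λ f → slopeSum (ρ f) , ℚ.≤-refl

    uniform-cauchy : ∀ {γ} → 0ℚ ℚ.< γ → ∀ e j → Eventually λ t → ∀ t′ → t ℕ.≤ t′ → ∣ val t e j ℚ.- val t′ e j ∣ ℚ.≤ γ
    uniform-cauchy {γ} 0<γ e j = let N , close = cauchy (Vec.lookup (L e) j) γ 0<γ in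
      N , λ t N≤t t′ t≤t′ → ℚ.<⇒≤ (close t t′ N≤t (ℕ.≤-trans N≤t t≤t′))

    -- The case distinctions of the Nullstellensatz compare rationals, where the order is decidable.
    -- They are made at a single index t, and the selection found there is kept for all later
    -- indices.
    choose : ∀ {N} → Expansion.coef ℤ-domain Fin._≟_ (allFin m) ρ (allFin m) N ≢ 0ℤ → (∀ e → N e ℕ.< k) →
      Σ[ c ∈ (Fin m → Fin k) ] ∀ f → let u , v = ends G f ; w = λ e → Vec.lookup (L e) (c e) in
      weightSum G w v # weightSum G w u
    choose {N} occurs N<k =
      let ε , 0<ε , gap = uniform-gap
          b , 1≤b , bnd = uniform-bound
          s , 1≤s , slope = uniform-slope
          len = length (allFin m)
          B = s ℚ.* b
          1≤B : 1ℚ ℚ.≤ B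
          1≤B = *-mono-≤-nonNeg {1ℚ} {s} {1ℚ} 0≤1 1≤s (ℚ.≤-trans 0≤1 1≤b) 1≤b
          -- The product of the factors is at least the margin and each factor is at most B, so each
          -- is at least η. None of these constants depends on t.
          η , 0<η , ηB≡ = divide (ℚ.<-≤-trans 0<1 (1≤power 1≤B len)) (margin>0 0<ε len)
          -- If every weight moves by at most γ, a factor moves by at most s γ = η/2, and so at
          -- least η/2 of it is left.
          γ , 0<γ , γs≡ = divide (ℚ.<-≤-trans 0<1 1≤s) (*-pos 0<½ 0<η)
          t , at-t = eventually-× (eventually-∀ λ e → eventually-∀ λ i → eventually-∀ λ j → gap e i j)
                       (eventually-× (eventually-∀ λ e → eventually-∀ λ j → bnd e j)
                                     (eventually-∀ λ e → eventually-∀ λ j → uniform-cauchy 0<γ e j))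
          gapₜ , bndₜ , closeₜ = at-t t ℕ.≤-refl
          c , _ , large = nullstellensatz (ℚ.<⇒≤ 0<ε) (val t) gapₜ (product ρ (allFin m)) N
            (coef≢0⇒total ρ (allFin m) occurs) (λ ≡0 → occurs (trans (sym (top-product ρ (allFin m) N)) ≡0)) N<k
          x = λ t e → val t e (c e)
          factor≤B : ∀ f → ∣ linear (ρ f) (x t) ∣ ℚ.≤ B
          factor≤B f = ℚ.≤-trans (∣linear∣≤ (ρ f) {x t} (ℚ.≤-trans 0≤1 1≤b) (λ e → bndₜ e (c e)))
            (ℚ.*-monoʳ-≤-nonNeg b {{ℚ.nonNegative (ℚ.≤-trans 0≤1 1≤b)}} (slope f))
          η≤factor : ∀ f → η ℚ.≤ ∣ linear (ρ f) (x t) ∣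
          η≤factor f = *-cancelʳ-≤ (ℚ.<-≤-trans 0<1 (1≤power 1≤B len)) (ℚ.≤-trans (ℚ.≤-reflexive ηB≡)
            (ℚ.≤-trans large (∣product∣≤∣factor∣ ρ 1≤B factor≤B (allFin m) (∈-allFin f))))
          drift≤½η : ∀ f t′ → t ℕ.≤ t′ → ∣ linear (ρ f) (λ e → x t e ℚ.- x t′ e) ∣ ℚ.≤ ½ ℚ.* η
          drift≤½η f t′ t≤t′ = ℚ.≤-trans (∣linear∣≤ (ρ f) (ℚ.<⇒≤ 0<γ) (λ e → closeₜ e (c e) t′ t≤t′))
            (ℚ.≤-trans (ℚ.*-monoʳ-≤-nonNeg γ {{ℚ.nonNegative (ℚ.<⇒≤ 0<γ)}} (slope f))
              (ℚ.≤-reflexive (trans (ℚ.*-comm s γ) γs≡)))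
      in c , λ f → ½ ℚ.* η , *-pos 0<½ 0<η , t , λ t′ t≤t′ → subst (½ ℚ.* η ℚ.≤_)
           (trans (ℚ.∣-p∣≡∣p∣ (linear (ρ f) (x t′))) (cong ∣_∣ (sym (weightSum-difference (λ e → Vec.lookup (L e) (c e)) f t′))))
           (half-of-difference (linear-minus (ρ f) (x t) (x t′)) (η≤factor f) (drift≤½η f t′ t≤t′))

  edgeWeightChoosable : ∀ {N k} → Expansion.coef ℤ-domain Fin._≟_ (allFin m) ρ (allFin m) N ≢ 0ℤ →
                        (∀ e → N e ℕ.< k) → EdgeWeightChoosable G k
  edgeWeightChoosable occurs N<k L distinct =
    let c , proper = choose L distinct occurs N<k
        w = λ e → Vec.lookup (L e) (c e)
    in w , (λ e → Vec.∈-lookup (c e) (L e)) , λ u v uv → separate w proper (ends-surjective G uv)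
    where
    separate : ∀ w {u v} → (∀ f → weightSum G w (proj₂ (ends G f)) # weightSum G w (proj₁ (ends G f))) →
               ∃[ i ] (ends G i ≡ (u , v) ⊎ ends G i ≡ (v , u)) → weightSum G w u # weightSum G w v
    separate w {u} {v} proper (i , inj₁ eq) = #-sym (weightSum G w v) (weightSum G w u)
      (subst (λ e → weightSum G w (proj₂ e) # weightSum G w (proj₁ e)) eq (proper i))
    separate w {u} {v} proper (i , inj₂ eq) =
      subst (λ e → weightSum G w (proj₂ e) # weightSum G w (proj₁ e)) eq (proper i)

-- The monomial of `mind-box` again: lists with one value more than the bound on its exponents
-- suffice.
ch-box : ∀ {g n} (d : ℕ) (G : Graph g) (H : Graph n) {r} → Degenerate d G → IsRegularOf r H → 2 ℕ.≤ r →
         chΣᵉ[ G □ H ]≤ ([ n ℕ.* d ] +∞ mind H +∞ [ 1 ])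
ch-box {n = n} d G H degenerate regular 2≤r =
  let b , mind≡ , N , N≤ , occurs = box-monomial d G H degenerate regular 2≤r
  in subst (λ μ → chΣᵉ[ G □ H ]≤ ([ n ℕ.* d ] +∞ μ +∞ [ 1 ])) (sym mind≡)
       (n ℕ.* d ℕ.+ b ℕ.+ 1 , (ℕ.m≤n+m 1 (n ℕ.* d ℕ.+ b) ,
         edgeWeightChoosable (G □ H) occurs (λ e → ℕ.≤-trans (ℕ.s≤s (N≤ e)) (ℕ.≤-reflexive (ℕ.+-comm 1 (n ℕ.* d ℕ.+ b))))) ,
         Sup.[ ℕ.≤-refl ])

open import Data.Nat.Base using (_*_; _≤_)

theorem5p2 : ∀ {g n : ℕ} (d : ℕ) (G : Graph g) (H : Graph n) →
    3 ≤ n → Regular H → HasTwoFactor H → Degenerate d G →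
    (mind (G □ H) ≤∞ [ n * d ] +∞ mind H) ×
    (chΣᵉ[ G □ H ]≤ ([ n * d ] +∞ mind H +∞ [ 1 ]))
theorem5p2 d G H 3≤n (_ , regular) twoFactor degenerate =
  mind-box d G H degenerate regular 2≤r , ch-box d G H degenerate regular 2≤r
  where 2≤r = twoFactor⇒2≤r {H = H} 3≤n regular twoFactor
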